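{- Let $\lambda$, $\mathbf{a}=(a_\ell)_{\ell\ge0}$, $\mathbf{b}=(b_{\ell,\ell'})$, $\mathbf{c}=(c_{\ell,\ell'})$, $\mathbf{d}=(d_{\ell,\ell'})$ ($\ell,\ell'\ge0$), $\mathbf{e}=(e_\ell)$, $\mathbf{f}=(f_\ell)$ be commuting indeterminates. For $n\ge0$ let \[ \widehat{Q}'_n=\sum_{\sigma\in\mathfrak{D}_{2n}}\lambda^{\mathrm{cyc}(\sigma)}\prod_{i\in\mathrm{Cval}}a_{\mathrm{lcross}'(i,\sigma)+\mathrm{lnest}'(i,\sigma)}\prod_{i\in\mathrm{Cpeak}}b_{\mathrm{ucross}'(i,\sigma),\mathrm{unest}'(i,\sigma)}\prod_{i\in\mathrm{Cdfall}}c_{\mathrm{lcross}'(i,\sigma),\mathrm{lnest}'(i,\sigma)}\prod_{i\in\mathrm{Cdrise}}d_{\mathrm{ucross}'(i,\sigma),\mathrm{unest}'(i,\sigma)}\prod_{i\in\mathrm{Evenfix}}e_{\mathrm{psnest}(i,\sigma)}\prod_{i\in\mathrm{Oddfix}}f_{\mathrm{psnest}(i,\sigma)} \] and \[ \widehat{Q}_n=\sum_{\sigma\in\mathfrak{D}_{2n}}\lambda^{\mathrm{cyc}(\sigma)}\prod_{i\in\mathrm{Cval}}a_{\mathrm{ucross}(i,\sigma)+\mathrm{unest}(i,\sigma)}\prod_{i\in\mathrm{Cpeak}}b_{\mathrm{lcross}(i,\sigma),\mathrm{lnest}(i,\sigma)}\prod_{i\in\mathrm{Cdfall}}c_{\mathrm{lcross}(i,\sigma),\mathrm{lnest}(i,\sigma)}\prod_{i\in\mathrm{Cdrise}}d_{\mathrm{ucross}(i,\sigma),\mathrm{unest}(i,\sigma)}\prod_{i\in\mathrm{Evenfix}}e_{\mathrm{psnest}(i,\sigma)}\prod_{i\in\mathrm{Oddfix}}f_{\mathrm{psnest}(i,\sigma)}.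 \] Then \[ \sum_{n\ge0}\widehat{Q}'_nt^n=\cfrac{1}{1-\delta_1t-\cfrac{\alpha_1t}{1-\delta_2t-\cfrac{\alpha_2t}{1-\cdots}}} \] with, for $k\ge1$, $\alpha_{2k-1}=(\lambda+k-1)a_{k-1}\sum_{\xi=0}^{k-1}b_{k-1-\xi,\xi}$, $\alpha_{2k}=\big(\lambda e_k+\sum_{\xi=0}^{k-1}c_{k-1-\xi,\xi}\big)\big(\lambda f_k+\sum_{\xi=0}^{k-1}d_{k-1-\xi,\xi}\big)$, $\delta_1=\lambda^2e_0f_0$, $\delta_n=0$ for $n\ge2$ (the same T-fraction as for $\widehat{Q}_n$), and therefore $\widehat{Q}'_n=\widehat{Q}_n$ for all $n\ge0$.
   Context: A D-permutation of $[2n]$: $\sigma(2k-1)\ge2k-1$ and $\sigma(2k)\le2k$ for all $k$; $\mathfrak{D}_{2n}$ is their set. $\mathrm{Cpeak}=\{i:\sigma^{ -1}(i)<i>\sigma(i)\}$, $\mathrm{Cval}=\{i:\sigma^{ -1}(i)>i<\sigma(i)\}$, $\mathrm{Cdrise}=\{i:\sigma^{ -1}(i)<i<\sigma(i)\}$, $\mathrm{Cdfall}=\{i:\sigma^{ -1}(i)>i>\sigma(i)\}$, $\mathrm{Evenfix}$/$\mathrm{Oddfix}$ = even/odd fixed points. $\mathrm{cyc}$ = number of cycles. $\mathrm{ucross}(j,\sigma)=\#\{i<j<k<l:k=\sigma(i),l=\sigma(j)\}$, $\mathrm{unest}(j,\sigma)=\#\{i<j<k<l:k=\sigma(j),l=\sigma(i)\}$,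 $\mathrm{lcross}(k,\sigma)=\#\{i<j<k<l:i=\sigma(k),j=\sigma(l)\}$, $\mathrm{lnest}(k,\sigma)=\#\{i<j<k<l:i=\sigma(l),j=\sigma(k)\}$; $\mathrm{ucross}'(k,\sigma)=\#\{i<j<k<l:k=\sigma(i),l=\sigma(j)\}$, $\mathrm{unest}'(k,\sigma)=\#\{i<j<k<l:k=\sigma(j),l=\sigma(i)\}$, $\mathrm{lcross}'(j,\sigma)=\#\{i<j<k<l:i=\sigma(k),j=\sigma(l)\}$, $\mathrm{lnest}'(j,\sigma)=\#\{i<j<k<l:i=\sigma(l),j=\sigma(k)\}$ (each counts choices of the remaining three indices). For a fixed point $i$, $\mathrm{psnest}(i,\sigma)=\#\{j<i:\sigma(j)>i\}$. -}

module Defs where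

open import Level using (Level)
open import Data.Bool using (Bool; true; false; _∧_; _∨_; not; if_then_else_)
import Data.Nat
open import Data.Nat using (ℕ; zero; suc; _∸_; ⌊_/2⌋; _<ᵇ_; _≡ᵇ_; _≤ᵇ_)
open import Data.Fin using (Fin; toℕ)
import Data.Fin as Fin
open import Data.List using (List; []; _∷_; map; concatMap; allFin; upTo; filterᵇ; length; foldr)
open import Data.Vec as Vec using (Vec)
open import Algebra.Bundles using (CommutativeRing)

-- Combinatorics of D-permutations of [2n].
-- A permutation of [N] is a function σ : Fin N → Fin N (bijective);
-- the element i : Fin N stands for the integer pos i = toℕ i + 1 ∈ {1,…,N}.

allᵇ : {A : Set} → (A → Bool) → List A → Bool
allᵇ p xs = foldr (λ x r → p x ∧ r) true xs

pos : ∀ {N} → Fin N → ℕ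
pos i = suc (toℕ i)

_<F_ : ∀ {N} → Fin N → Fin N → Bool
i <F j = pos i <ᵇ pos j

_=F_ : ∀ {N} → Fin N → Fin N → Bool
i =F j = pos i ≡ᵇ pos j

isEvenᵇ : ℕ → Bool
isEvenᵇ zero = true
isEvenᵇ (suc n) = not (isEvenᵇ n)

countF : ∀ N → (Fin N → Bool) → ℕ
countF N p = length (filterᵇ p (allFin N))

consF : ∀ {m N} → Fin N → (Fin m → Fin N) → Fin (suc m) → Fin N
consF v g Fin.zero = v
consF v g (Fin.suc i) = g i

allFuns : ∀ m N → List (Fin m → Fin N)
allFuns zero N = (λ ()) ∷ []
allFuns (suc m) N = concatMap (λ v → map (consF v) (allFuns m N)) (allFin N)

isPermᵇ : ∀ {N} → (Fin N → Fin N) → Bool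
isPermᵇ {N} σ = allᵇ (λ i → allᵇ (λ j → not (σ i =F σ j) ∨ (i =F j)) (allFin N)) (allFin N)

isDᵇ : ∀ {N} → (Fin N → Fin N) → Bool
isDᵇ {N} σ = allᵇ (λ i → if isEvenᵇ (pos i) then pos (σ i) ≤ᵇ pos i else pos i ≤ᵇ pos (σ i)) (allFin N)

DPerms : (n : ℕ) → List (Fin (2 Data.Nat.* n) → Fin (2 Data.Nat.* n))
DPerms n = filterᵇ (λ σ → isPermᵇ σ ∧ isDᵇ σ) (allFuns (2 Data.Nat.* n) (2 Data.Nat.* n))

module _ {N : ℕ} (σ : Fin N → Fin N) where

  σ⁻¹ : Fin N → Fin N
  σ⁻¹ i = foldr (λ j acc → if σ j =F i then j else acc) i (allFin N)

  iter : ℕ → Fin N → Fin N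
  iter zero i = i
  iter (suc k) i = σ (iter k i)

  -- number of cycles: count the elements that are minimal in their cycle
  cyc : ℕ
  cyc = countF N (λ i → allᵇ (λ k → pos i ≤ᵇ pos (iter k i)) (upTo N))

  sumℕ : List ℕ → ℕ
  sumℕ = foldr Data.Nat._+_ 0

  count3 : (Fin N → Fin N → Fin N → Bool) → ℕ
  count3 P = sumℕ (map (λ x → sumℕ (map (λ y → countF N (λ z → P x y z)) (allFin N))) (allFin N))

  lt4 : Fin N → Fin N → Fin N → Fin N → Bool
  lt4 i j k l = (i <F j) ∧ (j <F k) ∧ (k <F l)

  ucross : Fin N → ℕ
  ucross j = count3 (λ i k l → lt4 i j k l ∧ (k =F σ i) ∧ (l =F σ j))
  unest : Fin N → ℕ
  unest j = count3 (λ i k l → lt4 i j k l ∧ (k =F σ j) ∧ (l =F σ i))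
  lcross : Fin N → ℕ
  lcross k = count3 (λ i j l → lt4 i j k l ∧ (i =F σ k) ∧ (j =F σ l))
  lnest : Fin N → ℕ
  lnest k = count3 (λ i j l → lt4 i j k l ∧ (i =F σ l) ∧ (j =F σ k))
  ucross′ : Fin N → ℕ
  ucross′ k = count3 (λ i j l → lt4 i j k l ∧ (k =F σ i) ∧ (l =F σ j))
  unest′ : Fin N → ℕ
  unest′ k = count3 (λ i j l → lt4 i j k l ∧ (k =F σ j) ∧ (l =F σ i))
  lcross′ : Fin N → ℕ
  lcross′ j = count3 (λ i k l → lt4 i j k l ∧ (i =F σ k) ∧ (j =F σ l))
  lnest′ : Fin N → ℕ
  lnest′ j = count3 (λ i k l → lt4 i j k l ∧ (i =F σ l) ∧ (j =F σ k))

  psnest : Fin N → ℕ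
  psnest i = countF N (λ j → (j <F i) ∧ (i <F σ j))

  isCpeak isCval isCdrise isCdfall isEvenfix isOddfix : Fin N → Bool
  isCpeak i = (σ⁻¹ i <F i) ∧ (σ i <F i)
  isCval i = (i <F σ⁻¹ i) ∧ (i <F σ i)
  isCdrise i = (σ⁻¹ i <F i) ∧ (i <F σ i)
  isCdfall i = (i <F σ⁻¹ i) ∧ (σ i <F i)
  isEvenfix i = (σ i =F i) ∧ isEvenᵇ (pos i)
  isOddfix i = (σ i =F i) ∧ not (isEvenᵇ (pos i))

-- Everything ring-valued, over an arbitrary commutative ring R
-- (the indeterminates are arbitrary elements of R).

module Ring {c ℓ : Level} (R : CommutativeRing c ℓ) where
  open CommutativeRing R

  _−_ : Carrier → Carrier → Carrier
  x − y = x + (- y)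

  sumR : List Carrier → Carrier
  sumR = foldr _+_ 0#

  prodR : List Carrier → Carrier
  prodR = foldr _*_ 1#

  natR : ℕ → Carrier
  natR zero = 0#
  natR (suc n) = 1# + natR n

  _^R_ : Carrier → ℕ → Carrier
  x ^R zero = 1#
  x ^R suc n = x * x ^R n

  prodOver : (N : ℕ) → (Fin N → Bool) → (Fin N → Carrier) → Carrier
  prodOver N S w = prodR (map (λ i → if S i then w i else 1#) (allFin N))

  module _ (lam : Carrier) (a : ℕ → Carrier) (b c′ d : ℕ → ℕ → Carrier)
           (e f : ℕ → Carrier) where

    weight′ : ∀ {N} → (Fin N → Fin N) → Carrier
    weight′ {N} σ =
      lam ^R cyc σ
      * prodOver N (isCval σ) (λ i → a (lcross′ σ i Data.Nat.+ lnest′ σ i))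
      * prodOver N (isCpeak σ) (λ i → b (ucross′ σ i) (unest′ σ i))
      * prodOver N (isCdfall σ) (λ i → c′ (lcross′ σ i) (lnest′ σ i))
      * prodOver N (isCdrise σ) (λ i → d (ucross′ σ i) (unest′ σ i))
      * prodOver N (isEvenfix σ) (λ i → e (psnest σ i))
      * prodOver N (isOddfix σ) (λ i → f (psnest σ i))

    weight : ∀ {N} → (Fin N → Fin N) → Carrier
    weight {N} σ =
      lam ^R cyc σ
      * prodOver N (isCval σ) (λ i → a (ucross σ i Data.Nat.+ unest σ i))
      * prodOver N (isCpeak σ) (λ i → b (lcross σ i) (lnest σ i))
      * prodOver N (isCdfall σ) (λ i → c′ (lcross σ i) (lnest σ i))
      * prodOver N (isCdrise σ) (λ i → d (ucross σ i) (unest σ i))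
      * prodOver N (isEvenfix σ) (λ i → e (psnest σ i))
      * prodOver N (isOddfix σ) (λ i → f (psnest σ i))

    Qhat′ : ℕ → Carrier
    Qhat′ n = sumR (map weight′ (DPerms n))

    Qhat : ℕ → Carrier
    Qhat n = sumR (map weight (DPerms n))

    -- Σ_{ξ=0}^{k-1} x_{k-1-ξ,ξ}, written with j = k-1
    diagSum : (ℕ → ℕ → Carrier) → ℕ → Carrier
    diagSum x j = sumR (map (λ ξ → x (j ∸ ξ) ξ) (upTo (suc j)))

    -- α_{2k-1} and α_{2k}, for k = suc j
    αodd αeven : ℕ → Carrier
    αodd j = (lam + natR j) * a j * diagSum b j
    αeven j = (lam * e (suc j) + diagSum c′ j) * (lam * f (suc j) + diagSum d j)

    -- α_n (n ≥ 1; α_0 is unused): n = suc m, k = ⌊m/2⌋ + 1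
    α : ℕ → Carrier
    α zero = 0#
    α (suc m) = if isEvenᵇ m then αodd ⌊ m /2⌋ else αeven ⌊ m /2⌋

    δ : ℕ → Carrier
    δ (suc zero) = lam * lam * e 0 * f 0
    δ _ = 0#

  Series : Set c
  Series = ℕ → Carrier

  oneS : Series
  oneS zero = 1#
  oneS (suc _) = 0#

  _⊖_ : Series → Series → Series
  (F ⊖ G) n = F n − G n

  tS : Series → Series
  tS F zero = 0#
  tS F (suc n) = F n

  constS : Carrier → Series
  constS x zero = x
  constS x (suc _) = 0#

  scaleS : Carrier → Series → Series
  scaleS x F n = x * F n

  -- first n+1 coefficients of 1/F (F with constant term 1), newest first:
  -- g_0 = 1, g_{n+1} = - Σ_{k=1}^{n+1} F_k g_{n+1-k}
  invRev : Series → (n : ℕ) → Vec Carrier (suc n)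
  invRev F zero = 1# Vec.∷ Vec.[]
  invRev F (suc n) =
    (- Vec.foldr _ _+_ 0#
         (Vec.zipWith _*_ (Vec.tabulate (λ k → F (suc (toℕ k)))) (invRev F n)))
    Vec.∷ invRev F n

  invS : Series → Series
  invS F n = Vec.head (invRev F n)

  -- depth-m truncation of the T-fraction starting at level j:
  --   T j 0 = 1,  T j (m+1) = 1 / (1 − δ_j t − α_j t · T (j+1) m)
  -- so T 1 m is the m-th convergent of
  --   1/(1 − δ_1 t − α_1 t/(1 − δ_2 t − α_2 t/(1 − ⋯)))
  Tfrac : (ℕ → Carrier) → (ℕ → Carrier) → ℕ → ℕ → Series
  Tfrac δs αs j zero = oneS
  Tfrac δs αs j (suc m) =
    invS ((oneS ⊖ tS (constS (δs j))) ⊖ tS (scaleS (αs j) (Tfrac δs αs (suc j) m)))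

-- Place the elements of a permutation from the largest one down. The arcs placed
-- so far form closed cycles and k open paths, and the statistics of an element
-- depend only on its image and on the images of the larger elements. A cycle
-- valley may be sent to any of the k values not yet hit, all with the same weight,
-- and exactly one of them closes a cycle: this gives λ + k − 1. A peak, double fall
-- or double rise chooses a rank among the open paths and never closes a cycle, and
-- a fixed point contributes λ. Hence the sum over all partial configurations
-- depends on k alone and obeys a three-term recurrence; on D-permutations it
-- alternates between two kinds of steps and counts Dyck paths, whose first-passage
-- decomposition is the T-fraction. The primed statistics of σ are the unprimed ones
-- of σ⁻¹ with double rises and double falls exchanged, and this exchange leaves the
-- recurrence unchanged.

module Submission where

open import Defs
open import Level using (Level)
open import Algebra.Bundles using (CommutativeMonoid; CommutativeRing)
import Algebra.Properties.CommutativeMonoid.Sum as MonoidSum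
import Algebra.Properties.Group as GroupProperties
import Algebra.Properties.Ring as RingProperties
import Relation.Binary.Reasoning.Setoid as SetoidReasoning
open import Data.Bool using (Bool; true; false; _∧_; _∨_; not; if_then_else_)
open import Data.Bool.Properties using (∧-zeroʳ; ∧-identityʳ; ∧-comm; ∧-assoc; if-float)
open import Data.Empty using (⊥; ⊥-elim)
open import Data.Fin using (Fin; toℕ; fromℕ<)
import Data.Fin as Fin
import Data.Fin.Properties as Fin
open import Data.List using (List; []; _∷_; length; map; upTo; applyUpTo; tabulate; allFin; concatMap; filterᵇ; foldr; _++_)
open import Data.List.Properties using (length-map; tabulate-cong)
open import Data.List.Membership.Propositional using (_∈_)
open import Data.List.Membership.Propositional.Properties using (∈-allFin; ∈-upTo⁺)
open import Data.List.Relation.Unary.All using (All; []; _∷_)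
open import Data.List.Relation.Unary.Any using (here; there)
open import Data.Nat using (ℕ; zero; suc; _+_; _*_; _∸_; pred; _≤_; _<_; z≤n; s≤s; _<ᵇ_; _≡ᵇ_; _≤ᵇ_; ⌊_/2⌋)
open import Data.Nat.Properties
open import Data.Product using (_×_; _,_; proj₁; proj₂; ∃)
open import Data.Sum using (_⊎_; inj₁; inj₂)
import Data.Vec as Vec
open import Function using (_∘_; id)
open import Relation.Binary.Definitions using (tri<; tri≈; tri>)
open import Relation.Binary.PropositionalEquality
  using (_≡_; _≢_; refl; sym; trans; cong; cong₂; subst; module ≡-Reasoning)
open import Relation.Nullary using (yes; no)

-- Finite sums and counts over ℕ

-- The D-condition is not imposed on partial configurations. The recurrence is proved for all
-- permutations, with weights that may depend on the number of larger elements; the moves excluded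
-- at a given parity then receive weight zero. What makes the sum depend on so little is
-- relabelling: a value no longer available to the remaining list is deleted and the gap closed by
-- `punch`. Every statistic only compares labels, so no weight changes, and the shortened lists
-- again range over all states with a smaller ground set. The single nonzero δ comes from the bottom
-- of the path picture. With k open paths the height is 2k after an even and 2k - 1 after an odd
-- number of placed elements. A move keeping k ≥ 1 thus becomes an ordinary up or down step, but at
-- k = 0 a path visits height -1 and returns; this loop has weight (λ e 0)(λ f 0), which is δ 1. The
-- infinite fraction is never formed. Its truncation at depth m is exact up to the coefficient m, so
-- the identities between series that involve truncations are tracked to finite order.

bool-ext : ∀ {x y} → (x ≡ true → y ≡ true) → (y ≡ true → x ≡ true) → x ≡ y
bool-ext {false} {false} f g = refl
bool-ext {false} {true}  f g = g refl
bool-ext {true}  {false} f g = sym (f refl)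
bool-ext {true}  {true}  f g = refl

true≢false : ∀ {x} → x ≡ true → x ≡ false → ⊥
true≢false refl ()

≢true⇒false : ∀ {x} → (x ≡ true → ⊥) → x ≡ false
≢true⇒false {false} f = refl
≢true⇒false {true}  f = ⊥-elim (f refl)

∧-true : ∀ {x y} → x ≡ true → y ≡ true → (x ∧ y) ≡ true
∧-true refl refl = refl

∧-true₁ : ∀ {x y} → (x ∧ y) ≡ true → x ≡ true
∧-true₁ {true} _ = refl

∧-true₂ : ∀ {x y} → (x ∧ y) ≡ true → y ≡ true
∧-true₂ {true} p = p

∨-true₁ : ∀ {x y} → x ≡ true → (x ∨ y) ≡ true
∨-true₁ refl = refl

∨-true₂ : ∀ {x y} → y ≡ true → (x ∨ y) ≡ true
∨-true₂ {true}  _ = refl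
∨-true₂ {false} p = p

∨-split : ∀ {x y} → (x ∨ y) ≡ true → (x ≡ true) ⊎ (y ≡ true)
∨-split {true}  _ = inj₁ refl
∨-split {false} p = inj₂ p

not-true : ∀ {x} → not x ≡ true → x ≡ false
not-true {false} _ = refl

not-false : ∀ {x} → x ≡ false → not x ≡ true
not-false refl = refl

<ᵇ-true : ∀ {m n} → m < n → (m <ᵇ n) ≡ true
<ᵇ-true {zero}  (s≤s _) = refl
<ᵇ-true {suc m} (s≤s p) = <ᵇ-true p

<ᵇ-false : ∀ {m n} → n ≤ m → (m <ᵇ n) ≡ false
<ᵇ-false {m}     z≤n     = refl
<ᵇ-false {suc m} (s≤s p) = <ᵇ-false p

true-<ᵇ : ∀ {m n} → (m <ᵇ n) ≡ true → m < n
true-<ᵇ {m} {n} p = ≰⇒> λ q → true≢false p (<ᵇ-false q)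

≡ᵇ-refl : ∀ n → (n ≡ᵇ n) ≡ true
≡ᵇ-refl zero    = refl
≡ᵇ-refl (suc n) = ≡ᵇ-refl n

≡ᵇ-true : ∀ {m n} → m ≡ n → (m ≡ᵇ n) ≡ true
≡ᵇ-true {m} refl = ≡ᵇ-refl m

true-≡ᵇ : ∀ {m n} → (m ≡ᵇ n) ≡ true → m ≡ n
true-≡ᵇ {zero}  {zero}  _ = refl
true-≡ᵇ {suc m} {suc n} p = cong suc (true-≡ᵇ p)

≡ᵇ-false : ∀ {m n} → m ≢ n → (m ≡ᵇ n) ≡ false
≡ᵇ-false m≢n = ≢true⇒false (m≢n ∘ true-≡ᵇ)

-- Fin.punchIn on ℕ: the increasing enumeration of ℕ ∖ {p}.
punch : ℕ → ℕ → ℕ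
punch zero    x       = suc x
punch (suc p) zero    = zero
punch (suc p) (suc x) = suc (punch p x)

punch-< : ∀ {p x} → x < p → punch p x ≡ x
punch-< {suc p} {zero}  _       = refl
punch-< {suc p} {suc x} (s≤s q) = cong suc (punch-< q)

punch-≥ : ∀ {p x} → p ≤ x → punch p x ≡ suc x
punch-≥ {zero}          _       = refl
punch-≥ {suc p} {suc x} (s≤s q) = cong suc (punch-≥ q)

punch-≢ : ∀ p x → punch p x ≢ p
punch-≢ (suc p) (suc x) q = punch-≢ p x (cong pred q)

punch-<ᵇ : ∀ p x y → (punch p x <ᵇ punch p y) ≡ (x <ᵇ y)
punch-<ᵇ zero    x       y       = refl
punch-<ᵇ (suc p) zero    zero    = refl
punch-<ᵇ (suc p) zero    (suc y) = refl
punch-<ᵇ (suc p) (suc x) zero    = refl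
punch-<ᵇ (suc p) (suc x) (suc y) = punch-<ᵇ p x y

punch-≡ᵇ : ∀ p x y → (punch p x ≡ᵇ punch p y) ≡ (x ≡ᵇ y)
punch-≡ᵇ zero    x       y       = refl
punch-≡ᵇ (suc p) zero    zero    = refl
punch-≡ᵇ (suc p) zero    (suc y) = refl
punch-≡ᵇ (suc p) (suc x) zero    = refl
punch-≡ᵇ (suc p) (suc x) (suc y) = punch-≡ᵇ p x y

module Sums {a ℓ} (M : CommutativeMonoid a ℓ) where
  open CommutativeMonoid M renaming (refl to ≈-refl; sym to ≈-sym; trans to ≈-trans; reflexive to ≈-reflexive)
  open MonoidSum M using (sum; ∑-distrib-+)
  open SetoidReasoning setoid

  ∑ : ℕ → (ℕ → Carrier) → Carrier
  ∑ zero    f = ε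
  ∑ (suc n) f = f 0 ∙ ∑ n (f ∘ suc)

  ∑-sum : ∀ n f → ∑ n f ≡ sum {n} (f ∘ toℕ)
  ∑-sum zero    f = refl
  ∑-sum (suc n) f = cong (f 0 ∙_) (∑-sum n (f ∘ suc))

  ∑-cong : ∀ n {f g} → (∀ x → x < n → f x ≈ g x) → ∑ n f ≈ ∑ n g
  ∑-cong zero    h = ≈-refl
  ∑-cong (suc n) h = ∙-cong (h 0 (s≤s z≤n)) (∑-cong n λ x x<n → h (suc x) (s≤s x<n))

  ∑-zero : ∀ n {f} → (∀ x → x < n → f x ≈ ε) → ∑ n f ≈ ε
  ∑-zero zero    h = ≈-refl
  ∑-zero (suc n) h = ≈-trans (∙-cong (h 0 (s≤s z≤n)) (∑-zero n λ x x<n → h (suc x) (s≤s x<n))) (identityˡ ε)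

  ∑-+ : ∀ n f g → ∑ n (λ x → f x ∙ g x) ≈ ∑ n f ∙ ∑ n g
  ∑-+ n f g rewrite ∑-sum n f | ∑-sum n g | ∑-sum n (λ x → f x ∙ g x) = ∑-distrib-+ {n} _ _

  ∑-swap : ∀ m n (f : ℕ → ℕ → Carrier) → ∑ m (λ x → ∑ n (f x)) ≈ ∑ n (λ y → ∑ m (λ x → f x y))
  ∑-swap zero    n f = ≈-sym (∑-zero n λ _ _ → ≈-refl)
  ∑-swap (suc m) n f = ≈-trans (∙-congˡ (∑-swap m n (f ∘ suc)))
                               (≈-sym (∑-+ n (f 0) (λ y → ∑ m (λ x → f (suc x) y))))

  ∑-remove : ∀ n p f → p ≤ n → ∑ (suc n) f ≈ f p ∙ ∑ n (f ∘ punch p)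
  ∑-remove n       zero    f _         = ≈-refl
  ∑-remove (suc n) (suc p) f (s≤s p≤n) = begin
    f 0 ∙ ∑ (suc n) (f ∘ suc)                           ≈⟨ ∙-congˡ (∑-remove n p (f ∘ suc) p≤n) ⟩
    f 0 ∙ (f (suc p) ∙ ∑ n (f ∘ suc ∘ punch p))         ≈⟨ assoc _ _ _ ⟨
    (f 0 ∙ f (suc p)) ∙ ∑ n (f ∘ suc ∘ punch p)         ≈⟨ ∙-congʳ (comm _ _) ⟩
    (f (suc p) ∙ f 0) ∙ ∑ n (f ∘ suc ∘ punch p)         ≈⟨ assoc _ _ _ ⟩
    f (suc p) ∙ (f 0 ∙ ∑ n (f ∘ suc ∘ punch p))         ∎

  ∑-append : ∀ k m f → ∑ (k + m) f ≈ ∑ k f ∙ ∑ m (λ j → f (k + j))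
  ∑-append zero    m f = ≈-sym (identityˡ _)
  ∑-append (suc k) m f = ≈-trans (∙-congˡ (∑-append k m (f ∘ suc))) (≈-sym (assoc _ _ _))

  ∑-last : ∀ n f → ∑ (suc n) f ≈ ∑ n f ∙ f n
  ∑-last n f = ≈-trans (∑-remove n n f ≤-refl)
    (≈-trans (comm _ _) (∙-congʳ (∑-cong n λ x x<n → ≈-reflexive (cong f (punch-< x<n)))))

  ∑-single : ∀ n p f → p < n → (∀ x → x < n → x ≢ p → f x ≈ ε) → ∑ n f ≈ f p
  ∑-single (suc n) p f (s≤s p≤n) h = ≈-trans (∑-remove n p f p≤n)
    (≈-trans (∙-congˡ (∑-zero n λ x x<n → h (punch p x) (bound x x<n) (punch-≢ p x))) (identityʳ _))
    where
    bound : ∀ x → x < n → punch p x < suc n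
    bound x x<n with <-≤-connex x p
    ... | inj₁ q = subst (_< suc n) (sym (punch-< q)) (m<n⇒m<1+n x<n)
    ... | inj₂ q = subst (_< suc n) (sym (punch-≥ q)) (s≤s x<n)

  ∑-reverse : ∀ n f → ∑ n f ≈ ∑ n (λ x → f (pred n ∸ x))
  ∑-reverse zero    f = ≈-refl
  ∑-reverse (suc n) f = begin
    f 0 ∙ ∑ n (f ∘ suc)                     ≈⟨ ∙-congˡ (∑-reverse n (f ∘ suc)) ⟩
    f 0 ∙ ∑ n (λ x → f (suc (pred n ∸ x)))  ≈⟨ comm _ _ ⟩
    ∑ n (λ x → f (suc (pred n ∸ x))) ∙ f 0
      ≈⟨ ∙-cong (∑-cong n λ x x<n → ≈-reflexive (cong f (shift x<n))) (≈-reflexive (cong f (sym (n∸n≡0 n)))) ⟩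
    ∑ n (λ x → f (n ∸ x)) ∙ f (n ∸ n)       ≈⟨ ∑-last n (λ x → f (n ∸ x)) ⟨
    ∑ (suc n) (λ x → f (n ∸ x))             ∎
    where
    shift : ∀ {x n} → x < n → suc (pred n ∸ x) ≡ n ∸ x
    shift {x} {suc n} (s≤s x≤n) = sym (+-∸-assoc 1 x≤n)

  -- Both sides are iterated sums, in the two orders, of the matrix whose entry at (x, y) is f y if
  -- y is s x and neutral otherwise.
  ∑-reindex : ∀ n (s t : ℕ → ℕ) f → (∀ x → x < n → t x < n) → (∀ x → x < n → s x < n) →
              (∀ x → x < n → t (s x) ≡ x) → (∀ x → x < n → s (t x) ≡ x) → ∑ n (f ∘ s) ≈ ∑ n f
  ∑-reindex n s t f t< s< ts st = begin
    ∑ n (f ∘ s)                         ≈⟨ ∑-cong n (λ x p → ≈-sym (≈-trans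
                                             (∑-single n (s x) (λ y → δ y (s x)) (s< x p) (λ y q y≢ → ≈-reflexive (at-false _ (≡ᵇ-false y≢))))
                                             (≈-reflexive (at-true _ (≡ᵇ-refl (s x)))))) ⟩
    ∑ n (λ x → ∑ n (λ y → δ y (s x)))   ≈⟨ ∑-swap n n (λ x y → δ y (s x)) ⟩
    ∑ n (λ y → ∑ n (λ x → δ y (s x)))   ≈⟨ ∑-cong n (λ y q → ≈-trans
                                             (∑-single n (t y) (λ x → δ y (s x)) (t< y q) (λ x p x≢ → ≈-reflexive (at-false _ (≡ᵇ-false
                                               λ y≡sx → x≢ (sym (trans (cong t y≡sx) (ts x p)))))))
                                             (≈-reflexive (at-true _ (≡ᵇ-true (sym (st y q)))))) ⟩
    ∑ n f                               ∎
    where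
    δ : ℕ → ℕ → Carrier
    δ y z = if y ≡ᵇ z then f y else ε
    at-false : ∀ {b} y → b ≡ false → (if b then f y else ε) ≡ ε
    at-false _ refl = refl
    at-true : ∀ {b} y → b ≡ true → (if b then f y else ε) ≡ f y
    at-true _ refl = refl

module ℕΣ = Sums +-0-commutativeMonoid

ind : Bool → ℕ
ind true  = 1
ind false = 0

# : ℕ → (ℕ → Bool) → ℕ
# n p = ℕΣ.∑ n (λ x → ind (p x))

#-cong : ∀ n {p q : ℕ → Bool} → (∀ x → x < n → p x ≡ q x) → # n p ≡ # n q
#-cong n h = ℕΣ.∑-cong n (λ x x<n → cong ind (h x x<n))

#-remove : ∀ n p q → p ≤ n → q p ≡ false → # (suc n) q ≡ # n (q ∘ punch p)
#-remove n p q p≤n qp = trans (ℕΣ.∑-remove n p (ind ∘ q) p≤n) (cong (λ b → ind b + # n (q ∘ punch p)) qp)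

#-none : ∀ n {q : ℕ → Bool} → (∀ x → x < n → q x ≡ false) → # n q ≡ 0
#-none n h = ℕΣ.∑-zero n (λ x x<n → cong ind (h x x<n))

#-below : ∀ n k → k ≤ n → # n (λ q → q <ᵇ k) ≡ k
#-below n       zero    _       = #-none n (λ _ _ → refl)
#-below (suc n) (suc k) (s≤s p) = cong suc (#-below n k p)

#-between : ∀ n v k → k ≤ n → # n (λ q → (v <ᵇ q) ∧ (q <ᵇ k)) ≡ k ∸ suc v
#-between n       v       zero    _       = trans (#-none n λ x _ → ∧-false₂ (v <ᵇ x)) refl
  where
  ∧-false₂ : ∀ b → (b ∧ false) ≡ false
  ∧-false₂ false = refl
  ∧-false₂ true  = refl
#-between (suc n) zero    (suc k) (s≤s p) = #-below n k p
#-between (suc n) (suc v) (suc k) (s≤s p) = #-between n v k p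

-- Partial permutations as lists of images

-- A list g, placed at position k, is the partial map k ↦ g₀, k+1 ↦ g₁, …
-- with values below k + length g: the restriction of a permutation to its
-- largest arguments, the values below k standing for the ends of the
-- descending arcs still open at k, in increasing order.

hit : List ℕ → ℕ → Bool
hit []      q = false
hit (v ∷ g) q = (v ≡ᵇ q) ∨ hit g q

inj : List ℕ → Bool
inj []      = true
inj (v ∷ g) = not (hit g v) ∧ inj g

allBelow : ℕ → (ℕ → Bool) → Bool
allBelow zero    p = true
allBelow (suc k) p = p k ∧ allBelow k p

full : ℕ → List ℕ → Bool
full k g = allBelow k (hit g)

-- The first point below k on the orbit of x under the partial map g placed
-- at position k (a junk value ≥ k if the orbit does not leave g).
exit : ℕ → List ℕ → ℕ → ℕ
exit k []      x = x
exit k (v ∷ g) x = if exit (suc k) g x ≡ᵇ k then exit (suc k) g v else exit (suc k) g x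

-- lcross, lnest, ucross, unest and psnest of the element k with image v,
-- where g lists the images of k+1, k+2, … and n is the size of the ground set.
lcr lne ucr une : ℕ → ℕ → ℕ → List ℕ → ℕ
lcr n k v g = # n (λ q → ((v <ᵇ q) ∧ (q <ᵇ k)) ∧ hit g q)
lne n k v g = # n (λ q → (q <ᵇ v) ∧ hit g q)
ucr n k v g = # n (λ q → (k <ᵇ q) ∧ ((q <ᵇ v) ∧ not (hit g q)))
une n k v g = # n (λ q → (k <ᵇ q) ∧ ((v <ᵇ q) ∧ not (hit g q)))

psn : ℕ → ℕ → List ℕ → ℕ
psn n k g = # n (λ q → (q <ᵇ k) ∧ hit g q)

allBelow-true : ∀ k {p} → allBelow k p ≡ true → ∀ q → q < k → p q ≡ true
allBelow-true (suc k) h q (s≤s q≤k) with m≤n⇒m<n∨m≡n q≤k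
... | inj₁ q<k  = allBelow-true k (∧-true₂ h) q q<k
... | inj₂ refl = ∧-true₁ h

allBelow-cong : ∀ k {p r : ℕ → Bool} → (∀ q → q < k → p q ≡ r q) → allBelow k p ≡ allBelow k r
allBelow-cong zero    h = refl
allBelow-cong (suc k) h = cong₂ _∧_ (h k ≤-refl) (allBelow-cong k λ q q<k → h q (m<n⇒m<1+n q<k))

allBelow-punch : ∀ k v p → v ≤ k → p v ≡ true → allBelow (suc k) p ≡ allBelow k (p ∘ punch v)
allBelow-punch k v p v≤k pv with m≤n⇒m<n∨m≡n v≤k
... | inj₂ refl = trans (cong (_∧ allBelow k p) pv)
                        (allBelow-cong k λ q q<k → cong p (sym (punch-< q<k)))
allBelow-punch (suc k) v p _ pv | inj₁ (s≤s v≤k) =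
  cong₂ _∧_ (cong p (sym (punch-≥ v≤k))) (allBelow-punch k v p v≤k pv)

module _ (p : ℕ) where

  hit-punch : ∀ g x → hit (map (punch p) g) (punch p x) ≡ hit g x
  hit-punch []      x = refl
  hit-punch (v ∷ g) x = cong₂ _∨_ (punch-≡ᵇ p v x) (hit-punch g x)

  hit-punch-hole : ∀ g → hit (map (punch p) g) p ≡ false
  hit-punch-hole []      = refl
  hit-punch-hole (v ∷ g) = cong₂ _∨_ (≡ᵇ-false (punch-≢ p v)) (hit-punch-hole g)

  inj-punch : ∀ g → inj (map (punch p) g) ≡ inj g
  inj-punch []      = refl
  inj-punch (v ∷ g) = cong₂ _∧_ (cong not (hit-punch g v)) (inj-punch g)

  -- Relabelling conjugates the partial map. Because p ≤ k, `punch p` raises k and every larger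
  -- label by exactly one, which is why the position moves from k to `suc k`.
  exit-punch : ∀ k g x → p ≤ k → exit (suc k) (map (punch p) g) (punch p x) ≡ punch p (exit k g x)
  exit-punch k []      x p≤k = refl
  exit-punch k (v ∷ g) x p≤k
    rewrite exit-punch (suc k) g x (m≤n⇒m≤1+n p≤k)
          | exit-punch (suc k) g v (m≤n⇒m≤1+n p≤k)
    = trans (cong (λ b → if b then punch p (exit (suc k) g v) else punch p y) at-k)
            (sym (if-float (punch p) (y ≡ᵇ k)))
    where
    y = exit (suc k) g x
    at-k : (punch p y ≡ᵇ suc k) ≡ (y ≡ᵇ k)
    at-k = trans (cong (punch p y ≡ᵇ_) (sym (punch-≥ p≤k))) (punch-≡ᵇ p y k)

  module _ (n k : ℕ) (p≤n : p ≤ n) (p≤k : p ≤ k) where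

    private
      <k : ∀ q → (punch p q <ᵇ suc k) ≡ (q <ᵇ k)
      <k q = trans (cong (punch p q <ᵇ_) (sym (punch-≥ p≤k))) (punch-<ᵇ p q k)

      k< : ∀ q → (suc k <ᵇ punch p q) ≡ (k <ᵇ q)
      k< q = trans (cong (_<ᵇ punch p q) (sym (punch-≥ p≤k))) (punch-<ᵇ p k q)

      p-low : ∀ b → (suc k <ᵇ p) ∧ b ≡ false
      p-low b = cong (_∧ b) (<ᵇ-false (m≤n⇒m≤1+n p≤k))

      p-hole : ∀ b g → b ∧ hit (map (punch p) g) p ≡ false
      p-hole b g = trans (cong (b ∧_) (hit-punch-hole g)) (∧-zeroʳ b)

    -- The only extra summand is at the new label p, and it vanishes: p is not hit in this count and
    -- those of nestings below and of fixed points, and p is not above `suc k` in the two upper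
    -- counts.
    lcr-punch : ∀ v g → lcr (suc n) (suc k) (punch p v) (map (punch p) g) ≡ lcr n k v g
    lcr-punch v g = trans (#-remove n p (λ q → ((punch p v <ᵇ q) ∧ (q <ᵇ suc k)) ∧ hit (map (punch p) g) q) p≤n (p-hole ((punch p v <ᵇ p) ∧ (p <ᵇ suc k)) g)) (#-cong n λ q _ →
      cong₂ _∧_ (cong₂ _∧_ (punch-<ᵇ p v q) (<k q)) (hit-punch g q))

    lne-punch : ∀ v g → lne (suc n) (suc k) (punch p v) (map (punch p) g) ≡ lne n k v g
    lne-punch v g = trans (#-remove n p (λ q → (q <ᵇ punch p v) ∧ hit (map (punch p) g) q) p≤n (p-hole (p <ᵇ punch p v) g)) (#-cong n λ q _ →
      cong₂ _∧_ (punch-<ᵇ p q v) (hit-punch g q))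

    ucr-punch : ∀ v g → ucr (suc n) (suc k) (punch p v) (map (punch p) g) ≡ ucr n k v g
    ucr-punch v g = trans (#-remove n p (λ q → (suc k <ᵇ q) ∧ ((q <ᵇ punch p v) ∧ not (hit (map (punch p) g) q))) p≤n (p-low _)) (#-cong n λ q _ →
      cong₂ _∧_ (k< q) (cong₂ _∧_ (punch-<ᵇ p q v) (cong not (hit-punch g q))))

    une-punch : ∀ v g → une (suc n) (suc k) (punch p v) (map (punch p) g) ≡ une n k v g
    une-punch v g = trans (#-remove n p (λ q → (suc k <ᵇ q) ∧ ((punch p v <ᵇ q) ∧ not (hit (map (punch p) g) q))) p≤n (p-low _)) (#-cong n λ q _ →
      cong₂ _∧_ (k< q) (cong₂ _∧_ (punch-<ᵇ p v q) (cong not (hit-punch g q))))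

    psn-punch : ∀ g → psn (suc n) (suc k) (map (punch p) g) ≡ psn n k g
    psn-punch g = trans (#-remove n p (λ q → (q <ᵇ suc k) ∧ hit (map (punch p) g) q) p≤n (p-hole (p <ᵇ suc k) g)) (#-cong n λ q _ →
      cong₂ _∧_ (<k q) (hit-punch g q))

ind-unhit : ∀ v g x → hit g v ≡ false →
            ind (not (hit g x)) ≡ ind (not (hit (v ∷ g) x)) + ind (v ≡ᵇ x)
ind-unhit v g x hv with v ≡ᵇ x in eq
... | false = sym (+-identityʳ _)
... | true rewrite sym (true-≡ᵇ {v} {x} eq) | hv = refl

#-eq : ∀ n v → v < n → # n (v ≡ᵇ_) ≡ 1
#-eq n v v<n = trans (ℕΣ.∑-single n v (λ x → ind (v ≡ᵇ x)) v<n (λ x _ x≢v → cong ind (≡ᵇ-false (x≢v ∘ sym))))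
                     (cong ind (≡ᵇ-refl v))

#-unhit : ∀ n k g → k + length g ≡ n → All (_< n) g → inj g ≡ true → # n (not ∘ hit g) ≡ k
#-unhit n k []      refl []          _ = subst (λ j → # j (λ _ → true) ≡ k) (sym (+-identityʳ k))
                                         (trans (#-cong k (λ x x<k → sym (<ᵇ-true x<k))) (#-below k k ≤-refl))
#-unhit n k (v ∷ g) eq  (v<n ∷ g<n) h = +-cancelʳ-≡ 1 _ _ (begin
  # n (not ∘ hit (v ∷ g)) + 1
    ≡⟨ cong (# n (not ∘ hit (v ∷ g)) +_) (#-eq n v v<n) ⟨
  # n (not ∘ hit (v ∷ g)) + # n (v ≡ᵇ_)
    ≡⟨ ℕΣ.∑-+ n (λ x → ind (not (hit (v ∷ g) x))) (λ x → ind (v ≡ᵇ x)) ⟨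
  ℕΣ.∑ n (λ x → ind (not (hit (v ∷ g) x)) + ind (v ≡ᵇ x))
    ≡⟨ ℕΣ.∑-cong n (λ x _ → sym (ind-unhit v g x (not-true (∧-true₁ h)))) ⟩
  # n (not ∘ hit g)
    ≡⟨ #-unhit n (suc k) g (trans (sym (+-suc k _)) eq) g<n (∧-true₂ h) ⟩
  suc k
    ≡⟨ +-comm 1 k ⟩
  k + 1 ∎)
  where open ≡-Reasoning

private
  ∧-absorb : ∀ b {c} → (b ≡ true → c ≡ true) → b ∧ c ≡ b
  ∧-absorb true  h = h refl
  ∧-absorb false h = refl

-- Here every value between v and k ends an arc from a larger element, so each is a crossing.
-- Together with `lne-full`, the image v receives the indices (k - 1 - v, v): the origin of the
-- antidiagonal sums.
lcr-full : ∀ n k v g → k ≤ n → (∀ q → v < q → q < k → hit g q ≡ true) → lcr n k v g ≡ k ∸ suc v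
lcr-full n k v g k≤n h = trans
  (#-cong n λ q _ → ∧-absorb _ λ e → h q (true-<ᵇ (∧-true₁ e)) (true-<ᵇ (∧-true₂ {v <ᵇ q} e)))
  (#-between n v k k≤n)

lne-full : ∀ n k v g → v ≤ n → (∀ q → q < v → hit g q ≡ true) → lne n k v g ≡ v
lne-full n k v g v≤n h = trans (#-cong n λ q _ → ∧-absorb _ λ e → h q (true-<ᵇ e)) (#-below n v v≤n)

psn-full : ∀ n k g → k ≤ n → (∀ q → q < k → hit g q ≡ true) → psn n k g ≡ k
psn-full n k g = lne-full n k k g

-- Every unhit value lies above k and is v, a crossing or a nesting according to its order relative
-- to v. So the sum of the two counts is the same for all choices of v, which is why a valley weight
-- with one index can be factored out.
ucr+une : ∀ n k v g → k < v → v < n → hit g v ≡ false → (∀ q → q < suc k → hit g q ≡ true) →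
          # n (not ∘ hit g) ≡ suc (ucr n k v g + une n k v g)
ucr+une n k v g k<v v<n hv low = begin
  # n (not ∘ hit g)
    ≡⟨ ℕΣ.∑-cong n (λ q _ → split q) ⟩
  ℕΣ.∑ n (λ q → (ind (U q) + ind (V q)) + ind (v ≡ᵇ q))
    ≡⟨ ℕΣ.∑-+ n (λ q → ind (U q) + ind (V q)) (λ q → ind (v ≡ᵇ q)) ⟩
  ℕΣ.∑ n (λ q → ind (U q) + ind (V q)) + # n (v ≡ᵇ_)
    ≡⟨ cong₂ _+_ (ℕΣ.∑-+ n (ind ∘ U) (ind ∘ V)) (#-eq n v v<n) ⟩
  (ucr n k v g + une n k v g) + 1
    ≡⟨ +-comm _ 1 ⟩
  suc (ucr n k v g + une n k v g) ∎
  where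
  open ≡-Reasoning
  U V : ℕ → Bool
  U q = (k <ᵇ q) ∧ ((q <ᵇ v) ∧ not (hit g q))
  V q = (k <ᵇ q) ∧ ((v <ᵇ q) ∧ not (hit g q))
  split : ∀ q → ind (not (hit g q)) ≡ (ind (U q) + ind (V q)) + ind (v ≡ᵇ q)
  split q with <-≤-connex k q
  ... | inj₂ q≤k rewrite low q (s≤s q≤k) | <ᵇ-false q≤k | ≡ᵇ-false {v} {q} (λ v≡q → <⇒≱ k<v (subst (_≤ k) (sym v≡q) q≤k)) = refl
  ... | inj₁ k<q rewrite <ᵇ-true k<q with <-cmp q v
  ...   | tri< q<v q≢v _ rewrite <ᵇ-true q<v | <ᵇ-false (<⇒≤ q<v) | ≡ᵇ-false (q≢v ∘ sym) =
            sym (trans (+-identityʳ _) (+-identityʳ _))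
  ...   | tri≈ _ refl _ rewrite <ᵇ-false (≤-refl {q}) | ≡ᵇ-refl q | hv = refl
  ...   | tri> _ q≢v v<q rewrite <ᵇ-true v<q | <ᵇ-false (<⇒≤ v<q) | ≡ᵇ-false (q≢v ∘ sym) = sym (+-identityʳ _)

module _ (n k u : ℕ) (g : List ℕ) (k≤n : k ≤ n) (k≤u : k ≤ u) (low : ∀ q → q < k → hit g q ≡ true) where

  private
    self : ∀ b → (k <ᵇ k) ∧ b ≡ false
    self b = cong (_∧ b) (<ᵇ-false {k} ≤-refl)

    drop-low : ∀ q (b : Bool) → (k <ᵇ punch k q) ∧ (b ∧ not (hit g q)) ≡ b ∧ not (hit g q)
    drop-low q b with <-≤-connex q k
    ... | inj₁ q<k rewrite low q q<k | ∧-zeroʳ b = ∧-zeroʳ _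
    ... | inj₂ k≤q rewrite punch-≥ k≤q | <ᵇ-true (s≤s k≤q) = refl

  -- At a double rise k itself is unhit and can be deleted. As all values below k are hit, lying
  -- above k is automatic for the others, and the crossings and nestings become the ranks of u among
  -- unhit values from below and from above.
  ucr-hole : ucr (suc n) k (suc u) (map (punch k) g) ≡ # n (λ q → (q <ᵇ u) ∧ not (hit g q))
  ucr-hole = trans (#-remove n k (λ q → (k <ᵇ q) ∧ ((q <ᵇ suc u) ∧ not (hit (map (punch k) g) q))) k≤n (self _)) (#-cong n λ q _ →
    trans (cong₂ (λ a b → (k <ᵇ punch k q) ∧ (a ∧ not b))
      (trans (cong (punch k q <ᵇ_) (sym (punch-≥ k≤u))) (punch-<ᵇ k q u)) (hit-punch k g q))
      (drop-low q (q <ᵇ u)))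

  une-hole : une (suc n) k (suc u) (map (punch k) g) ≡ # n (λ q → (u <ᵇ q) ∧ not (hit g q))
  une-hole = trans (#-remove n k (λ q → (k <ᵇ q) ∧ ((suc u <ᵇ q) ∧ not (hit (map (punch k) g) q))) k≤n (self _)) (#-cong n λ q _ →
    trans (cong₂ (λ a b → (k <ᵇ punch k q) ∧ (a ∧ not b))
      (trans (cong (_<ᵇ punch k q) (sym (punch-≥ k≤u))) (punch-<ᵇ k u q)) (hit-punch k g q))
      (drop-low q (u <ᵇ q)))

-- Sums in a commutative ring over lists of images

module RingSums {ℓ₁ ℓ₂ : Level} (R : CommutativeRing ℓ₁ ℓ₂) where
  open CommutativeRing R public
    using (Carrier; _≈_; 0#; 1#; setoid)
    renaming ( _+_ to _⊕_; _*_ to _⊛_; -_ to ⊖_; refl to ≈-refl; sym to ≈-sym; trans to ≈-trans; reflexive to ≈-reflexive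
             ; +-cong to ⊕-cong; +-congˡ to ⊕-congˡ; +-congʳ to ⊕-congʳ; +-assoc to ⊕-assoc; +-comm to ⊕-comm
             ; +-identityˡ to ⊕-identityˡ; +-identityʳ to ⊕-identityʳ
             ; *-cong to ⊛-cong; *-congˡ to ⊛-congˡ; *-congʳ to ⊛-congʳ; *-assoc to ⊛-assoc; *-comm to ⊛-comm
             ; *-identityˡ to ⊛-identityˡ; *-identityʳ to ⊛-identityʳ
             ; distribˡ to ⊛-distribˡ; distribʳ to ⊛-distribʳ; zeroˡ to ⊛-zeroˡ; zeroʳ to ⊛-zeroʳ
             ; -‿inverseˡ to ⊖-inverseˡ; -‿inverseʳ to ⊖-inverseʳ; -‿cong to ⊖-cong)
  open Sums (CommutativeRing.+-commutativeMonoid R) public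
    using (∑; ∑-cong; ∑-zero; ∑-+; ∑-swap; ∑-remove; ∑-append; ∑-last; ∑-single; ∑-reverse)
  open GroupProperties (CommutativeRing.+-group R) public
    using () renaming (∙-cancelʳ to ⊕-cancelʳ)
  open SetoidReasoning setoid

  infixr 8 _·_
  _·_ : Bool → Carrier → Carrier
  b · x = if b then x else 0#

  ·-cong : ∀ {a b x y} → a ≡ b → (b ≡ true → x ≈ y) → a · x ≈ b · y
  ·-cong {b = true}  refl h = h refl
  ·-cong {b = false} refl h = ≈-refl

  ·-⊛ : ∀ b x y → b · (x ⊛ y) ≈ x ⊛ (b · y)
  ·-⊛ true  x y = ≈-refl
  ·-⊛ false x y = ≈-sym (⊛-zeroʳ x)

  ·-⊛ʳ : ∀ b x y → b · (x ⊛ y) ≈ (b · x) ⊛ y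
  ·-⊛ʳ true  x y = ≈-refl
  ·-⊛ʳ false x y = ≈-sym (⊛-zeroˡ y)

  ·-split : ∀ h x → x ≈ h · x ⊕ not h · x
  ·-split true  x = ≈-sym (⊕-identityʳ x)
  ·-split false x = ≈-sym (⊕-identityˡ x)

  ·-· : ∀ a b x → a · b · x ≡ (a ∧ b) · x
  ·-· true  b x = refl
  ·-· false b x = refl

  ⊕-swap : ∀ a b c d → (a ⊕ b) ⊕ (c ⊕ d) ≈ (a ⊕ c) ⊕ (b ⊕ d)
  ⊕-swap a b c d = begin
    (a ⊕ b) ⊕ (c ⊕ d)  ≈⟨ ⊕-assoc a b _ ⟩
    a ⊕ (b ⊕ (c ⊕ d))  ≈⟨ ⊕-congˡ (⊕-assoc b c d) ⟨
    a ⊕ ((b ⊕ c) ⊕ d)  ≈⟨ ⊕-congˡ (⊕-congʳ (⊕-comm b c)) ⟩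
    a ⊕ ((c ⊕ b) ⊕ d)  ≈⟨ ⊕-congˡ (⊕-assoc c b d) ⟩
    a ⊕ (c ⊕ (b ⊕ d))  ≈⟨ ⊕-assoc a c _ ⟨
    (a ⊕ c) ⊕ (b ⊕ d)  ∎

  ∑-⊛ˡ : ∀ n x f → x ⊛ ∑ n f ≈ ∑ n (λ i → x ⊛ f i)
  ∑-⊛ˡ zero    x f = ⊛-zeroʳ x
  ∑-⊛ˡ (suc n) x f = ≈-trans (⊛-distribˡ x _ _) (⊕-congˡ (∑-⊛ˡ n x (f ∘ suc)))

  ∑-⊛ʳ : ∀ n x f → ∑ n f ⊛ x ≈ ∑ n (λ i → f i ⊛ x)
  ∑-⊛ʳ n x f = ≈-trans (⊛-comm _ x) (≈-trans (∑-⊛ˡ n x f) (∑-cong n λ i _ → ⊛-comm x (f i)))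

  ∑-· : ∀ n b f → b · ∑ n f ≈ ∑ n (λ i → b · f i)
  ∑-· n true  f = ≈-refl
  ∑-· n false f = ≈-sym (∑-zero n λ _ _ → ≈-refl)

  ∑L : ℕ → ℕ → (List ℕ → Carrier) → Carrier
  ∑L zero    n φ = φ []
  ∑L (suc m) n φ = ∑ n (λ v → ∑L m n (λ g → φ (v ∷ g)))

  ∑L-cong : ∀ m n {φ ψ} → (∀ g → length g ≡ m → All (_< n) g → φ g ≈ ψ g) → ∑L m n φ ≈ ∑L m n ψ
  ∑L-cong zero    n h = h [] refl []
  ∑L-cong (suc m) n h = ∑-cong n λ v v<n → ∑L-cong m n λ g len g<n → h (v ∷ g) (cong suc len) (v<n ∷ g<n)

  ∑L-zero : ∀ m n {φ} → (∀ g → φ g ≈ 0#) → ∑L m n φ ≈ 0#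
  ∑L-zero zero    n h = h []
  ∑L-zero (suc m) n h = ∑-zero n λ v _ → ∑L-zero m n λ g → h (v ∷ g)

  ∑L-+ : ∀ m n φ ψ → ∑L m n (λ g → φ g ⊕ ψ g) ≈ ∑L m n φ ⊕ ∑L m n ψ
  ∑L-+ zero    n φ ψ = ≈-refl
  ∑L-+ (suc m) n φ ψ = ≈-trans (∑-cong n λ v _ → ∑L-+ m n (φ ∘ (v ∷_)) (ψ ∘ (v ∷_))) (∑-+ n _ _)

  ∑L-⊛ˡ : ∀ m n x φ → ∑L m n (λ g → x ⊛ φ g) ≈ x ⊛ ∑L m n φ
  ∑L-⊛ˡ zero    n x φ = ≈-refl
  ∑L-⊛ˡ (suc m) n x φ = ≈-trans (∑-cong n λ v _ → ∑L-⊛ˡ m n x (φ ∘ (v ∷_))) (≈-sym (∑-⊛ˡ n x _))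

  ∑L-swap : ∀ m n j (φ : ℕ → List ℕ → Carrier) →
            ∑ j (λ i → ∑L m n (φ i)) ≈ ∑L m n (λ g → ∑ j (λ i → φ i g))
  ∑L-swap zero    n j φ = ≈-refl
  ∑L-swap (suc m) n j φ = ≈-trans (∑-swap j n (λ i v → ∑L m n (φ i ∘ (v ∷_))))
    (∑-cong n λ v _ → ∑L-swap m n j (λ i → φ i ∘ (v ∷_)))

  ∑L-punch : ∀ m n p φ → p ≤ n → (∀ g → hit g p ≡ true → φ g ≈ 0#) →
             ∑L m (suc n) φ ≈ ∑L m n (φ ∘ map (punch p))
  ∑L-punch zero    n p φ p≤n h = ≈-refl
  ∑L-punch (suc m) n p φ p≤n h = begin
    ∑ (suc n) (λ v → ∑L m (suc n) (φ ∘ (v ∷_)))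
      ≈⟨ ∑-remove n p (λ v → ∑L m (suc n) (φ ∘ (v ∷_))) p≤n ⟩
    ∑L m (suc n) (φ ∘ (p ∷_)) ⊕ ∑ n (λ v → ∑L m (suc n) (φ ∘ (punch p v ∷_)))
      ≈⟨ ⊕-cong (∑L-zero m (suc n) λ g → h (p ∷ g) (∨-true₁ (≡ᵇ-refl p)))
                (∑-cong n λ v _ → ∑L-punch m n p (φ ∘ (punch p v ∷_)) p≤n λ g e → h (punch p v ∷ g) (∨-true₂ e)) ⟩
    0# ⊕ ∑ n (λ v → ∑L m n (λ g → φ (map (punch p) (v ∷ g))))
      ≈⟨ ⊕-identityˡ _ ⟩
    ∑ n (λ v → ∑L m n (λ g → φ (map (punch p) (v ∷ g)))) ∎

  -- Following the orbits maps the points not hit bijectively onto the values below k.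
  exit-sum : ∀ n k g (h : ℕ → Carrier) → k + length g ≡ n → All (_< n) g → inj g ≡ true →
             ∑ n (λ x → not (hit g x) · h (exit k g x)) ≈ ∑ k h
  exit-sum n k []      h refl []          _ rewrite +-identityʳ k = ≈-refl
  -- Prepending v removes v from the unhit points and redirects to y every orbit that used to leave
  -- at k; `h′` encodes the redirection. The term `h y` of the lost point v is added to both sides
  -- and cancelled.
  exit-sum n k (v ∷ g) h eq   (v<n ∷ g<n) i = ⊕-cancelʳ (h y) _ _ (begin
    ∑ n (λ x → not (hit (v ∷ g) x) · h (exit k (v ∷ g) x)) ⊕ h y
      ≈⟨ ⊕-congˡ at-v ⟨
    ∑ n (λ x → not (hit (v ∷ g) x) · h (exit k (v ∷ g) x)) ⊕ ∑ n (λ x → (v ≡ᵇ x) · h y)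
      ≈⟨ ∑-+ n _ _ ⟨
    ∑ n (λ x → not (hit (v ∷ g) x) · h (exit k (v ∷ g) x) ⊕ (v ≡ᵇ x) · h y)
      ≈⟨ ∑-cong n (λ x _ → pointwise x) ⟩
    ∑ n (λ x → not (hit g x) · h′ (exit (suc k) g x))
      ≈⟨ exit-sum n (suc k) g h′ (trans (sym (+-suc k _)) eq) g<n (∧-true₂ i) ⟩
    ∑ (suc k) h′
      ≈⟨ ∑-last k h′ ⟩
    ∑ k h′ ⊕ h′ k
      ≈⟨ ⊕-cong (∑-cong k λ q q<k → ≈-reflexive (cong (λ b → if b then h y else h q) (≡ᵇ-false (<⇒≢ q<k))))
                (≈-reflexive (cong (λ b → if b then h y else h k) (≡ᵇ-refl k))) ⟩
    ∑ k h ⊕ h y ∎)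
    where
    y = exit (suc k) g v
    h′ : ℕ → Carrier
    h′ q = if q ≡ᵇ k then h y else h q
    h′y : h′ y ≡ h y
    h′y with y ≡ᵇ k
    ... | true  = refl
    ... | false = refl
    at-v : ∑ n (λ x → (v ≡ᵇ x) · h y) ≈ h y
    at-v = ≈-trans (∑-single n v (λ x → (v ≡ᵇ x) · h y) v<n λ x _ x≢v → ≈-reflexive (cong (_· h y) (≡ᵇ-false (x≢v ∘ sym))))
                   (≈-reflexive (cong (_· h y) (≡ᵇ-refl v)))
    pointwise : ∀ x → not (hit (v ∷ g) x) · h (exit k (v ∷ g) x) ⊕ (v ≡ᵇ x) · h y
                      ≈ not (hit g x) · h′ (exit (suc k) g x)
    pointwise x with v ≡ᵇ x in e
    ... | false = ≈-trans (⊕-identityʳ _)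
                    (≈-reflexive (cong (not (hit g x) ·_) (if-float h (exit (suc k) g x ≡ᵇ k))))
    ... | true rewrite sym (true-≡ᵇ {v} {x} e) | not-true (∧-true₁ {not (hit g v)} i) =
            ≈-trans (⊕-identityˡ _) (≈-reflexive (sym h′y))

  -- Listed in increasing order, the member of U with ξ members below it has c - 1 - ξ above it, and
  -- each ξ below c occurs once.
  rank-sum : ∀ n c (U : ℕ → Bool) (D : ℕ → ℕ → Carrier) → # n U ≡ c →
    ∑ n (λ u → U u · D (# n (λ q → (q <ᵇ u) ∧ U q)) (# n (λ q → (u <ᵇ q) ∧ U q)))
    ≈ ∑ c (λ ξ → D ξ (c ∸ suc ξ))
  rank-sum zero    c U D refl = ≈-refl
  rank-sum (suc n) c U D e with U 0 in u₀
  ... | false = ≈-trans (⊕-identityˡ _) (rank-sum n c (U ∘ suc) D e)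
  rank-sum (suc n) (suc c) U D e | true = ⊕-cong
    (≈-reflexive (cong₂ D (#-none n λ _ _ → refl) (suc-injective e)))
    (rank-sum n c (U ∘ suc) (D ∘ suc) (suc-injective e))

-- The state sum and its recurrence

module StateSums {ℓ₁ ℓ₂ : Level} (R : CommutativeRing ℓ₁ ℓ₂)
  (lam : CommutativeRing.Carrier R)
  (A : ℕ → ℕ → CommutativeRing.Carrier R)
  (B C D : ℕ → ℕ → ℕ → CommutativeRing.Carrier R)
  (F : ℕ → ℕ → CommutativeRing.Carrier R) where
  open RingSums R
  open Defs.Ring R using (natR)
  open SetoidReasoning setoid

  -- With elements placed in decreasing order, a cycle closes at its least element, a valley or a
  -- fixed point. The factor for a fixed point is left to `F`.
  closing : Bool → Carrier
  closing b = if b then lam else 1#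

  -- The first argument of the weight functions is the number of elements above k.
  loc : ℕ → ℕ → List ℕ → Carrier
  loc k v g =
    if v <ᵇ k
    then (if hit g k then C m (lcr n k v g) (lne n k v g) else B m (lcr n k v g) (lne n k v g))
    else if k <ᵇ v
    then (if hit g k then closing (exit (suc k) g v ≡ᵇ k) ⊛ A m (ucr n k v g + une n k v g)
                     else D m (ucr n k v g) (une n k v g))
    else F m (psn n k g)
    where
    m = length g
    n = suc (k + m)

  W : ℕ → List ℕ → Carrier
  W k []      = 1#
  W k (v ∷ g) = loc k v g ⊛ W (suc k) g

  loc-punch : ∀ p k v g → p ≤ k → loc (suc k) (punch p v) (map (punch p) g) ≡ loc k v g
  loc-punch p k v g p≤k
    rewrite length-map (punch p) g
          | trans (cong (punch p v <ᵇ_) (sym (punch-≥ p≤k))) (punch-<ᵇ p v k)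
          | trans (cong (_<ᵇ punch p v) (sym (punch-≥ p≤k))) (punch-<ᵇ p k v)
          | trans (cong (hit (map (punch p) g)) (sym (punch-≥ p≤k))) (hit-punch p g k)
          | exit-punch p (suc k) g v (m≤n⇒m≤1+n p≤k)
          | trans (cong (punch p (exit (suc k) g v) ≡ᵇ_) (sym (punch-≥ p≤k))) (punch-≡ᵇ p (exit (suc k) g v) k)
          | lcr-punch p (suc (k + length g)) k (m≤n⇒m≤1+n (m≤n⇒m≤n+o _ p≤k)) p≤k v g
          | lne-punch p (suc (k + length g)) k (m≤n⇒m≤1+n (m≤n⇒m≤n+o _ p≤k)) p≤k v g
          | ucr-punch p (suc (k + length g)) k (m≤n⇒m≤1+n (m≤n⇒m≤n+o _ p≤k)) p≤k v g
          | une-punch p (suc (k + length g)) k (m≤n⇒m≤1+n (m≤n⇒m≤n+o _ p≤k)) p≤k v g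
          | psn-punch p (suc (k + length g)) k (m≤n⇒m≤1+n (m≤n⇒m≤n+o _ p≤k)) p≤k g
    = refl

  W-punch : ∀ p k g → p ≤ k → W (suc k) (map (punch p) g) ≡ W k g
  W-punch p k []      p≤k = refl
  W-punch p k (v ∷ g) p≤k = cong₂ _⊛_ (loc-punch p k v g p≤k) (W-punch p (suc k) g (m≤n⇒m≤1+n p≤k))

  -- The state sum with m elements placed and k open paths. An injective list of length m leaves k
  -- of the k + m values unhit, and fullness puts all of them at or above k.
  Z : ℕ → ℕ → Carrier
  Z m k = ∑L m (k + m) (λ g → (inj g ∧ full k g) · W k g)

  private
    low-hit : ∀ {k} g → inj g ∧ full k g ≡ true → ∀ q → q < k → hit g q ≡ true
    low-hit {k} g e = allBelow-true k (∧-true₂ {inj g} e)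

    hit-map-< : ∀ {p} g q → hit g q ≡ true → q < p → hit (map (punch p) g) q ≡ true
    hit-map-< g q e q<p = trans (cong (hit (map (punch _) g)) (sym (punch-< q<p))) (trans (hit-punch _ g q) e)

  loc-fix : ∀ k g → (∀ q → q < k → hit g q ≡ true) → loc k k g ≡ F (length g) k
  loc-fix k g low
    rewrite <ᵇ-false (≤-refl {k}) | psn-full (suc (k + length g)) k g (m≤n⇒m≤1+n (m≤m+n k _)) low = refl

  loc-low : ∀ k v g → v < k → (∀ q → q < k → q ≢ v → hit g q ≡ true) →
    loc k v g ≡ (if hit g k then C (length g) (k ∸ suc v) v else B (length g) (k ∸ suc v) v)
  loc-low k v g v<k low
    rewrite <ᵇ-true v<k
          | lcr-full (suc (k + length g)) k v g (m≤n⇒m≤1+n (m≤m+n k _)) (λ q v<q q<k → low q q<k (<⇒≢ v<q ∘ sym))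
          | lne-full (suc (k + length g)) k v g (m≤n⇒m≤1+n (m≤n⇒m≤n+o _ (<⇒≤ v<k))) (λ q q<v → low q (<-trans q<v v<k) (<⇒≢ q<v))
    = refl

  loc-valley : ∀ k v g → k < v → v < suc (k + length g) → All (_< suc (k + length g)) g → inj g ≡ true →
    hit g v ≡ false → (∀ q → q < suc k → hit g q ≡ true) →
    loc k v g ≡ closing (exit (suc k) g v ≡ᵇ k) ⊛ A (length g) k
  loc-valley k v g k<v v<n g<n i hv low
    rewrite <ᵇ-false (<⇒≤ k<v) | <ᵇ-true k<v | low k ≤-refl =
    cong (λ x → closing (exit (suc k) g v ≡ᵇ k) ⊛ A (length g) x)
      (suc-injective (trans (sym (ucr+une _ k v g k<v v<n hv low)) (#-unhit _ (suc k) g refl g<n i)))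

  loc-drise : ∀ k u g → k ≤ u → (∀ q → q < k → hit g q ≡ true) →
    loc k (suc u) (map (punch k) g) ≡
    D (length g) (# (k + length g) (λ q → (q <ᵇ u) ∧ not (hit g q))) (# (k + length g) (λ q → (u <ᵇ q) ∧ not (hit g q)))
  loc-drise k u g k≤u low
    rewrite <ᵇ-false (m≤n⇒m≤1+n k≤u) | <ᵇ-true (s≤s k≤u) | hit-punch-hole k g | length-map (punch k) g
          | ucr-hole (k + length g) k u g (m≤m+n k _) k≤u low
          | une-hole (k + length g) k u g (m≤m+n k _) k≤u low = refl

  -- By computation the summand of `Z (suc m) k` at the list with head v; the recurrence comes from
  -- sorting these by v and by whether k is hit.
  term : ℕ → ℕ → List ℕ → Carrier
  term k v g = ((not (hit g v) ∧ inj g) ∧ full k (v ∷ g)) · (loc k v g ⊛ W (suc k) g)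

  private
    unless-hit : ∀ k v g → hit g v ≡ true → term k v g ≈ 0#
    unless-hit k v g e rewrite e = ≈-refl

  fix-sum : ∀ m k → ∑L m (suc (k + m)) (term k k) ≈ F m k ⊛ Z m k
  fix-sum m k = begin
    ∑L m (suc (k + m)) (term k k)
      ≈⟨ ∑L-punch m (k + m) k (term k k) (m≤m+n k m) (unless-hit k k) ⟩
    ∑L m (k + m) (term k k ∘ map (punch k))
      ≈⟨ ∑L-cong m (k + m) (λ g len _ → pointwise g len) ⟩
    ∑L m (k + m) (λ g → F m k ⊛ ((inj g ∧ full k g) · W k g))
      ≈⟨ ∑L-⊛ˡ m (k + m) (F m k) _ ⟩
    F m k ⊛ Z m k ∎
    where
    condition : ∀ g → (not (hit (map (punch k) g) k) ∧ inj (map (punch k) g)) ∧ full k (k ∷ map (punch k) g)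
                      ≡ inj g ∧ full k g
    condition g = cong₂ _∧_
      (cong₂ _∧_ (cong not (hit-punch-hole k g)) (inj-punch k g))
      (allBelow-cong k λ q q<k → cong₂ _∨_ (≡ᵇ-false (<⇒≢ q<k ∘ sym))
        (trans (cong (hit (map (punch k) g)) (sym (punch-< q<k))) (hit-punch k g q)))
    pointwise : ∀ g → length g ≡ m → term k k (map (punch k) g) ≈ F m k ⊛ ((inj g ∧ full k g) · W k g)
    pointwise g refl = ≈-trans
      (·-cong (condition g) λ e → ≈-reflexive (cong₂ _⊛_
        (trans (loc-fix k (map (punch k) g) λ q q<k → hit-map-< g q (low-hit g e q q<k) q<k)
               (cong (λ l → F l k) (length-map (punch k) g)))
        (W-punch k k g ≤-refl)))
      (·-⊛ _ _ _)

  -- Deleting v turns the label `suc k` of the new element into k. If k is hit, the element is a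
  -- double fall and the rest is a state with `suc k` open paths; if not, it is a peak, and deleting
  -- k as well leaves a state with k open paths.
  low-sum : ∀ m k v → v ≤ k → ∑L m (suc (suc k + m)) (term (suc k) v)
    ≈ C m (k ∸ v) v ⊛ Z m (suc k) ⊕ B m (k ∸ v) v ⊛ Z m k
  low-sum m k v v≤k = begin
    ∑L m (suc (suc k + m)) (term (suc k) v)
      ≈⟨ ∑L-punch m (suc k + m) v (term (suc k) v) (≤-trans v≤k (m≤n⇒m≤1+n (m≤m+n k m))) (unless-hit (suc k) v) ⟩
    ∑L m (suc k + m) (term (suc k) v ∘ map (punch v))
      ≈⟨ ∑L-cong m (suc k + m) (λ g len _ → pointwise g len) ⟩
    ∑L m (suc k + m) (λ g → x ⊛ ((inj g ∧ full (suc k) g) · W (suc k) g) ⊕ y ⊛ rest g)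
      ≈⟨ ∑L-+ m (suc k + m) _ _ ⟩
    ∑L m (suc k + m) (λ g → x ⊛ ((inj g ∧ full (suc k) g) · W (suc k) g)) ⊕ ∑L m (suc k + m) (λ g → y ⊛ rest g)
      ≈⟨ ⊕-cong (∑L-⊛ˡ m (suc k + m) x _) (≈-trans (∑L-⊛ˡ m (suc k + m) y rest) (⊛-congˡ peak)) ⟩
    x ⊛ Z m (suc k) ⊕ y ⊛ Z m k ∎
    where
    x = C m (k ∸ v) v
    y = B m (k ∸ v) v
    rest : List ℕ → Carrier
    rest g = (not (hit g k) ∧ (inj g ∧ full k g)) · W (suc k) g
    k≡ : punch v k ≡ suc k
    k≡ = punch-≥ v≤k
    hit-top : ∀ g → hit (map (punch v) g) (suc k) ≡ hit g k
    hit-top g = trans (cong (hit (map (punch v) g)) (sym k≡)) (hit-punch v g k)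
    condition : ∀ g → (not (hit (map (punch v) g) v) ∧ inj (map (punch v) g)) ∧ full (suc k) (v ∷ map (punch v) g)
                      ≡ inj g ∧ full k g
    condition g = cong₂ _∧_
      (cong₂ _∧_ (cong not (hit-punch-hole v g)) (inj-punch v g))
      (trans (allBelow-punch k v (hit (v ∷ map (punch v) g)) v≤k (∨-true₁ (≡ᵇ-refl v)))
             (allBelow-cong k λ q _ → cong₂ _∨_ (≡ᵇ-false (punch-≢ v q ∘ sym)) (hit-punch v g q)))
    low : ∀ g → inj g ∧ full k g ≡ true → ∀ q → q < suc k → q ≢ v → hit (map (punch v) g) q ≡ true
    low g e q q<sk q≢v with <-cmp q v
    ... | tri< q<v _ _ = hit-map-< g q (low-hit g e q (<-≤-trans q<v v≤k)) q<v
    ... | tri≈ _ q≡v _ = ⊥-elim (q≢v q≡v)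
    low g e (suc q) (s≤s q<k) q≢v | tri> _ _ (s≤s v≤q) =
      trans (cong (hit (map (punch v) g)) (sym (punch-≥ v≤q))) (trans (hit-punch v g q) (low-hit g e q q<k))
    pointwise : ∀ g → length g ≡ m → term (suc k) v (map (punch v) g)
      ≈ x ⊛ ((inj g ∧ full (suc k) g) · W (suc k) g) ⊕ y ⊛ rest g
    pointwise g refl = begin
      term (suc k) v (map (punch v) g)
        ≈⟨ ·-cong (condition g) (λ e → ≈-reflexive (cong₂ _⊛_
             (trans (loc-low (suc k) v (map (punch v) g) (s≤s v≤k) (low g e))
                    (cong₂ (λ b l → if b then C l (k ∸ v) v else B l (k ∸ v) v) (hit-top g) (length-map (punch v) g)))
             (W-punch v (suc k) g (m≤n⇒m≤1+n v≤k)))) ⟩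
      (inj g ∧ full k g) · ((if hit g k then x else y) ⊛ W (suc k) g)
        ≈⟨ by-top (inj g) (full k g) (hit g k) ⟩
      x ⊛ ((inj g ∧ (hit g k ∧ full k g)) · W (suc k) g) ⊕ y ⊛ rest g ∎
      where
      by-top : ∀ i f h → (i ∧ f) · ((if h then x else y) ⊛ W (suc k) g)
        ≈ x ⊛ ((i ∧ (h ∧ f)) · W (suc k) g) ⊕ y ⊛ ((not h ∧ (i ∧ f)) · W (suc k) g)
      by-top i f true  = ≈-sym (≈-trans (⊕-congˡ (⊛-zeroʳ y)) (≈-trans (⊕-identityʳ _) (≈-sym (·-⊛ (i ∧ f) x _))))
      by-top i f false rewrite ∧-zeroʳ i =
        ≈-sym (≈-trans (⊕-congʳ (⊛-zeroʳ x)) (≈-trans (⊕-identityˡ _) (≈-sym (·-⊛ (i ∧ f) y _))))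
    peak : ∑L m (suc k + m) rest ≈ Z m k
    peak = begin
      ∑L m (suc (k + m)) rest
        ≈⟨ ∑L-punch m (k + m) k rest (m≤m+n k m) (λ g e → ≈-reflexive (cong (λ b → (not b ∧ (inj g ∧ full k g)) · W (suc k) g) e)) ⟩
      ∑L m (k + m) (rest ∘ map (punch k))
        ≈⟨ ∑L-cong m (k + m) (λ g _ _ → ·-cong
             (cong₂ (λ a b → not a ∧ b) (hit-punch-hole k g)
               (cong₂ _∧_ (inj-punch k g) (allBelow-cong k λ q q<k →
                 trans (cong (hit (map (punch k) g)) (sym (punch-< q<k))) (hit-punch k g q))))
             (λ _ → ≈-reflexive (W-punch k k g ≤-refl))) ⟩
      Z m k ∎

  -- The admissible images differ only in the factor `closing`. Following orbits matches these
  -- `suc k` images with the values up to k, and only the one arriving at k closes a cycle, so the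
  -- factors add up to lam + k.
  valley-sum : ∀ m k → ∑ m (λ j → ∑L m (suc (k + m)) (λ g → hit g k · term k (suc (k + j)) g))
    ≈ ((lam ⊕ natR k) ⊛ A m k) ⊛ Z m (suc k)
  valley-sum m k = begin
    ∑ m (λ j → ∑L m n (λ g → hit g k · term k (suc (k + j)) g))
      ≈⟨ ∑L-swap m n m (λ j g → hit g k · term k (suc (k + j)) g) ⟩
    ∑L m n (λ g → ∑ m (λ j → hit g k · term k (suc (k + j)) g))
      ≈⟨ ∑L-cong m n pointwise ⟩
    ∑L m n (λ g → ((lam ⊕ natR k) ⊛ A m k) ⊛ ((inj g ∧ full (suc k) g) · W (suc k) g))
      ≈⟨ ∑L-⊛ˡ m n _ _ ⟩
    ((lam ⊕ natR k) ⊛ A m k) ⊛ Z m (suc k) ∎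
    where
    n = suc (k + m)
    closings : ∀ k → ∑ (suc k) (λ y → closing (y ≡ᵇ k)) ≈ lam ⊕ natR k
    closings k = begin
      ∑ (suc k) (λ y → closing (y ≡ᵇ k))              ≈⟨ ∑-last k (λ y → closing (y ≡ᵇ k)) ⟩
      ∑ k (λ y → closing (y ≡ᵇ k)) ⊕ closing (k ≡ᵇ k)
        ≈⟨ ⊕-cong (≈-trans (∑-cong k λ y y<k → ≈-reflexive (cong closing (≡ᵇ-false (<⇒≢ y<k)))) (ones k))
                  (≈-reflexive (cong closing (≡ᵇ-refl k))) ⟩
      natR k ⊕ lam                                    ≈⟨ ⊕-comm _ _ ⟩
      lam ⊕ natR k ∎
      where
      ones : ∀ k → ∑ k (λ _ → 1#) ≈ natR k
      ones zero    = ≈-refl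
      ones (suc k) = ⊕-congˡ (ones k)
    pointwise : ∀ g → length g ≡ m → All (_< n) g →
      ∑ m (λ j → hit g k · term k (suc (k + j)) g)
      ≈ ((lam ⊕ natR k) ⊛ A m k) ⊛ ((inj g ∧ full (suc k) g) · W (suc k) g)
    pointwise g refl g<n = begin
      ∑ m (λ j → hit g k · term k (suc (k + j)) g)
        ≈⟨ ∑-cong m each ⟩
      ∑ m (λ j → good · (not (hit g (suc (k + j))) · closing (exit (suc k) g (suc (k + j)) ≡ᵇ k) ⊛ aw))
        ≈⟨ ∑-· m good _ ⟨
      good · ∑ m (λ j → not (hit g (suc (k + j))) · closing (exit (suc k) g (suc (k + j)) ≡ᵇ k) ⊛ aw)
        ≈⟨ ·-cong {good} refl total ⟩
      good · (((lam ⊕ natR k) ⊛ A m k) ⊛ W (suc k) g)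
        ≈⟨ ·-⊛ good _ _ ⟩
      ((lam ⊕ natR k) ⊛ A m k) ⊛ (good · W (suc k) g) ∎
      where
      good = inj g ∧ full (suc k) g
      aw = A m k ⊛ W (suc k) g
      low : good ≡ true → ∀ q → q < suc k → hit g q ≡ true
      low = low-hit g
      each : ∀ j → j < m → hit g k · term k (suc (k + j)) g
        ≈ good · (not (hit g (suc (k + j))) · closing (exit (suc k) g (suc (k + j)) ≡ᵇ k) ⊛ aw)
      each j j<m = begin
        hit g k · term k v g
          ≡⟨ ·-· (hit g k) _ _ ⟩
        (hit g k ∧ ((not (hit g v) ∧ inj g) ∧ full k (v ∷ g))) · (loc k v g ⊛ W (suc k) g)
          ≈⟨ ·-cong condition (λ e → weights (∧-true₁ e) (not-true (∧-true₂ {good} e))) ⟩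
        (good ∧ not (hit g v)) · (closing (exit (suc k) g v ≡ᵇ k) ⊛ aw)
          ≡⟨ ·-· good _ _ ⟨
        good · (not (hit g v) · (closing (exit (suc k) g v ≡ᵇ k) ⊛ aw))
          ≈⟨ ·-cong {good} refl (λ _ → ·-⊛ʳ (not (hit g v)) _ aw) ⟩
        good · ((not (hit g v) · closing (exit (suc k) g v ≡ᵇ k)) ⊛ aw) ∎
        where
        v = suc (k + j)
        condition : (hit g k ∧ ((not (hit g v) ∧ inj g) ∧ full k (v ∷ g))) ≡ good ∧ not (hit g v)
        condition = trans
          (cong (λ f → hit g k ∧ ((not (hit g v) ∧ inj g) ∧ f))
            (allBelow-cong k λ q q<k → cong (_∨ hit g q) (≡ᵇ-false (<⇒≢ (<-trans q<k (s≤s (m≤m+n k j))) ∘ sym))))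
          (∧-shuffle (hit g k) (not (hit g v)) (inj g) (full k g))
          where
          ∧-shuffle : ∀ h u i f → h ∧ ((u ∧ i) ∧ f) ≡ (i ∧ (h ∧ f)) ∧ u
          ∧-shuffle false u     false f     = refl
          ∧-shuffle false u     true  f     = refl
          ∧-shuffle true  false false f     = refl
          ∧-shuffle true  false true  false = refl
          ∧-shuffle true  false true  true  = refl
          ∧-shuffle true  true  false f     = refl
          ∧-shuffle true  true  true  false = refl
          ∧-shuffle true  true  true  true  = refl
        weights : good ≡ true → hit g v ≡ false → loc k v g ⊛ W (suc k) g ≈ closing (exit (suc k) g v ≡ᵇ k) ⊛ aw
        weights e hv = ≈-trans
          (⊛-congʳ (≈-reflexive (loc-valley k v g (s≤s (m≤m+n k j)) (s≤s (+-monoʳ-< k j<m)) g<n (∧-true₁ e) hv (low e))))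
          (⊛-assoc _ _ _)
      total : good ≡ true →
        ∑ m (λ j → not (hit g (suc (k + j))) · closing (exit (suc k) g (suc (k + j)) ≡ᵇ k) ⊛ aw)
        ≈ ((lam ⊕ natR k) ⊛ A m k) ⊛ W (suc k) g
      total e = begin
        ∑ m (λ j → not (hit g (suc (k + j))) · closing (exit (suc k) g (suc (k + j)) ≡ᵇ k) ⊛ aw)
          ≈⟨ ∑-⊛ʳ m aw _ ⟨
        ∑ m (λ j → not (hit g (suc (k + j))) · closing (exit (suc k) g (suc (k + j)) ≡ᵇ k)) ⊛ aw
          -- The sum is extended from the values above k to all values, so that `exit-sum` applies:
          -- the values up to k are hit and add zero.
          ≈⟨ ⊛-congʳ (⊕-identityˡ _) ⟨
        (0# ⊕ ∑ m (λ j → not (hit g (suc (k + j))) · closing (exit (suc k) g (suc (k + j)) ≡ᵇ k))) ⊛ aw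
          ≈⟨ ⊛-congʳ (⊕-congʳ (∑-zero (suc k) (λ q q≤k → ≈-reflexive (cong (λ b → not b · closing (exit (suc k) g q ≡ᵇ k)) (low e q q≤k))))) ⟨
        (∑ (suc k) unhit ⊕ ∑ m (λ j → unhit (suc k + j))) ⊛ aw
          ≈⟨ ⊛-congʳ (∑-append (suc k) m unhit) ⟨
        ∑ n unhit ⊛ aw
          ≈⟨ ⊛-congʳ (exit-sum n (suc k) g (λ y → closing (y ≡ᵇ k)) refl g<n (∧-true₁ e)) ⟩
        ∑ (suc k) (λ y → closing (y ≡ᵇ k)) ⊛ aw
          ≈⟨ ⊛-congʳ (closings k) ⟩
        (lam ⊕ natR k) ⊛ aw
          ≈⟨ ⊛-assoc _ _ _ ⟨
        ((lam ⊕ natR k) ⊛ A m k) ⊛ W (suc k) g ∎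
        where
        unhit : ℕ → Carrier
        unhit x = not (hit g x) · closing (exit (suc k) g x ≡ᵇ k)

  -- The unhit value k is deleted from the list. The image may be any of the k unhit values of what
  -- remains, and its rank among them supplies both indices of `D`.
  drise-sum : ∀ m k → ∑ m (λ j → ∑L m (suc (k + m)) (λ g → not (hit g k) · term k (suc (k + j)) g))
    ≈ ∑ k (λ ξ → D m ξ (k ∸ suc ξ)) ⊛ Z m k
  drise-sum m k = begin
    ∑ m (λ j → ∑L m (suc n) (λ g → not (hit g k) · term k (suc (k + j)) g))
      ≈⟨ ∑-cong m (λ j _ → ∑L-punch m n k (λ g → not (hit g k) · term k (suc (k + j)) g) (m≤m+n k m)
           λ g e → ≈-reflexive (cong (λ b → not b · term k (suc (k + j)) g) e)) ⟩
    ∑ m (λ j → ∑L m n (λ g → not (hit (map (punch k) g) k) · term k (suc (k + j)) (map (punch k) g)))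
      ≈⟨ ∑L-swap m n m (λ j g → not (hit (map (punch k) g) k) · term k (suc (k + j)) (map (punch k) g)) ⟩
    ∑L m n (λ g → ∑ m (λ j → not (hit (map (punch k) g) k) · term k (suc (k + j)) (map (punch k) g)))
      ≈⟨ ∑L-cong m n pointwise ⟩
    ∑L m n (λ g → ∑ k (λ ξ → D m ξ (k ∸ suc ξ)) ⊛ ((inj g ∧ full k g) · W k g))
      ≈⟨ ∑L-⊛ˡ m n _ _ ⟩
    ∑ k (λ ξ → D m ξ (k ∸ suc ξ)) ⊛ Z m k ∎
    where
    n = k + m
    pointwise : ∀ g → length g ≡ m → All (_< n) g →
      ∑ m (λ j → not (hit (map (punch k) g) k) · term k (suc (k + j)) (map (punch k) g))
      ≈ ∑ k (λ ξ → D m ξ (k ∸ suc ξ)) ⊛ ((inj g ∧ full k g) · W k g)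
    pointwise g refl g<n = begin
      ∑ m (λ j → not (hit (map (punch k) g) k) · term k (suc (k + j)) (map (punch k) g))
        ≈⟨ ∑-cong m (λ j _ → each j) ⟩
      ∑ m (λ j → good · (ranked (k + j) ⊛ W k g))
        ≈⟨ ∑-· m good _ ⟨
      good · ∑ m (λ j → ranked (k + j) ⊛ W k g)
        ≈⟨ ·-cong {good} refl total ⟩
      good · (∑ k (λ ξ → D m ξ (k ∸ suc ξ)) ⊛ W k g)
        ≈⟨ ·-⊛ good _ _ ⟩
      ∑ k (λ ξ → D m ξ (k ∸ suc ξ)) ⊛ (good · W k g) ∎
      where
      good = inj g ∧ full k g
      ranked : ℕ → Carrier
      ranked u = not (hit g u) · D m (# n (λ q → (q <ᵇ u) ∧ not (hit g q))) (# n (λ q → (u <ᵇ q) ∧ not (hit g q)))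
      total : good ≡ true →
        ∑ m (λ j → ranked (k + j) ⊛ W k g) ≈ ∑ k (λ ξ → D m ξ (k ∸ suc ξ)) ⊛ W k g
      total e = begin
        ∑ m (λ j → ranked (k + j) ⊛ W k g)
          ≈⟨ ∑-⊛ʳ m (W k g) _ ⟨
        ∑ m (λ j → ranked (k + j)) ⊛ W k g
          ≈⟨ ⊛-congʳ (⊕-identityˡ _) ⟨
        (0# ⊕ ∑ m (λ j → ranked (k + j))) ⊛ W k g
          ≈⟨ ⊛-congʳ (⊕-congʳ (∑-zero k (λ q q<k → ≈-reflexive (cong
               (λ b → not b · D m (# n (λ p → (p <ᵇ q) ∧ not (hit g p))) (# n (λ p → (q <ᵇ p) ∧ not (hit g p))))
               (low-hit g e q q<k))))) ⟨
        (∑ k ranked ⊕ ∑ m (λ j → ranked (k + j))) ⊛ W k g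
          ≈⟨ ⊛-congʳ (∑-append k m ranked) ⟨
        ∑ n ranked ⊛ W k g
          ≈⟨ ⊛-congʳ (rank-sum n k (not ∘ hit g) (D m) (#-unhit n k g refl g<n (∧-true₁ e))) ⟩
        ∑ k (λ ξ → D m ξ (k ∸ suc ξ)) ⊛ W k g ∎
      each : ∀ j → not (hit (map (punch k) g) k) · term k (suc (k + j)) (map (punch k) g) ≈ good · (ranked (k + j) ⊛ W k g)
      each j = begin
        not (hit pg k) · term k v pg
          ≡⟨ cong (λ b → not b · term k v pg) (hit-punch-hole k g) ⟩
        ((not (hit pg v) ∧ inj pg) ∧ full k (v ∷ pg)) · (loc k v pg ⊛ W (suc k) pg)
          ≈⟨ ·-cong condition (λ e → ⊛-cong (≈-reflexive (loc-drise k (k + j) g (m≤m+n k j) (low-hit g (∧-true₁ e))))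
                                            (≈-reflexive (W-punch k k g ≤-refl))) ⟩
        (good ∧ not (hit g (k + j))) · (rank ⊛ W k g)
          ≡⟨ ·-· good _ _ ⟨
        good · (not (hit g (k + j)) · (rank ⊛ W k g))
          ≈⟨ ·-cong {good} refl (λ _ → ·-⊛ʳ (not (hit g (k + j))) _ _) ⟩
        good · (ranked (k + j) ⊛ W k g) ∎
        where
        v = suc (k + j)
        pg = map (punch k) g
        rank = D m (# n (λ q → (q <ᵇ k + j) ∧ not (hit g q))) (# n (λ q → (k + j <ᵇ q) ∧ not (hit g q)))
        condition : (not (hit pg v) ∧ inj pg) ∧ full k (v ∷ pg) ≡ good ∧ not (hit g (k + j))
        condition = trans
          (cong₂ _∧_
            (cong₂ _∧_ (cong not (trans (cong (hit pg) (sym (punch-≥ (m≤m+n k j)))) (hit-punch k g (k + j)))) (inj-punch k g))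
            (allBelow-cong k λ q q<k → cong₂ _∨_
              (≡ᵇ-false (<⇒≢ (<-trans q<k (s≤s (m≤m+n k j))) ∘ sym))
              (trans (cong (hit pg) (sym (punch-< q<k))) (hit-punch k g q))))
          (∧-rotate (not (hit g (k + j))) (inj g) (full k g))
          where
          ∧-rotate : ∀ u i f → (u ∧ i) ∧ f ≡ (i ∧ f) ∧ u
          ∧-rotate u i f = trans (cong (_∧ f) (∧-comm u i)) (trans (∧-assoc i u f)
            (trans (cong (i ∧_) (∧-comm u f)) (sym (∧-assoc i f u))))

  -- Placing a peak opens a path, so it cannot produce a state with none: hence zero at k = 0.
  down : ℕ → ℕ → Carrier
  down m zero    = 0#
  down m (suc k) = ∑ (suc k) (λ ξ → B m (k ∸ ξ) ξ) ⊛ Z m k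

  -- The new element has image below k (peak or double fall), equal to k (fixed point) or above k
  -- (double rise or valley). Before it there were k - 1 open paths for a peak, k + 1 for a valley
  -- and k otherwise.
  Z-step : ∀ m k → Z (suc m) k ≈
    (down m k ⊕ (F m k ⊕ (∑ k (λ ξ → C m (k ∸ suc ξ) ξ) ⊕ ∑ k (λ ξ → D m ξ (k ∸ suc ξ)))) ⊛ Z m k)
    ⊕ ((lam ⊕ natR k) ⊛ A m k) ⊛ Z m (suc k)
  Z-step m k = begin
    Z (suc m) k
      ≡⟨⟩
    ∑L (suc m) (k + suc m) (λ g → (inj g ∧ full k g) · W k g)
      ≡⟨ cong (λ n → ∑L (suc m) n (λ g → (inj g ∧ full k g) · W k g)) (+-suc k m) ⟩
    ∑ (suc k + m) S
      ≈⟨ ∑-append (suc k) m S ⟩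
    ∑ (suc k) S ⊕ ∑ m (λ j → S (suc (k + j)))
      ≈⟨ ⊕-cong (≈-trans (∑-last k S) (⊕-cong (lows k) (fix-sum m k))) high ⟩
    ((down m k ⊕ c ⊛ z) ⊕ F m k ⊛ z) ⊕ (d ⊛ z ⊕ up)
      ≈⟨ ⊕-assoc _ _ _ ⟨
    (((down m k ⊕ c ⊛ z) ⊕ F m k ⊛ z) ⊕ d ⊛ z) ⊕ up
      ≈⟨ ⊕-congʳ (≈-trans (⊕-congʳ (⊕-assoc _ _ _)) (⊕-assoc _ _ _)) ⟩
    (down m k ⊕ ((c ⊛ z ⊕ F m k ⊛ z) ⊕ d ⊛ z)) ⊕ up
      ≈⟨ ⊕-congʳ (⊕-congˡ (≈-trans (⊕-congʳ (⊕-comm _ _)) (⊕-assoc _ _ _))) ⟩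
    (down m k ⊕ (F m k ⊛ z ⊕ (c ⊛ z ⊕ d ⊛ z))) ⊕ up
      ≈⟨ ⊕-congʳ (⊕-congˡ (≈-trans (⊛-distribʳ z _ _) (⊕-congˡ (⊛-distribʳ z c d)))) ⟨
    (down m k ⊕ (F m k ⊕ (c ⊕ d)) ⊛ z) ⊕ up ∎
    where
    z = Z m k
    c = ∑ k (λ ξ → C m (k ∸ suc ξ) ξ)
    d = ∑ k (λ ξ → D m ξ (k ∸ suc ξ))
    up = ((lam ⊕ natR k) ⊛ A m k) ⊛ Z m (suc k)
    S : ℕ → Carrier
    S v = ∑L m (suc (k + m)) (term k v)
    lows : ∀ k → ∑ k (λ v → ∑L m (suc (k + m)) (term k v)) ≈ down m k ⊕ ∑ k (λ ξ → C m (k ∸ suc ξ) ξ) ⊛ Z m k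
    lows zero    = ≈-sym (≈-trans (⊕-identityˡ _) (⊛-zeroˡ _))
    lows (suc k) = begin
      ∑ (suc k) (λ v → ∑L m (suc (suc k + m)) (term (suc k) v))
        ≈⟨ ∑-cong (suc k) (λ { v (s≤s v≤k) → low-sum m k v v≤k }) ⟩
      ∑ (suc k) (λ v → C m (k ∸ v) v ⊛ Z m (suc k) ⊕ B m (k ∸ v) v ⊛ Z m k)
        ≈⟨ ∑-+ (suc k) (λ v → C m (k ∸ v) v ⊛ Z m (suc k)) (λ v → B m (k ∸ v) v ⊛ Z m k) ⟩
      ∑ (suc k) (λ v → C m (k ∸ v) v ⊛ Z m (suc k)) ⊕ ∑ (suc k) (λ v → B m (k ∸ v) v ⊛ Z m k)
        ≈⟨ ⊕-cong (∑-⊛ʳ (suc k) (Z m (suc k)) (λ v → C m (k ∸ v) v)) (∑-⊛ʳ (suc k) (Z m k) (λ v → B m (k ∸ v) v)) ⟨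
      ∑ (suc k) (λ v → C m (k ∸ v) v) ⊛ Z m (suc k) ⊕ down m (suc k)
        ≈⟨ ⊕-comm _ _ ⟩
      down m (suc k) ⊕ ∑ (suc k) (λ v → C m (k ∸ v) v) ⊛ Z m (suc k) ∎
    high : ∑ m (λ j → S (suc (k + j))) ≈ d ⊛ z ⊕ up
    high = begin
      ∑ m (λ j → ∑L m (suc (k + m)) (term k (suc (k + j))))
        ≈⟨ ∑-cong m (λ j _ → ≈-trans (∑L-cong m (suc (k + m)) λ g _ _ → ·-split (hit g k) (term k (suc (k + j)) g))
                                     (∑L-+ m (suc (k + m)) (λ g → hit g k · term k (suc (k + j)) g) (λ g → not (hit g k) · term k (suc (k + j)) g))) ⟩
      ∑ m (λ j → ∑L m (suc (k + m)) (λ g → hit g k · term k (suc (k + j)) g)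
               ⊕ ∑L m (suc (k + m)) (λ g → not (hit g k) · term k (suc (k + j)) g))
        ≈⟨ ∑-+ m _ _ ⟩
      ∑ m (λ j → ∑L m (suc (k + m)) (λ g → hit g k · term k (suc (k + j)) g))
      ⊕ ∑ m (λ j → ∑L m (suc (k + m)) (λ g → not (hit g k) · term k (suc (k + j)) g))
        ≈⟨ ⊕-cong (valley-sum m k) (drise-sum m k) ⟩
      up ⊕ d ⊛ z
        ≈⟨ ⊕-comm _ _ ⟩
      d ⊛ z ⊕ up ∎

-- Continued fractions and Dyck paths

-- Swapping the two sequences at each step lets alternating recurrences be proved by one induction
-- in which the two cases trade places.
interleave : ∀ {a} {X : Set a} → (ℕ → X) → (ℕ → X) → ℕ → X
interleave f g zero    = f zero
interleave f g (suc j) = interleave g (f ∘ suc) j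

interleave-parity : ∀ {a} {X : Set a} (f g : ℕ → X) j →
  (if isEvenᵇ j then f ⌊ j /2⌋ else g ⌊ j /2⌋) ≡ interleave f g j
interleave-parity f g zero          = refl
interleave-parity f g (suc zero)    = refl
interleave-parity f g (suc (suc j)) with isEvenᵇ j | interleave-parity (f ∘ suc) (g ∘ suc) j
... | true  | e = e
... | false | e = e

module ContinuedFractions {ℓ₁ ℓ₂ : Level} (R : CommutativeRing ℓ₁ ℓ₂) where
  open RingSums R
  open Defs.Ring R using (Series; oneS; tS; constS; scaleS; invRev; invS; Tfrac)
    renaming (_⊖_ to _⊖S_)
  open RingProperties (CommutativeRing.ring R) using (-‿distribˡ-*; -‿+-comm; -0#≈0#)
  open SetoidReasoning setoid

  infixl 7 _⋆_
  -- The Cauchy product, unfolded along its first factor to match the fold in `invRev`.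
  _⋆_ : Series → Series → Series
  (X ⋆ Y) zero    = X 0 ⊛ Y 0
  (X ⋆ Y) (suc n) = X 0 ⊛ Y (suc n) ⊕ ((X ∘ suc) ⋆ Y) n

  ⋆-cong : ∀ n {X X′ Y Y′} → (∀ i → i ≤ n → X i ≈ X′ i) → (∀ i → i ≤ n → Y i ≈ Y′ i) → (X ⋆ Y) n ≈ (X′ ⋆ Y′) n
  ⋆-cong zero    h h′ = ⊛-cong (h 0 z≤n) (h′ 0 z≤n)
  ⋆-cong (suc n) h h′ = ⊕-cong (⊛-cong (h 0 z≤n) (h′ (suc n) ≤-refl))
    (⋆-cong n (λ i i≤n → h (suc i) (s≤s i≤n)) (λ i i≤n → h′ i (m≤n⇒m≤1+n i≤n)))

  ⋆-⊕ : ∀ n X X′ Y → ((λ i → X i ⊕ X′ i) ⋆ Y) n ≈ (X ⋆ Y) n ⊕ (X′ ⋆ Y) n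
  ⋆-⊕ zero    X X′ Y = ⊛-distribʳ _ _ _
  ⋆-⊕ (suc n) X X′ Y = ≈-trans (⊕-cong (⊛-distribʳ _ _ _) (⋆-⊕ n (X ∘ suc) (X′ ∘ suc) Y)) (⊕-swap _ _ _ _)

  ⋆-⊛ˡ : ∀ n x X Y → ((λ i → x ⊛ X i) ⋆ Y) n ≈ x ⊛ (X ⋆ Y) n
  ⋆-⊛ˡ zero    x X Y = ⊛-assoc _ _ _
  ⋆-⊛ˡ (suc n) x X Y = ≈-trans (⊕-cong (⊛-assoc _ _ _) (⋆-⊛ˡ n x (X ∘ suc) Y)) (≈-sym (⊛-distribˡ _ _ _))

  ⋆-⊛ʳ : ∀ n x X Y → (X ⋆ (λ i → x ⊛ Y i)) n ≈ x ⊛ (X ⋆ Y) n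
  ⋆-⊛ʳ zero    x X Y = ⊛-left-comm
    where
    ⊛-left-comm : ∀ {a b} → a ⊛ (x ⊛ b) ≈ x ⊛ (a ⊛ b)
    ⊛-left-comm = ≈-trans (≈-sym (⊛-assoc _ _ _)) (≈-trans (⊛-congʳ (⊛-comm _ _)) (⊛-assoc _ _ _))
  ⋆-⊛ʳ (suc n) x X Y = ≈-trans
    (⊕-cong (≈-trans (≈-sym (⊛-assoc _ _ _)) (≈-trans (⊛-congʳ (⊛-comm _ _)) (⊛-assoc _ _ _))) (⋆-⊛ʳ n x (X ∘ suc) Y))
    (≈-sym (⊛-distribˡ _ _ _))

  ⋆-zeroˡ : ∀ n {X} Y → (∀ i → X i ≈ 0#) → (X ⋆ Y) n ≈ 0#
  ⋆-zeroˡ zero    Y h = ≈-trans (⊛-congʳ (h 0)) (⊛-zeroˡ _)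
  ⋆-zeroˡ (suc n) Y h = ≈-trans (⊕-cong (≈-trans (⊛-congʳ (h 0)) (⊛-zeroˡ _)) (⋆-zeroˡ n Y (h ∘ suc))) (⊕-identityˡ _)

  ⋆-constS : ∀ n x Y → (constS x ⋆ Y) n ≈ x ⊛ Y n
  ⋆-constS zero    x Y = ≈-refl
  ⋆-constS (suc n) x Y = ≈-trans (⊕-congˡ (⋆-zeroˡ n Y λ _ → ≈-refl)) (⊕-identityʳ _)

  ⋆-oneSˡ : ∀ n Y → (oneS ⋆ Y) n ≈ Y n
  ⋆-oneSˡ zero    Y = ⊛-identityˡ _
  ⋆-oneSˡ (suc n) Y = ≈-trans (⊕-cong (⊛-identityˡ _) (⋆-zeroˡ n Y λ _ → ≈-refl)) (⊕-identityʳ _)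

  ⋆-oneSʳ : ∀ n X → (X ⋆ oneS) n ≈ X n
  ⋆-oneSʳ zero    X = ⊛-identityʳ _
  ⋆-oneSʳ (suc n) X = ≈-trans (⊕-cong (⊛-zeroʳ _) (⋆-oneSʳ n (X ∘ suc))) (⊕-identityˡ _)

  ⋆-assoc : ∀ n X Y Y′ → ((X ⋆ Y) ⋆ Y′) n ≈ (X ⋆ (Y ⋆ Y′)) n
  ⋆-assoc zero    X Y Y′ = ⊛-assoc _ _ _
  ⋆-assoc (suc n) X Y Y′ = begin
    (X 0 ⊛ Y 0) ⊛ Y′ (suc n) ⊕ ((λ i → X 0 ⊛ Y (suc i) ⊕ ((X ∘ suc) ⋆ Y) i) ⋆ Y′) n
      ≈⟨ ⊕-cong (⊛-assoc _ _ _) (⋆-⊕ n _ _ Y′) ⟩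
    X 0 ⊛ (Y 0 ⊛ Y′ (suc n)) ⊕ (((λ i → X 0 ⊛ Y (suc i)) ⋆ Y′) n ⊕ (((X ∘ suc) ⋆ Y) ⋆ Y′) n)
      ≈⟨ ⊕-congˡ (⊕-cong (⋆-⊛ˡ n (X 0) (Y ∘ suc) Y′) (⋆-assoc n (X ∘ suc) Y Y′)) ⟩
    X 0 ⊛ (Y 0 ⊛ Y′ (suc n)) ⊕ (X 0 ⊛ ((Y ∘ suc) ⋆ Y′) n ⊕ ((X ∘ suc) ⋆ (Y ⋆ Y′)) n)
      ≈⟨ ⊕-assoc _ _ _ ⟨
    (X 0 ⊛ (Y 0 ⊛ Y′ (suc n)) ⊕ X 0 ⊛ ((Y ∘ suc) ⋆ Y′) n) ⊕ ((X ∘ suc) ⋆ (Y ⋆ Y′)) n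
      ≈⟨ ⊕-congʳ (⊛-distribˡ _ _ _) ⟨
    X 0 ⊛ (Y ⋆ Y′) (suc n) ⊕ ((X ∘ suc) ⋆ (Y ⋆ Y′)) n ∎

  -- Stated to order n, since truncated fractions satisfy the path equations only up to their depth.
  ⋆-cancelˡ : ∀ n {G X Y} → G 0 ≈ 1# → (∀ i → i ≤ n → (G ⋆ X) i ≈ (G ⋆ Y) i) → ∀ i → i ≤ n → X i ≈ Y i
  ⋆-cancelˡ zero    {G} {X} {Y} g₀ h zero z≤n = begin
    X 0         ≈⟨ ≈-trans (⊛-congʳ g₀) (⊛-identityˡ _) ⟨
    G 0 ⊛ X 0   ≈⟨ h 0 z≤n ⟩
    G 0 ⊛ Y 0   ≈⟨ ≈-trans (⊛-congʳ g₀) (⊛-identityˡ _) ⟩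
    Y 0         ∎
  ⋆-cancelˡ (suc n) {G} {X} {Y} g₀ h i i≤1+n with m≤n⇒m<n∨m≡n i≤1+n
  ... | inj₁ (s≤s i≤n) = ⋆-cancelˡ n {G} g₀ (λ i i≤n → h i (m≤n⇒m≤1+n i≤n)) i i≤n
  ... | inj₂ refl      = begin
    X (suc n)          ≈⟨ ≈-trans (⊛-congʳ g₀) (⊛-identityˡ _) ⟨
    G 0 ⊛ X (suc n)    ≈⟨ ⊕-cancelʳ (((G ∘ suc) ⋆ X) n) _ _ (≈-trans (h (suc n) ≤-refl)
                            (⊕-congˡ (⋆-cong n (λ _ _ → ≈-refl) λ i i≤n → ≈-sym (⋆-cancelˡ n {G} g₀ (λ i i≤n → h i (m≤n⇒m≤1+n i≤n)) i i≤n)))) ⟩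
    G 0 ⊛ Y (suc n)    ≈⟨ ≈-trans (⊛-congʳ g₀) (⊛-identityˡ _) ⟩
    Y (suc n)          ∎

  convolve-invRev : ∀ G X n →
    Vec.foldr (λ _ → Carrier) _⊕_ 0# (Vec.zipWith _⊛_ (Vec.tabulate (λ k → X (toℕ k))) (invRev G n)) ≈ (X ⋆ invS G) n
  convolve-invRev G X zero    = ⊕-identityʳ _
  convolve-invRev G X (suc n) = ⊕-congˡ (convolve-invRev G (X ∘ suc) n)

  ⋆-invS : ∀ n {G} → G 0 ≈ 1# → (G ⋆ invS G) n ≈ oneS n
  ⋆-invS zero        g₀ = ≈-trans (⊛-identityʳ _) g₀
  ⋆-invS (suc n) {G} g₀ = begin
    G 0 ⊛ invS G (suc n) ⊕ ((G ∘ suc) ⋆ invS G) n   ≈⟨ ⊕-congʳ (≈-trans (⊛-congʳ g₀) (⊛-identityˡ _)) ⟩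
    invS G (suc n) ⊕ ((G ∘ suc) ⋆ invS G) n         ≈⟨ ⊕-congʳ (⊖-cong (convolve-invRev G (G ∘ suc) n)) ⟩
    ⊖ ((G ∘ suc) ⋆ invS G) n ⊕ ((G ∘ suc) ⋆ invS G) n ≈⟨ ⊖-inverseˡ _ ⟩
    0# ∎

  -- The recurrence says that G ⋆ X agrees with Y up to order M, where G is 1 - dl t - al t T. So
  -- does G ⋆ (invS G ⋆ Y), and G has constant term 1, so it cancels.
  level : ∀ M dl al (T X Y : Series) → X 0 ≈ Y 0 →
    (∀ n → n < M → X (suc n) ≈ Y (suc n) ⊕ (dl ⊛ X n ⊕ al ⊛ (T ⋆ X) n)) →
    ∀ n → n ≤ M → X n ≈ (invS ((oneS ⊖S tS (constS dl)) ⊖S tS (scaleS al T)) ⋆ Y) n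
  level M dl al T X Y x₀ step = ⋆-cancelˡ M {G} g₀ λ n n≤M → ≈-trans (G⋆X n n≤M) (≈-sym (begin
    (G ⋆ (invS G ⋆ Y)) n   ≈⟨ ⋆-assoc n G (invS G) Y ⟨
    ((G ⋆ invS G) ⋆ Y) n   ≈⟨ ⋆-cong n (λ i _ → ⋆-invS i {G} g₀) (λ _ _ → ≈-refl) ⟩
    (oneS ⋆ Y) n           ≈⟨ ⋆-oneSˡ n Y ⟩
    Y n                    ∎))
    where
    G : Series
    G = (oneS ⊖S tS (constS dl)) ⊖S tS (scaleS al T)
    g₀ : G 0 ≈ 1#
    g₀ = ≈-trans (⊕-cong (≈-trans (⊕-congˡ -0#≈0#) (⊕-identityʳ _)) -0#≈0#) (⊕-identityʳ _)
    ⊖1 = ⊖ 1#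
    ⊖≈ : ∀ x → ⊖ x ≈ ⊖1 ⊛ x
    ⊖≈ x = ≈-trans (⊖-cong (≈-sym (⊛-identityˡ x))) (-‿distribˡ-* 1# x)
    tail-G : ∀ n → ((G ∘ suc) ⋆ X) n ≈ ⊖ (dl ⊛ X n ⊕ al ⊛ (T ⋆ X) n)
    tail-G n = begin
      ((G ∘ suc) ⋆ X) n
        ≈⟨ ⋆-cong n {X = G ∘ suc} {X′ = λ i → ⊖1 ⊛ (constS dl i ⊕ al ⊛ T i)} (λ i _ → ≈-trans (⊕-congʳ (⊕-identityˡ _))
             (≈-trans (-‿+-comm _ _) (⊖≈ _))) (λ _ _ → ≈-refl) ⟩
      ((λ i → ⊖1 ⊛ (constS dl i ⊕ al ⊛ T i)) ⋆ X) n
        ≈⟨ ⋆-⊛ˡ n ⊖1 (λ i → constS dl i ⊕ al ⊛ T i) X ⟩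
      ⊖1 ⊛ ((λ i → constS dl i ⊕ al ⊛ T i) ⋆ X) n
        ≈⟨ ⊛-congˡ (≈-trans (⋆-⊕ n (constS dl) (λ i → al ⊛ T i) X) (⊕-cong (⋆-constS n dl X) (⋆-⊛ˡ n al T X))) ⟩
      ⊖1 ⊛ (dl ⊛ X n ⊕ al ⊛ (T ⋆ X) n)
        ≈⟨ ⊖≈ _ ⟨
      ⊖ (dl ⊛ X n ⊕ al ⊛ (T ⋆ X) n) ∎
    G⋆X : ∀ n → n ≤ M → (G ⋆ X) n ≈ Y n
    G⋆X zero    _   = ≈-trans (≈-trans (⊛-congʳ g₀) (⊛-identityˡ _)) x₀
    G⋆X (suc n) n<M = begin
      G 0 ⊛ X (suc n) ⊕ ((G ∘ suc) ⋆ X) n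
        ≈⟨ ⊕-cong (≈-trans (⊛-congʳ g₀) (≈-trans (⊛-identityˡ _) (step n n<M))) (tail-G n) ⟩
      (Y (suc n) ⊕ (dl ⊛ X n ⊕ al ⊛ (T ⋆ X) n)) ⊕ ⊖ (dl ⊛ X n ⊕ al ⊛ (T ⋆ X) n)
        ≈⟨ ≈-trans (⊕-assoc _ _ _) (≈-trans (⊕-congˡ (⊖-inverseʳ _)) (⊕-identityʳ _)) ⟩
      Y (suc n) ∎

  -- P j n counts weighted Dyck-type paths with j + 2n steps from height j to height 0.
  module _ (δs αs : ℕ → Carrier) (dn up : ℕ → Carrier) (P : ℕ → Series)
    (αs≈ : ∀ j → αs (suc j) ≈ up j ⊛ dn j) (δs≈ : ∀ j → δs (suc (suc j)) ≈ 0#)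
    (P₀-zero : P 0 0 ≈ 1#)
    (P₀-suc  : ∀ n → P 0 (suc n) ≈ δs 1 ⊛ P 0 n ⊕ up 0 ⊛ P 1 n)
    (P-zero  : ∀ j → P (suc j) 0 ≈ dn j ⊛ P j 0)
    (P-suc   : ∀ j n → P (suc j) (suc n) ≈ dn j ⊛ P j (suc n) ⊕ up (suc j) ⊛ P (suc (suc j)) n)
    where

    private
      T : ℕ → ℕ → Series
      T = Tfrac δs αs

      -- A path from height `suc j` is cut at its first step down to j. The part before the cut
      -- stays at or above `suc j` and is counted by the fraction starting at level j + 2; the part
      -- after it is counted by `P j`.
      first-passage : ∀ m j n → n ≤ m → P (suc j) n ≈ (T (suc (suc j)) m ⋆ (λ i → dn j ⊛ P j i)) n

      -- An up step from j and the first return to j contribute the product of their weights, which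
      -- is the coefficient of the fraction.
      ascend : ∀ m j n → n ≤ m → up j ⊛ P (suc j) n ≈ αs (suc j) ⊛ (T (suc (suc j)) m ⋆ P j) n
      ascend m j n n≤m = begin
        up j ⊛ P (suc j) n                                             ≈⟨ ⊛-congˡ (first-passage m j n n≤m) ⟩
        up j ⊛ (T (suc (suc j)) m ⋆ (λ i → dn j ⊛ P j i)) n             ≈⟨ ⊛-congˡ (⋆-⊛ʳ n (dn j) _ (P j)) ⟩
        up j ⊛ (dn j ⊛ (T (suc (suc j)) m ⋆ P j) n)                     ≈⟨ ⊛-assoc _ _ _ ⟨
        (up j ⊛ dn j) ⊛ (T (suc (suc j)) m ⋆ P j) n                     ≈⟨ ⊛-congʳ (αs≈ j) ⟨
        αs (suc j) ⊛ (T (suc (suc j)) m ⋆ P j) n ∎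

      first-passage zero    j zero z≤n = ≈-trans (P-zero j) (≈-sym (⊛-identityˡ _))
      first-passage (suc m) j n    n≤m = level (suc m) (δs (suc (suc j))) (αs (suc (suc j))) (T (suc (suc (suc j))) m)
        (P (suc j)) (λ i → dn j ⊛ P j i) (P-zero j)
        -- A path recurrence away from height 0 has no level term; the vanishing δ of index j + 2 is
        -- inserted to fit `level`.
        (λ { i (s≤s i≤m) → ≈-trans (P-suc j i) (⊕-congˡ (≈-trans (ascend m (suc j) i i≤m)
          (≈-sym (≈-trans (⊕-congʳ (≈-trans (⊛-congʳ (δs≈ j)) (⊛-zeroˡ _))) (⊕-identityˡ _))))) })
        n n≤m

    convergent : ∀ n m → n ≤ m → P 0 n ≈ T 1 m n
    convergent zero zero    z≤n = P₀-zero
    convergent n    (suc m) n≤m = ≈-trans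
      (level (suc m) (δs 1) (αs 1) (T 2 m) (P 0) oneS P₀-zero
        (λ { i (s≤s i≤m) → ≈-trans (P₀-suc i) (≈-trans (⊕-congˡ (ascend m 0 i i≤m)) (≈-sym (⊕-identityˡ _))) })
        n n≤m)
      (⋆-oneSʳ n _)

  private
    Step : Series → Series → Series → Carrier → Carrier → Set ℓ₂
    Step X Y Y′ b u = (Y 0 ≈ b ⊛ X 0) × (∀ n → Y (suc n) ≈ b ⊛ X (suc n) ⊕ u ⊛ Y′ n)

    interleave-Step : ∀ {X Y : ℕ → Series} {b g u u′ : ℕ → Carrier} →
      (∀ k → Step (X k) (Y k) (X (suc k)) (b k) (u k)) →
      (∀ k → Step (Y k) (X (suc k)) (Y (suc k)) (g k) (u′ k)) →
      ∀ j → Step (interleave X Y j) (interleave X Y (suc j)) (interleave X Y (suc (suc j)))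
                 (interleave b g j) (interleave u u′ j)
    interleave-Step s s′ zero    = s 0
    interleave-Step s s′ (suc j) = interleave-Step s′ (s ∘ suc) j

  -- The arrays X and Y count the paths of even and odd length from height k to
  -- height 0; splitting each level at height k into two steps, of weights E and G,
  -- turns them into Dyck-type paths on the heights 2k and 2k − 1.
  module _ (δs αs : ℕ → Carrier) (E G β U : ℕ → Carrier) (X Y : ℕ → ℕ → Carrier)
    (δ₁≈ : δs 1 ≈ G 0 ⊛ E 0) (δs≈ : ∀ j → δs (suc (suc j)) ≈ 0#)
    (αs≈ : ∀ j → αs (suc j) ≈ interleave (λ k → U k ⊛ β k) (λ k → E (suc k) ⊛ G (suc k)) j)
    (X₀₀ : X 0 0 ≈ 1#) (X₀ : ∀ k → X 0 (suc k) ≈ 0#)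
    (Y₀ : ∀ i → Y i 0 ≈ E 0 ⊛ X i 0)
    (Y⁺ : ∀ i k → Y i (suc k) ≈ β k ⊛ X i k ⊕ E (suc k) ⊛ X i (suc k))
    (X⁺ : ∀ i k → X (suc i) k ≈ G k ⊛ Y i k ⊕ U k ⊛ Y i (suc k))
    where

    private
      -- `p k` sits at height 2k and `q k` at height 2k + 1. The shift by k discards the steps
      -- forced by the descent, so n counts the up steps.
      p q : ℕ → Series
      p k n = X (k + n) k
      q k n = Y (k + n) (suc k)

      dn up : ℕ → Carrier
      dn = interleave β (G ∘ suc)
      up = interleave U (E ∘ suc)

      vanish : ∀ x {y y′} → y ≈ 0# → y′ ⊕ x ⊛ y ≈ y′
      vanish x h = ≈-trans (⊕-congˡ (≈-trans (⊛-congˡ h) (⊛-zeroʳ x))) (⊕-identityʳ _)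

      sum-zero : ∀ x x′ {y y′} → y ≈ 0# → y′ ≈ 0# → x ⊛ y ⊕ x′ ⊛ y′ ≈ 0#
      sum-zero x x′ h h′ = ≈-trans (vanish x′ h′) (≈-trans (⊛-congˡ h) (⊛-zeroʳ x))

      -- A path cannot come down to height 0 in fewer steps than its starting height. This removes
      -- the up term at the first index of each series.
      X-zero : ∀ i k → i < k → X i k ≈ 0#
      Y-zero : ∀ i k → i < k → Y i (suc k) ≈ 0#
      X-zero zero    (suc k) _         = X₀ k
      X-zero (suc i) (suc k) (s≤s i<k) = ≈-trans (X⁺ i (suc k))
        (sum-zero _ _ (Y-zero i k i<k) (Y-zero i (suc k) (m<n⇒m<1+n i<k)))
      Y-zero i k i<k = ≈-trans (Y⁺ i k) (sum-zero _ _ (X-zero i k i<k) (X-zero i (suc k) (m<n⇒m<1+n i<k)))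

      at : ∀ {a} {S : Set a} (s : ℕ → ℕ → S) {i j} k → i ≡ j → s i k ≡ s j k
      at s k refl = refl

      step-q : ∀ k → Step (p k) (q k) (p (suc k)) (β k) (E (suc k))
      step-q k = ≈-trans (Y⁺ (k + 0) k) (vanish _ (X-zero (k + 0) (suc k) (s≤s (≤-reflexive (+-identityʳ k)))))
               , λ n → ≈-trans (Y⁺ (k + suc n) k)
                   (⊕-congˡ (⊛-congˡ (≈-reflexive (at X (suc k) (+-suc k n)))))

      step-p : ∀ k → Step (q k) (p (suc k)) (q (suc k)) (G (suc k)) (U (suc k))
      step-p k = ≈-trans (X⁺ (k + 0) (suc k)) (vanish _ (Y-zero (k + 0) (suc k) (s≤s (≤-reflexive (+-identityʳ k)))))
               , λ n → ≈-trans (X⁺ (k + suc n) (suc k))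
                   (⊕-congˡ (⊛-congˡ (≈-reflexive (at Y (suc (suc k)) (+-suc k n)))))

      steps : ∀ j → Step (interleave p q j) (interleave p q (suc j)) (interleave p q (suc (suc j))) (dn j) (up (suc j))
      steps = interleave-Step step-q step-p

      interleave-⊛ : ∀ {b g u u′ : ℕ → Carrier} j →
        interleave (λ k → u k ⊛ b k) (λ k → u′ k ⊛ g k) j ≡ interleave u u′ j ⊛ interleave b g j
      interleave-⊛ zero    = refl
      interleave-⊛ {b} {g} {u} {u′} (suc j) = interleave-⊛ {g} {b ∘ suc} {u′} {u ∘ suc} j

    paths-convergent : ∀ n m → n ≤ m → X n 0 ≈ Tfrac δs αs 1 m n
    paths-convergent = convergent δs αs dn up (interleave p q)
      (λ j → ≈-trans (αs≈ j) (≈-reflexive (interleave-⊛ {β} {G ∘ suc} {U} {E ∘ suc} j)))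
      δs≈ X₀₀
      -- `Y n 0` is at height -1 and only continues to height 0 with weight E 0. Eliminating it
      -- turns the detour into a loop of weight G 0 E 0, the coefficient δ 1.
      (λ n → ≈-trans (X⁺ n 0) (⊕-congʳ (≈-trans (⊛-congˡ (Y₀ n)) (≈-trans (≈-sym (⊛-assoc _ _ _)) (⊛-congʳ (≈-sym δ₁≈))))))
      (λ j → proj₁ (steps j)) (λ j → proj₂ (steps j))

-- Specialization of the recurrence by parity

isEvenᵇ-2* : ∀ i → isEvenᵇ (2 * i) ≡ true
isEvenᵇ-2* zero    = refl
isEvenᵇ-2* (suc i) rewrite +-suc i (i + 0) | isEvenᵇ-2* i = refl

module Parity {ℓ₁ ℓ₂ : Level} (R : CommutativeRing ℓ₁ ℓ₂)
  (lam : CommutativeRing.Carrier R) (a : ℕ → CommutativeRing.Carrier R)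
  (b c d : ℕ → ℕ → CommutativeRing.Carrier R) (e f : ℕ → CommutativeRing.Carrier R) where
  open RingSums R
  open ContinuedFractions R
  open Defs.Ring R using (natR; sumR; diagSum; δ; α; Tfrac)
  open SetoidReasoning setoid

  -- An element with an even number of larger ones has even position in [2n], and
  -- the weights excluded by the D-condition at that position are set to 0.
  even odd : (ℕ → ℕ → Carrier) → ℕ → ℕ → ℕ → Carrier
  even x m i j = if isEvenᵇ m then x i j else 0#
  odd  x m i j = if isEvenᵇ m then 0# else x i j

  A : ℕ → ℕ → Carrier
  A m i = if isEvenᵇ m then 0# else a i

  F : ℕ → ℕ → Carrier
  F m i = lam ⊛ (if isEvenᵇ m then e i else f i)

  -- `diagSum` with its index shifted by one, so that k = 0 gives the empty sum; this lets the
  -- bottom level share the formulas of the others.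
  diag : (ℕ → ℕ → Carrier) → ℕ → Carrier
  diag x k = ∑ k (λ ξ → x (k ∸ suc ξ) ξ)

  private
    sumR-upTo : ∀ n (x : ℕ → Carrier) g → sumR (map x (applyUpTo g n)) ≡ ∑ n (x ∘ g)
    sumR-upTo zero    x g = refl
    sumR-upTo (suc n) x g = cong (x (g 0) ⊕_) (sumR-upTo n x (g ∘ suc))

    diagSum≡ : ∀ x k → diagSum lam a b c d e f x k ≡ diag x (suc k)
    diagSum≡ x k = sumR-upTo (suc k) (λ ξ → x (k ∸ ξ) ξ) id

  -- In the recurrence `D` receives the count from below first, while `C` receives it second;
  -- reversing the sum brings both to one form.
  diag-reverse : ∀ x k → ∑ k (λ ξ → x ξ (k ∸ suc ξ)) ≈ diag x k
  diag-reverse x k = ≈-trans (∑-reverse k (λ ξ → x ξ (k ∸ suc ξ)))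
    (∑-cong k λ ξ ξ<k → ≈-reflexive (cong₂ x (pred-∸ k ξ) (back ξ<k)))
    where
    pred-∸ : ∀ k ξ → pred k ∸ ξ ≡ k ∸ suc ξ
    pred-∸ zero    ξ = 0∸n≡0 ξ
    pred-∸ (suc k) ξ = refl
    back : ∀ {k ξ} → ξ < k → k ∸ suc (pred k ∸ ξ) ≡ ξ
    back {suc k} (s≤s ξ≤k) = m∸[m∸n]≡n ξ≤k

  diag-even : ∀ x m k → diag (even x m) k ≈ (if isEvenᵇ m then diag x k else 0#)
  diag-even x m k with isEvenᵇ m
  ... | true  = ≈-refl
  ... | false = ∑-zero k λ _ _ → ≈-refl

  diag-odd : ∀ x m k → diag (odd x m) k ≈ (if isEvenᵇ m then 0# else diag x k)
  diag-odd x m k with isEvenᵇ m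
  ... | true  = ∑-zero k λ _ _ → ≈-refl
  ... | false = ≈-refl

  level-weight : ℕ → ℕ → Carrier
  level-weight m k = if isEvenᵇ m then lam ⊛ e k ⊕ diag c k else lam ⊛ f k ⊕ diag d k

  module _ (C D : ℕ → ℕ → ℕ → Carrier)
    (CD : ∀ m k → diag (C m) k ⊕ diag (D m) k ≈ (if isEvenᵇ m then diag c k else diag d k)) where
    open StateSums R lam A (even b) C D F using (Z; Z-step; down)

    private
      level≈ : ∀ m k → F m k ⊕ (diag (C m) k ⊕ ∑ k (λ ξ → D m ξ (k ∸ suc ξ))) ≈ level-weight m k
      level≈ m k = ≈-trans (⊕-congˡ (≈-trans (⊕-congˡ (diag-reverse (D m) k)) (CD m k))) collect
        where
        collect : F m k ⊕ (if isEvenᵇ m then diag c k else diag d k) ≈ level-weight m k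
        collect with isEvenᵇ m
        ... | true  = ≈-refl
        ... | false = ≈-refl

      step : ∀ m k → Z (suc m) k ≈ (down m k ⊕ level-weight m k ⊛ Z m k) ⊕ ((lam ⊕ natR k) ⊛ A m k) ⊛ Z m (suc k)
      step m k = ≈-trans (Z-step m k) (⊕-congʳ (⊕-congˡ (⊛-congʳ (level≈ m k))))

      E G : ℕ → Carrier
      E k = lam ⊛ e k ⊕ diag c k
      G k = lam ⊛ f k ⊕ diag d k
      U : ℕ → Carrier
      U k = (lam ⊕ natR k) ⊛ a k

      even-step : ∀ m k → isEvenᵇ m ≡ true → Z (suc m) k ≈ down m k ⊕ E k ⊛ Z m k
      even-step m k ev = begin
        Z (suc m) k
          ≈⟨ step m k ⟩
        (down m k ⊕ level-weight m k ⊛ Z m k) ⊕ ((lam ⊕ natR k) ⊛ A m k) ⊛ Z m (suc k)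
          ≡⟨ cong (λ b → (down m k ⊕ (if b then E k else G k) ⊛ Z m k)
                         ⊕ ((lam ⊕ natR k) ⊛ (if b then 0# else a k)) ⊛ Z m (suc k)) ev ⟩
        (down m k ⊕ E k ⊛ Z m k) ⊕ ((lam ⊕ natR k) ⊛ 0#) ⊛ Z m (suc k)
          ≈⟨ ≈-trans (⊕-congˡ (≈-trans (⊛-congʳ (⊛-zeroʳ _)) (⊛-zeroˡ _))) (⊕-identityʳ _) ⟩
        down m k ⊕ E k ⊛ Z m k ∎

      odd-step : ∀ m k → isEvenᵇ m ≡ false → Z (suc m) k ≈ G k ⊛ Z m k ⊕ U k ⊛ Z m (suc k)
      odd-step m k ev = begin
        Z (suc m) k
          ≈⟨ step m k ⟩
        (down m k ⊕ level-weight m k ⊛ Z m k) ⊕ ((lam ⊕ natR k) ⊛ A m k) ⊛ Z m (suc k)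
          ≡⟨ cong (λ b → (down m k ⊕ (if b then E k else G k) ⊛ Z m k)
                         ⊕ ((lam ⊕ natR k) ⊛ (if b then 0# else a k)) ⊛ Z m (suc k)) ev ⟩
        (down m k ⊕ G k ⊛ Z m k) ⊕ U k ⊛ Z m (suc k)
          ≈⟨ ⊕-congʳ (≈-trans (⊕-congʳ (down≈0 k)) (⊕-identityˡ _)) ⟩
        G k ⊛ Z m k ⊕ U k ⊛ Z m (suc k) ∎
        where
        down≈0 : ∀ k → down m k ≈ 0#
        down≈0 zero    = ≈-refl
        down≈0 (suc k) = ≈-trans (⊛-congʳ (∑-zero (suc k) λ ξ _ →
          ≈-reflexive (cong (λ v → if v then b (k ∸ ξ) ξ else 0#) ev))) (⊛-zeroˡ _)

      ev2* : ∀ i → isEvenᵇ (suc (2 * i)) ≡ false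
      ev2* i = cong not (isEvenᵇ-2* i)

    -- Double falls and double rises both preserve the number of open paths, so `C` and `D` enter
    -- only through the sum in `CD`. The same argument therefore serves the unprimed weights and,
    -- with the two roles exchanged, the primed ones.
    state-sum-convergent : ∀ n m → n ≤ m →
      Z (2 * n) 0 ≈ Tfrac (δ lam a b c d e f) (α lam a b c d e f) 1 m n
    state-sum-convergent = paths-convergent (δ lam a b c d e f) (α lam a b c d e f) E G (λ k → diag b (suc k)) U
      (λ i → Z (2 * i)) (λ i → Z (suc (2 * i)))
      δ₁≈ (λ _ → ≈-refl) α≈ (≈-refl) (λ _ → ≈-refl)
      (λ i → ≈-trans (even-step (2 * i) 0 (isEvenᵇ-2* i)) (⊕-identityˡ _))
      (λ i k → ≈-trans (even-step (2 * i) (suc k) (isEvenᵇ-2* i)) (⊕-congʳ (⊛-congʳ (∑-cong (suc k) λ ξ _ →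
        ≈-reflexive (cong (λ v → if v then b (k ∸ ξ) ξ else 0#) (isEvenᵇ-2* i))))))
      (λ i k → ≈-trans (≈-reflexive (cong (λ m → Z m k) (*-suc 2 i))) (odd-step (suc (2 * i)) k (ev2* i)))
      where
      δ₁≈ : ((lam ⊛ lam) ⊛ e 0) ⊛ f 0 ≈ G 0 ⊛ E 0
      δ₁≈ = begin
        ((lam ⊛ lam) ⊛ e 0) ⊛ f 0    ≈⟨ ⊛-congʳ (⊛-assoc lam lam (e 0)) ⟩
        (lam ⊛ (lam ⊛ e 0)) ⊛ f 0    ≈⟨ ⊛-congʳ (⊛-comm lam _) ⟩
        ((lam ⊛ e 0) ⊛ lam) ⊛ f 0    ≈⟨ ⊛-assoc _ lam (f 0) ⟩
        (lam ⊛ e 0) ⊛ (lam ⊛ f 0)    ≈⟨ ⊛-comm _ _ ⟩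
        (lam ⊛ f 0) ⊛ (lam ⊛ e 0)    ≈⟨ ⊛-cong (⊕-identityʳ _) (⊕-identityʳ _) ⟨
        G 0 ⊛ E 0 ∎
      α≈ : ∀ j → α lam a b c d e f (suc j) ≈ interleave (λ k → U k ⊛ diag b (suc k)) (λ k → E (suc k) ⊛ G (suc k)) j
      α≈ j = begin
        α lam a b c d e f (suc j)
          ≡⟨ cong₂ (λ x y → if isEvenᵇ j then x else y)
               (cong (U ⌊ j /2⌋ ⊛_) (diagSum≡ b ⌊ j /2⌋))
               (cong₂ (λ x y → (lam ⊛ e (suc ⌊ j /2⌋) ⊕ x) ⊛ (lam ⊛ f (suc ⌊ j /2⌋) ⊕ y)) (diagSum≡ c ⌊ j /2⌋) (diagSum≡ d ⌊ j /2⌋)) ⟩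
        (if isEvenᵇ j then U ⌊ j /2⌋ ⊛ diag b (suc ⌊ j /2⌋) else E (suc ⌊ j /2⌋) ⊛ G (suc ⌊ j /2⌋))
          ≡⟨ interleave-parity (λ k → U k ⊛ diag b (suc k)) (λ k → E (suc k) ⊛ G (suc k)) j ⟩
        interleave (λ k → U k ⊛ diag b (suc k)) (λ k → E (suc k) ⊛ G (suc k)) j ∎

-- Sums over functions between finite sets

values : ∀ {m N} → (Fin m → Fin N) → List ℕ
values σ = tabulate (toℕ ∘ σ)

module FunctionSums {ℓ₁ ℓ₂ : Level} (R : CommutativeRing ℓ₁ ℓ₂) where
  open RingSums R
  open Defs.Ring R using (sumR)
  open SetoidReasoning setoid

  Σₗ : ∀ {a} {X : Set a} → List X → (X → Carrier) → Carrier
  Σₗ xs φ = sumR (map φ xs)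

  module _ {a} {X : Set a} where

    Σₗ-cong : ∀ (xs : List X) {φ ψ} → (∀ x → φ x ≈ ψ x) → Σₗ xs φ ≈ Σₗ xs ψ
    Σₗ-cong []       h = ≈-refl
    Σₗ-cong (x ∷ xs) h = ⊕-cong (h x) (Σₗ-cong xs h)

    Σₗ-zero : ∀ (xs : List X) {φ} → (∀ x → φ x ≈ 0#) → Σₗ xs φ ≈ 0#
    Σₗ-zero []       h = ≈-refl
    Σₗ-zero (x ∷ xs) h = ≈-trans (⊕-cong (h x) (Σₗ-zero xs h)) (⊕-identityˡ _)

    Σₗ-⊕ : ∀ (xs : List X) φ ψ → Σₗ xs (λ x → φ x ⊕ ψ x) ≈ Σₗ xs φ ⊕ Σₗ xs ψ
    Σₗ-⊕ []       φ ψ = ≈-sym (⊕-identityˡ _)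
    Σₗ-⊕ (x ∷ xs) φ ψ = ≈-trans (⊕-congˡ (Σₗ-⊕ xs φ ψ)) (⊕-swap _ _ _ _)

    Σₗ-++ : ∀ (xs ys : List X) φ → Σₗ (xs ++ ys) φ ≈ Σₗ xs φ ⊕ Σₗ ys φ
    Σₗ-++ []       ys φ = ≈-sym (⊕-identityˡ _)
    Σₗ-++ (x ∷ xs) ys φ = ≈-trans (⊕-congˡ (Σₗ-++ xs ys φ)) (≈-sym (⊕-assoc _ _ _))

    Σₗ-filter : ∀ (p : X → Bool) xs φ → Σₗ (filterᵇ p xs) φ ≈ Σₗ xs (λ x → p x · φ x)
    Σₗ-filter p []       φ = ≈-refl
    Σₗ-filter p (x ∷ xs) φ with p x
    ... | true  = ⊕-congˡ (Σₗ-filter p xs φ)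
    ... | false = ≈-trans (Σₗ-filter p xs φ) (≈-sym (⊕-identityˡ _))

    Σₗ-tabulate : ∀ {n} (h : Fin n → X) (φ : ℕ → Carrier) ψ → (∀ i → ψ (h i) ≈ φ (toℕ i)) →
                  Σₗ (tabulate h) ψ ≈ ∑ n φ
    Σₗ-tabulate {zero}  h φ ψ e = ≈-refl
    Σₗ-tabulate {suc n} h φ ψ e = ⊕-cong (e Fin.zero) (Σₗ-tabulate (h ∘ Fin.suc) (φ ∘ suc) ψ (e ∘ Fin.suc))

    Σₗ-tabulate-single : ∀ {n} (h : Fin n → X) i ψ → (∀ j → j ≢ i → ψ (h j) ≈ 0#) → Σₗ (tabulate h) ψ ≈ ψ (h i)
    Σₗ-tabulate-single {suc n} h Fin.zero ψ e =
      ≈-trans (⊕-congˡ (zeros (h ∘ Fin.suc) λ j → e (Fin.suc j) λ ())) (⊕-identityʳ _)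
      where
      zeros : ∀ {n} (h : Fin n → X) → (∀ j → ψ (h j) ≈ 0#) → Σₗ (tabulate h) ψ ≈ 0#
      zeros {zero}  h e = ≈-refl
      zeros {suc n} h e = ≈-trans (⊕-cong (e Fin.zero) (zeros (h ∘ Fin.suc) (e ∘ Fin.suc))) (⊕-identityˡ _)
    Σₗ-tabulate-single {suc n} h (Fin.suc i) ψ e =
      ≈-trans (⊕-cong (e Fin.zero λ ()) (Σₗ-tabulate-single (h ∘ Fin.suc) i ψ λ j j≢i → e (Fin.suc j) (j≢i ∘ Fin.suc-injective)))
              (⊕-identityˡ _)

  module _ {a b} {X : Set a} {Y : Set b} where

    Σₗ-swap : ∀ (xs : List X) (ys : List Y) (φ : X → Y → Carrier) → Σₗ xs (λ x → Σₗ ys (φ x)) ≈ Σₗ ys (λ y → Σₗ xs (λ x → φ x y))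
    Σₗ-swap []       ys φ = ≈-sym (Σₗ-zero ys λ _ → ≈-refl)
    Σₗ-swap (x ∷ xs) ys φ = ≈-trans (⊕-congˡ (Σₗ-swap xs ys φ)) (≈-sym (Σₗ-⊕ ys (φ x) (λ y → Σₗ xs (λ x′ → φ x′ y))))

    Σₗ-map : ∀ (h : X → Y) xs φ → Σₗ (map h xs) φ ≡ Σₗ xs (φ ∘ h)
    Σₗ-map h []       φ = refl
    Σₗ-map h (x ∷ xs) φ = cong (φ (h x) ⊕_) (Σₗ-map h xs φ)

    Σₗ-concatMap : ∀ (h : X → List Y) xs φ → Σₗ (concatMap h xs) φ ≈ Σₗ xs (λ x → Σₗ (h x) φ)
    Σₗ-concatMap h []       φ = ≈-refl
    Σₗ-concatMap h (x ∷ xs) φ = ≈-trans (Σₗ-++ (h x) _ φ) (⊕-congˡ (Σₗ-concatMap h xs φ))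

  Σₗ-allFuns-suc : ∀ m N φ → Σₗ (allFuns (suc m) N) φ ≈ Σₗ (allFin N) (λ v → Σₗ (allFuns m N) (φ ∘ consF v))
  Σₗ-allFuns-suc m N φ = ≈-trans (Σₗ-concatMap (λ v → map (consF v) (allFuns m N)) (allFin N) φ)
    (Σₗ-cong (allFin N) λ v → ≈-reflexive (Σₗ-map (consF v) (allFuns m N) φ))

  Σₗ-allFuns : ∀ m N ψ → Σₗ (allFuns m N) (ψ ∘ values) ≈ ∑L m N ψ
  Σₗ-allFuns zero    N ψ = ⊕-identityʳ _
  Σₗ-allFuns (suc m) N ψ = ≈-trans (Σₗ-allFuns-suc m N (ψ ∘ values))
    (Σₗ-tabulate {n = N} id (λ v → ∑L m N (ψ ∘ (v ∷_))) _ λ v → Σₗ-allFuns m N (ψ ∘ (toℕ v ∷_)))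

  -- Functions are compared pointwise, in the absence of extensionality: `p` singles out the
  -- functions agreeing with ρ everywhere, and `allFuns` lists exactly one of them.
  Σₗ-allFuns-single : ∀ m {N} (p : (Fin m → Fin N) → Bool) (ρ : Fin m → Fin N) x →
    (∀ τ → p τ ≡ true → ∀ i → τ i ≡ ρ i) → (∀ τ → (∀ i → τ i ≡ ρ i) → p τ ≡ true) →
    Σₗ (allFuns m N) (λ τ → p τ · x) ≈ x
  Σₗ-allFuns-single zero p ρ x h h′ =
    ≈-trans (⊕-identityʳ _) (≈-reflexive (cong (_· x) (h′ (λ ()) λ ())))
  Σₗ-allFuns-single (suc m) {N} p ρ x h h′ = begin
    Σₗ (allFuns (suc m) N) (λ τ → p τ · x)
      ≈⟨ Σₗ-allFuns-suc m N (λ τ → p τ · x) ⟩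
    Σₗ (allFin N) (λ v → Σₗ (allFuns m N) (λ g → p (consF v g) · x))
      ≈⟨ Σₗ-tabulate-single id (ρ Fin.zero) (λ v → Σₗ (allFuns m N) (λ g → p (consF v g) · x))
           (λ v v≢ → Σₗ-zero (allFuns m N) λ g →
             ≈-reflexive (cong (_· x) (≢true⇒false λ e → v≢ (h (consF v g) e Fin.zero)))) ⟩
    Σₗ (allFuns m N) (λ g → p (consF (ρ Fin.zero) g) · x)
      ≈⟨ Σₗ-allFuns-single m (p ∘ consF (ρ Fin.zero)) (ρ ∘ Fin.suc) x
           (λ g e i → h (consF (ρ Fin.zero) g) e (Fin.suc i))
           (λ g e → h′ (consF (ρ Fin.zero) g) λ { Fin.zero → refl ; (Fin.suc i) → e i }) ⟩
    x ∎

-- Orbits of permutations of an initial segment of ℕ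

iterate : (ℕ → ℕ) → ℕ → ℕ → ℕ
iterate s zero    x = x
iterate s (suc i) x = iterate s i (s x)

iterate-suc : ∀ s i x → iterate s (suc i) x ≡ s (iterate s i x)
iterate-suc s zero    x = refl
iterate-suc s (suc i) x = iterate-suc s i (s x)

iterate-+ : ∀ s i j x → iterate s (j + i) x ≡ iterate s i (iterate s j x)
iterate-+ s i zero    x = refl
iterate-+ s i (suc j) x = iterate-+ s i j (s x)

iterate-< : ∀ {N} s → (∀ x → x < N → s x < N) → ∀ i x → x < N → iterate s i x < N
iterate-< s s< zero    x x<N = x<N
iterate-< s s< (suc i) x x<N = iterate-< s s< i (s x) (s< x x<N)

Stays : (ℕ → ℕ) → ℕ → ℕ → Set
Stays s k x = ∀ i → k ≤ iterate s i x

segment : (ℕ → ℕ) → ℕ → ℕ → List ℕ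
segment s k zero    = []
segment s k (suc m) = s k ∷ segment s (suc k) m

length-segment : ∀ s k m → length (segment s k m) ≡ m
length-segment s k zero    = refl
length-segment s k (suc m) = cong suc (length-segment s (suc k) m)

tabulate-segment : ∀ {m} s k (f : Fin m → ℕ) → (∀ i → f i ≡ s (k + toℕ i)) → tabulate f ≡ segment s k m
tabulate-segment {zero}  s k f h = refl
tabulate-segment {suc m} s k f h = cong₂ _∷_
  (trans (h Fin.zero) (cong s (+-identityʳ k)))
  (tabulate-segment s (suc k) (f ∘ Fin.suc) λ i → trans (h (Fin.suc i)) (cong s (+-suc k (toℕ i))))

hit-segment⇒ : ∀ s k m {q} → hit (segment s k m) q ≡ true → ∃ λ j → k ≤ j × j < k + m × s j ≡ q
hit-segment⇒ s k (suc m) {q} e with ∨-split {s k ≡ᵇ q} e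
... | inj₁ e′ = k , ≤-refl , m<m+n k (s≤s z≤n) , true-≡ᵇ e′
... | inj₂ e′ with hit-segment⇒ s (suc k) m e′
...   | j , k<j , j< , sj = j , <⇒≤ k<j , subst (j <_) (sym (+-suc k m)) j< , sj

⇒hit-segment : ∀ s k m {q} j → k ≤ j → j < k + m → s j ≡ q → hit (segment s k m) q ≡ true
⇒hit-segment s k zero    j k≤j j< sj = ⊥-elim (<⇒≱ j< (subst (_≤ j) (sym (+-identityʳ k)) k≤j))
⇒hit-segment s k (suc m) j k≤j j< sj with m≤n⇒m<n∨m≡n k≤j
... | inj₁ k<j  = ∨-true₂ (⇒hit-segment s (suc k) m j k<j (subst (j <_) (+-suc k m) j<) sj)
... | inj₂ refl = ∨-true₁ (≡ᵇ-true sj)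

-- The stretch of an orbit from x up to its first point below k; `Stays` is the opposite case, where
-- no such point exists.
data Walk (s : ℕ → ℕ) (k : ℕ) : ℕ → ℕ → Set where
  stop : ∀ {x} → x < k → Walk s k x x
  go   : ∀ {x y} → k ≤ x → Walk s k (s x) y → Walk s k x y

module _ {s : ℕ → ℕ} {k : ℕ} where

  walk-lower : ∀ {x y} → Walk s (suc k) x y → y < k → Walk s k x y
  walk-lower (stop _) y<k = stop y<k
  walk-lower (go k<x w) y<k = go (<⇒≤ k<x) (walk-lower w y<k)

  walk-through : ∀ {x y} → Walk s (suc k) x k → Walk s k (s k) y → Walk s k x y
  walk-through (stop _)   v = go ≤-refl v
  walk-through (go k<x w) v = go (<⇒≤ k<x) (walk-through w v)

  walk-iterate : ∀ {x y} → Walk s k x y → ∃ λ i → iterate s i x ≡ y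
  walk-iterate (stop _) = 0 , refl
  walk-iterate (go _ w) with walk-iterate w
  ... | i , e = suc i , e

  stays-through : ∀ {x} → Walk s (suc k) x k → Stays s k (s k) → Stays s k x
  stays-through (stop _)   h zero    = ≤-refl
  stays-through (stop _)   h (suc i) = h i
  stays-through (go k<x w) h zero    = <⇒≤ k<x
  stays-through (go k<x w) h (suc i) = stays-through w h i

  stays-loop : Walk s (suc k) (s k) k → ∀ {x} → Walk s (suc k) x k → Stays s k x
  stays-loop v (stop _)   zero    = ≤-refl
  stays-loop v (stop _)   (suc i) = stays-loop v v i
  stays-loop v (go k<x w) zero    = <⇒≤ k<x
  stays-loop v (go k<x w) (suc i) = stays-loop v w i

module _ {N : ℕ} {s : ℕ → ℕ} (s< : ∀ x → x < N → s x < N) where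

  -- Gives a meaning to the junk values of `exit`: a result at or above k certifies that the orbit
  -- never descends below k. It arises when the orbit is already caught above k or returns to k from
  -- `s k`.
  exit-segment : ∀ m k x → k + m ≡ N → x < N → let y = exit k (segment s k m) x in
    (y < k × Walk s k x y) ⊎ (k ≤ y × Stays s k x)
  exit-segment zero    k x refl x<N =
    let x<k = subst (x <_) (+-identityʳ k) x<N in inj₁ (x<k , stop x<k)
  exit-segment (suc m) k x k+m≡N x<N with exit-segment m (suc k) x (trans (sym (+-suc k m)) k+m≡N) x<N
  ... | inj₂ (k<y , h) rewrite ≡ᵇ-false (<⇒≢ k<y ∘ sym) = inj₂ (<⇒≤ k<y , λ i → <⇒≤ (h i))
  ... | inj₁ (s≤s y≤k , w) with m≤n⇒m<n∨m≡n y≤k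
  ...   | inj₁ y<k rewrite ≡ᵇ-false (<⇒≢ y<k) = inj₁ (y<k , walk-lower w y<k)
  ...   | inj₂ y≡k rewrite ≡ᵇ-true y≡k
          with exit-segment m (suc k) (s k) (trans (sym (+-suc k m)) k+m≡N)
                 (s< k (subst (k <_) k+m≡N (m<m+n k (s≤s z≤n))))
  ...     | inj₂ (k<y′ , h) = inj₂ (<⇒≤ k<y′ , stays-through (subst (Walk s (suc k) x) y≡k w) (λ i → <⇒≤ (h i)))
  ...     | inj₁ (s≤s y′≤k , w′) with m≤n⇒m<n∨m≡n y′≤k
  ...       | inj₁ y′<k = inj₁ (y′<k , walk-through (subst (Walk s (suc k) x) y≡k w) (walk-lower w′ y′<k))
  ...       | inj₂ y′≡k = inj₂ (≤-reflexive (sym y′≡k) , stays-loop (subst (Walk s (suc k) (s k)) y′≡k w′) (subst (Walk s (suc k) x) y≡k w))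

  module _ (s-injective : ∀ x y → x < N → y < N → s x ≡ s y → x ≡ y) where

    iterate-injective : ∀ i x y → x < N → y < N → iterate s i x ≡ iterate s i y → x ≡ y
    iterate-injective zero    x y x< y< e = e
    iterate-injective (suc i) x y x< y< e =
      s-injective x y x< y< (iterate-injective i (s x) (s y) (s< x x<) (s< y y<) e)

    -- Among the first N + 1 iterates two coincide by the pigeonhole principle, and injectivity
    -- strips off their common initial part.
    periodic : ∀ x → x < N → ∃ λ p → p < N × iterate s (suc p) x ≡ x
    periodic x x<N with Fin.pigeonhole (≤-refl {suc N}) (λ i → fromℕ< (iterate-< s s< (toℕ i) x x<N))
    ... | i , j , i<j , e with m≤n⇒∃[o]m+o≡n i<j
    ...   | p , i+p≡j = p , ≤-trans (s≤s (≤-trans (m≤n+m p (toℕ i)) (≤-reflexive (suc-injective (trans i+p≡j (sym (suc-pred-toℕ j i<j)))))))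
                              (≤-trans (≤-reflexive (suc-pred-toℕ j i<j)) (≤-pred (Fin.toℕ<n j)))
                      , sym (iterate-injective (toℕ i) x _ x<N (iterate-< s s< (suc p) x x<N) (begin
      iterate s (toℕ i) x                        ≡⟨ Fin.fromℕ<-injective _ _ _ _ e ⟩
      iterate s (toℕ j) x                        ≡⟨ cong (λ n → iterate s n x) (trans (sym i+p≡j) (cong suc (+-comm (toℕ i) p))) ⟩
      iterate s (suc p + toℕ i) x                ≡⟨ iterate-+ s (toℕ i) (suc p) x ⟩
      iterate s (toℕ i) (iterate s (suc p) x)    ∎))
      where
      open ≡-Reasoning
      suc-pred-toℕ : ∀ {n a} (j : Fin n) → a < toℕ j → suc (pred (toℕ j)) ≡ toℕ j
      suc-pred-toℕ (Fin.suc j) _ = refl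

    -- `cyc` inspects N iterates only; a later one repeats an earlier one, because the period is at
    -- most N. The bound in `fuel` makes the descent structural.
    stays-bounded : ∀ x → x < N → (∀ i → i < N → x ≤ iterate s i x) → Stays s x x
    stays-bounded x x<N h i = fuel i i ≤-refl
      where
      p = proj₁ (periodic x x<N)
      fuel : ∀ b i → i ≤ b → x ≤ iterate s i x
      fuel b i i≤b with <-≤-connex i (suc p)
      ... | inj₁ i<p = h i (≤-trans i<p (proj₁ (proj₂ (periodic x x<N))))
      fuel zero    zero    i≤b | inj₂ ()
      fuel (suc b) (suc i) (s≤s i≤b) | inj₂ (s≤s p≤i) = subst (x ≤_) (begin
        iterate s (i ∸ p) x                        ≡⟨ cong (iterate s (i ∸ p)) (proj₂ (proj₂ (periodic x x<N))) ⟨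
        iterate s (i ∸ p) (iterate s (suc p) x)    ≡⟨ iterate-+ s (i ∸ p) (suc p) x ⟨
        iterate s (suc (p + (i ∸ p))) x            ≡⟨ cong (λ n → iterate s (suc n) x) (m+[n∸m]≡n p≤i) ⟩
        iterate s (suc i) x                        ∎)
        (fuel b (i ∸ p) (≤-trans (m∸n≤m i p) i≤b))
        where open ≡-Reasoning

record Inverses (N : ℕ) (s t : ℕ → ℕ) : Set where
  field
    s< : ∀ x → x < N → s x < N
    t< : ∀ x → x < N → t x < N
    ts : ∀ x → x < N → t (s x) ≡ x
    st : ∀ x → x < N → s (t x) ≡ x

  injective : ∀ x y → x < N → y < N → s x ≡ s y → x ≡ y
  injective x y x<N y<N e = trans (sym (ts x x<N)) (trans (cong t e) (ts y y<N))

  -- The bridge from lists to permutations: being hit by larger elements is a comparison with the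
  -- preimage `t q`, and in this form preimages enter all the counts.
  hit-segment : ∀ x m q → suc x + m ≡ N → q < N → hit (segment s (suc x) m) q ≡ (x <ᵇ t q)
  hit-segment x m q eq q<N = bool-ext
    (λ e → let (j , x<j , j< , sj) = hit-segment⇒ s (suc x) m e in
       <ᵇ-true (subst (x <_) (trans (sym (ts j (subst (j <_) eq j<))) (cong t sj)) x<j))
    (λ e → ⇒hit-segment s (suc x) m (t q) (true-<ᵇ e) (subst (t q <_) (sym eq) (t< q q<N)) (st q q<N))

  -- By periodicity every backward iterate is also a forward iterate.
  stays-inverse : ∀ x → x < N → Stays s x x → Stays t x x
  stays-inverse x x<N h i with back i
    where
    back : ∀ i → ∃ λ j → iterate t i x ≡ iterate s j x
    back zero = 0 , refl
    back (suc i) with back i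
    ... | suc j , e = j , trans (iterate-suc t i x) (trans (cong t (trans e (iterate-suc s j x)))
                            (ts _ (iterate-< s s< j x x<N)))
    ... | zero , e with periodic s< injective x x<N
    ...   | p , _ , e′ = p , trans (iterate-suc t i x) (trans (cong t (trans e (trans (sym e′) (iterate-suc s p x))))
                               (ts _ (iterate-< s s< p x x<N)))
  ... | j , e = subst (x ≤_) (sym e) (h j)

  -- With `stays⇒exit`, identifies the closing test of the state weights with minimality in a cycle:
  -- the orbit of `s x` first drops to x or below at x itself precisely when nothing on the cycle is
  -- smaller.
  exit⇒stays : ∀ x m → suc x + m ≡ N → exit (suc x) (segment s (suc x) m) (s x) ≡ x → Stays s x x
  exit⇒stays x m eq e with exit-segment s< m (suc x) (s x) eq (s< x (subst (x <_) eq (s≤s (m≤m+n x m))))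
  ... | inj₁ (_ , w)   = stays-loop w′ (stop ≤-refl)
    where w′ = subst (Walk s (suc x) (s x)) e w
  ... | inj₂ (x<y , _) = ⊥-elim (<⇒≢ x<y (sym e))

  stays⇒exit : ∀ x m → suc x + m ≡ N → Stays s x x → exit (suc x) (segment s (suc x) m) (s x) ≡ x
  stays⇒exit x m eq h with exit-segment s< m (suc x) (s x) eq (s< x x<N)
    where x<N = subst (x <_) eq (s≤s (m≤m+n x m))
  ... | inj₁ (s≤s y≤x , w) with walk-iterate w
  ...   | i , e = ≤-antisym y≤x (subst (x ≤_) e (h (suc i)))
  stays⇒exit x m eq h | inj₂ (_ , h′) with periodic s< injective x (subst (x <_) eq (s≤s (m≤m+n x m)))
  ...   | p , _ , e = ⊥-elim (<⇒≢ (h′ p) (sym e))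

-- Statistics of permutations as counts over ℕ

module _ {n : ℕ} where

  ∑∑-single : ∀ (p : ℕ → ℕ → Bool) a b → a < n → b < n →
    (∀ x y → x < n → y < n → p x y ≡ true → x ≡ a × y ≡ b) →
    ℕΣ.∑ n (λ x → # n (p x)) ≡ ind (p a b)
  ∑∑-single p a b a<n b<n h = trans
    (ℕΣ.∑-single n a (λ x → # n (p x)) a<n λ x x<n x≢a → #-none n λ y y<n → ≢true⇒false λ e → x≢a (proj₁ (h x y x<n y<n e)))
    (ℕΣ.∑-single n b (λ y → ind (p a y)) b<n λ y y<n y≢b → cong ind (≢true⇒false λ e → y≢b (proj₂ (h a y a<n y<n e))))

  module _ (p : ℕ → ℕ → ℕ → Bool) (a b : ℕ → ℕ) (a< : ∀ x → x < n → a x < n) (b< : ∀ x → x < n → b x < n) where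

    -- In a crossing or nesting one free index determines the other two through the permutation, so
    -- the triple count collapses to a single one. The three versions differ in the index that
    -- survives.
    count-by-first : (∀ x y z → x < n → y < n → z < n → p x y z ≡ true → y ≡ a x × z ≡ b x) →
      ℕΣ.∑ n (λ x → ℕΣ.∑ n (λ y → # n (p x y))) ≡ # n (λ x → p x (a x) (b x))
    count-by-first h = ℕΣ.∑-cong n λ x x<n →
      ∑∑-single (p x) (a x) (b x) (a< x x<n) (b< x x<n) λ y z y<n z<n → h x y z x<n y<n z<n

    count-by-second : (∀ x y z → x < n → y < n → z < n → p x y z ≡ true → x ≡ a y × z ≡ b y) →
      ℕΣ.∑ n (λ x → ℕΣ.∑ n (λ y → # n (p x y))) ≡ # n (λ y → p (a y) y (b y))
    count-by-second h = trans (ℕΣ.∑-swap n n (λ x y → # n (p x y))) (ℕΣ.∑-cong n λ y y<n →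
      ∑∑-single (λ x z → p x y z) (a y) (b y) (a< y y<n) (b< y y<n) λ x z x<n z<n → h x y z x<n y<n z<n)

    count-by-third : (∀ x y z → x < n → y < n → z < n → p x y z ≡ true → x ≡ a z × y ≡ b z) →
      ℕΣ.∑ n (λ x → ℕΣ.∑ n (λ y → # n (p x y))) ≡ # n (λ z → p (a z) (b z) z)
    count-by-third h = trans
      (ℕΣ.∑-cong n λ x _ → ℕΣ.∑-swap n n (λ y z → ind (p x y z)))
      (trans (ℕΣ.∑-swap n n (λ x z → # n (λ y → p x y z))) (ℕΣ.∑-cong n λ z z<n →
        ∑∑-single (λ x y → p x y z) (a z) (b z) (a< z z<n) (b< z z<n) λ x y x<n y<n → h x y z x<n y<n z<n))

module _ {X : Set} where

  allᵇ-true : ∀ (p : X → Bool) xs → allᵇ p xs ≡ true → ∀ {x} → x ∈ xs → p x ≡ true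
  allᵇ-true p (x ∷ xs) h (here refl) = ∧-true₁ h
  allᵇ-true p (x ∷ xs) h (there x∈)  = allᵇ-true p xs (∧-true₂ h) x∈

  true-allᵇ : ∀ (p : X → Bool) xs → (∀ x → p x ≡ true) → allᵇ p xs ≡ true
  true-allᵇ p []       h = refl
  true-allᵇ p (x ∷ xs) h = ∧-true (h x) (true-allᵇ p xs h)

toℕ-=F : ∀ {N} {i j : Fin N} → (i =F j) ≡ true → i ≡ j
toℕ-=F = Fin.toℕ-injective ∘ true-≡ᵇ

=F-refl : ∀ {N} {i j : Fin N} → i ≡ j → (i =F j) ≡ true
=F-refl = ≡ᵇ-true ∘ cong toℕ

private
  implies : ∀ {a b} → (a ≡ true → b ≡ true) → (not a ∨ b) ≡ true
  implies {true}  h = h refl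
  implies {false} h = refl

  implied : ∀ {a b} → (not a ∨ b) ≡ true → a ≡ true → b ≡ true
  implied {true} h _ = h

module _ {N : ℕ} (σ : Fin N → Fin N) where

  isPermᵇ-true : isPermᵇ σ ≡ true → ∀ i j → σ i ≡ σ j → i ≡ j
  isPermᵇ-true h i j e = toℕ-=F (implied
    (allᵇ-true (λ j → not (σ i =F σ j) ∨ (i =F j)) (allFin N) (allᵇ-true _ (allFin N) h (∈-allFin i)) (∈-allFin j))
    (=F-refl e))

  true-isPermᵇ : (∀ i j → σ i ≡ σ j → i ≡ j) → isPermᵇ σ ≡ true
  true-isPermᵇ h = true-allᵇ _ (allFin N) λ i → true-allᵇ _ (allFin N) λ j → implies λ e → =F-refl (h i j (toℕ-=F e))

  σ⁻¹-inverse : ∀ i → (∃ λ j → σ j ≡ i) → σ (σ⁻¹ σ i) ≡ i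
  σ⁻¹-inverse i (j , σj) = search (allFin N) (∈-allFin j)
    where
    search : ∀ xs → j ∈ xs → σ (foldr (λ j acc → if σ j =F i then j else acc) i xs) ≡ i
    search (x ∷ xs) j∈ with σ x =F i in e
    ... | true = toℕ-=F e
    search (x ∷ xs) (here refl) | false = ⊥-elim (true≢false (=F-refl σj) e)
    search (x ∷ xs) (there j∈)  | false = search xs j∈

  -- Extended by the identity beyond N, so that orbits live in ℕ together with the lists and `exit`.
  ext : ℕ → ℕ
  ext x with x <? N
  ... | yes x<N = toℕ (σ (fromℕ< x<N))
  ... | no  _   = x

  ext-toℕ : ∀ i → ext (toℕ i) ≡ toℕ (σ i)
  ext-toℕ i with toℕ i <? N
  ... | yes i<N = cong (toℕ ∘ σ) (Fin.fromℕ<-toℕ i i<N)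
  ... | no  i≮N = ⊥-elim (i≮N (Fin.toℕ<n i))

  iter-iterate : ∀ k i → toℕ (iter σ k i) ≡ iterate ext k (toℕ i)
  iter-iterate zero    i = refl
  iter-iterate (suc k) i = trans (sym (ext-toℕ (iter σ k i)))
    (trans (cong ext (iter-iterate k i)) (sym (iterate-suc ext k (toℕ i))))

∀-fin : ∀ {N} {P : ℕ → Set} → (∀ (i : Fin N) → P (toℕ i)) → ∀ x → x < N → P x
∀-fin {P = P} h x x<N = subst P (Fin.toℕ-fromℕ< x<N) (h (fromℕ< x<N))

hit-tabulate⇒ : ∀ {m} (f : Fin m → ℕ) {q} → hit (tabulate f) q ≡ true → ∃ λ i → f i ≡ q
hit-tabulate⇒ {suc m} f {q} e with ∨-split {f Fin.zero ≡ᵇ q} e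
... | inj₁ e′ = Fin.zero , true-≡ᵇ e′
... | inj₂ e′ = let (i , fi) = hit-tabulate⇒ (f ∘ Fin.suc) e′ in Fin.suc i , fi

⇒hit-tabulate : ∀ {m} (f : Fin m → ℕ) {q} i → f i ≡ q → hit (tabulate f) q ≡ true
⇒hit-tabulate f Fin.zero    e = ∨-true₁ (≡ᵇ-true e)
⇒hit-tabulate f (Fin.suc i) e = ∨-true₂ (⇒hit-tabulate (f ∘ Fin.suc) i e)

inj-tabulate⇒ : ∀ {m} (f : Fin m → ℕ) → inj (tabulate f) ≡ true → ∀ i j → f i ≡ f j → i ≡ j
inj-tabulate⇒ f h Fin.zero    Fin.zero    e = refl
inj-tabulate⇒ f h Fin.zero    (Fin.suc j) e = ⊥-elim (true≢false (⇒hit-tabulate (f ∘ Fin.suc) j (sym e)) (not-true (∧-true₁ h)))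
inj-tabulate⇒ f h (Fin.suc i) Fin.zero    e = ⊥-elim (true≢false (⇒hit-tabulate (f ∘ Fin.suc) i e) (not-true (∧-true₁ h)))
inj-tabulate⇒ f h (Fin.suc i) (Fin.suc j) e = cong Fin.suc (inj-tabulate⇒ (f ∘ Fin.suc) (∧-true₂ h) i j e)

⇒inj-tabulate : ∀ {m} (f : Fin m → ℕ) → (∀ i j → f i ≡ f j → i ≡ j) → inj (tabulate f) ≡ true
⇒inj-tabulate {zero}  f h = refl
⇒inj-tabulate {suc m} f h = ∧-true
  (not-false (≢true⇒false λ e → let (i , fi) = hit-tabulate⇒ (f ∘ Fin.suc) e in Fin.0≢1+n (h Fin.zero (Fin.suc i) (sym fi))))
  (⇒inj-tabulate (f ∘ Fin.suc) λ i j e → Fin.suc-injective (h (Fin.suc i) (Fin.suc j) e))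

inj-values : ∀ {N} (σ : Fin N → Fin N) → inj (values σ) ≡ isPermᵇ σ
inj-values σ = bool-ext
  (λ e → true-isPermᵇ σ λ i j σi≡σj → inj-tabulate⇒ (toℕ ∘ σ) e i j (cong toℕ σi≡σj))
  (λ e → ⇒inj-tabulate (toℕ ∘ σ) λ i j σi≡σj → isPermᵇ-true σ e i j (Fin.toℕ-injective σi≡σj))

values-ext : ∀ {N} (σ : Fin N → Fin N) → values σ ≡ segment (ext σ) 0 N
values-ext σ = tabulate-segment (ext σ) 0 (toℕ ∘ σ) (λ i → sym (ext-toℕ σ i))

record InverseFuns {N : ℕ} (σ τ : Fin N → Fin N) : Set where
  constructor _,_
  field
    τσ : ∀ i → τ (σ i) ≡ i
    στ : ∀ i → σ (τ i) ≡ i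

swap-inverse : ∀ {N} {σ τ : Fin N → Fin N} → InverseFuns σ τ → InverseFuns τ σ
swap-inverse (τσ , στ) = στ , τσ

-- `isPermᵇ` tests injectivity. Surjectivity follows by going around the orbit of i: its last point
-- before returning, `iter σ p i`, is a preimage, so the search in `σ⁻¹` succeeds.
isPermᵇ⇒σ⁻¹ : ∀ {N} (σ : Fin N → Fin N) → isPermᵇ σ ≡ true → InverseFuns σ (σ⁻¹ σ)
isPermᵇ⇒σ⁻¹ {N} σ h = (λ i → inject _ _ (right (σ i))) , right
  where
  inject = isPermᵇ-true σ h
  s< : ∀ x → x < N → ext σ x < N
  s< = ∀-fin λ i → subst (_< N) (sym (ext-toℕ σ i)) (Fin.toℕ<n (σ i))
  s-injective : ∀ x y → x < N → y < N → ext σ x ≡ ext σ y → x ≡ y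
  s-injective x y x<N y<N = ∀-fin {P = λ x → ext σ x ≡ ext σ y → x ≡ y}
    (λ i → ∀-fin {P = λ y → ext σ (toℕ i) ≡ ext σ y → toℕ i ≡ y}
      (λ j e → cong toℕ (inject i j (Fin.toℕ-injective (trans (sym (ext-toℕ σ i)) (trans e (ext-toℕ σ j)))))) y y<N) x x<N
  right : ∀ i → σ (σ⁻¹ σ i) ≡ i
  right i with periodic s< s-injective (toℕ i) (Fin.toℕ<n i)
  ... | p , _ , e = σ⁻¹-inverse σ i (iter σ p i , Fin.toℕ-injective (trans (iter-iterate σ (suc p) i) e))

module _ {N : ℕ} {σ τ : Fin N → Fin N} (inv : InverseFuns σ τ) where
  open InverseFuns inv

  inverse-isPermᵇ : isPermᵇ σ ≡ true
  inverse-isPermᵇ = true-isPermᵇ σ λ i j e → trans (sym (τσ i)) (trans (cong τ e) (τσ j))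

  σ⁻¹≡ : ∀ i → σ⁻¹ σ i ≡ τ i
  σ⁻¹≡ i = trans (sym (τσ _)) (cong τ (σ⁻¹-inverse σ i (τ i , στ i)))

  ext-inverses : Inverses N (ext σ) (ext τ)
  ext-inverses = record
    { s< = ∀-fin λ i → subst (_< N) (sym (ext-toℕ σ i)) (Fin.toℕ<n (σ i))
    ; t< = ∀-fin λ i → subst (_< N) (sym (ext-toℕ τ i)) (Fin.toℕ<n (τ i))
    ; ts = ∀-fin λ i → trans (cong (ext τ) (ext-toℕ σ i)) (trans (ext-toℕ τ (σ i)) (cong toℕ (τσ i)))
    ; st = ∀-fin λ i → trans (cong (ext σ) (ext-toℕ τ i)) (trans (ext-toℕ σ (τ i)) (cong toℕ (στ i)))
    }

  =F-inverse : ∀ i j → (i =F σ j) ≡ (j =F τ i)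
  =F-inverse i j = bool-ext
    (λ e → =F-refl (trans (sym (τσ j)) (cong τ (sym (toℕ-=F e)))))
    (λ e → =F-refl (trans (sym (στ i)) (cong σ (sym (toℕ-=F e)))))

-- The predicate inside `cyc`, named so that `cyc σ` is its count by computation.
isCycleMin : ∀ {N} → (Fin N → Fin N) → Fin N → Bool
isCycleMin {N} σ i = allᵇ (λ k → pos i ≤ᵇ pos (iter σ k i)) (upTo N)

private
  ≤ᵇ-suc-true : ∀ {m n} → m ≤ n → (suc m ≤ᵇ suc n) ≡ true
  ≤ᵇ-suc-true m≤n = <ᵇ-true (s≤s m≤n)

  true-≤ᵇ-suc : ∀ {m n} → (suc m ≤ᵇ suc n) ≡ true → m ≤ n
  true-≤ᵇ-suc e = ≤-pred (true-<ᵇ e)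

module _ {N : ℕ} {σ τ : Fin N → Fin N} (inv : InverseFuns σ τ) where
  open Inverses (ext-inverses inv)

  isCycleMin⇒stays : ∀ i → isCycleMin σ i ≡ true → Stays (ext σ) (toℕ i) (toℕ i)
  isCycleMin⇒stays i h = stays-bounded s< injective (toℕ i) (Fin.toℕ<n i) λ k k<N →
    subst (toℕ i ≤_) (iter-iterate σ k i) (true-≤ᵇ-suc (allᵇ-true _ (upTo N) h (∈-upTo⁺ k<N)))

  stays⇒isCycleMin : ∀ i → Stays (ext σ) (toℕ i) (toℕ i) → isCycleMin σ i ≡ true
  stays⇒isCycleMin i h = true-allᵇ _ (upTo N) λ k →
    ≤ᵇ-suc-true {toℕ i} (subst (toℕ i ≤_) (sym (iter-iterate σ k i)) (h k))

isCycleMin-inverse : ∀ {N} {σ τ : Fin N → Fin N} → InverseFuns σ τ → ∀ i → isCycleMin σ i ≡ isCycleMin τ i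
isCycleMin-inverse inv i = bool-ext (transfer inv) (transfer (swap-inverse inv))
  where
  transfer : ∀ {σ τ} → InverseFuns σ τ → isCycleMin σ i ≡ true → isCycleMin τ i ≡ true
  transfer inv e = stays⇒isCycleMin (swap-inverse inv) i
    (Inverses.stays-inverse (ext-inverses inv) (toℕ i) (Fin.toℕ<n i) (isCycleMin⇒stays inv i e))

countF-# : ∀ {N} (P : Fin N → Bool) (p : ℕ → Bool) → (∀ i → P i ≡ p (toℕ i)) → countF N P ≡ # N p
countF-# P p h = along id (λ i → h i)
  where
  along : ∀ {n p} (f : Fin n → Fin _) → (∀ i → P (f i) ≡ p (toℕ i)) → length (filterᵇ P (tabulate f)) ≡ # n p
  along {zero}      f h = refl
  along {suc n} {p} f h rewrite sym (h Fin.zero) with P (f Fin.zero)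
  ... | true  = cong suc (along (f ∘ Fin.suc) (h ∘ Fin.suc))
  ... | false = along (f ∘ Fin.suc) (h ∘ Fin.suc)

module _ {N : ℕ} (σ : Fin N → Fin N) where

  sumℕ-∑ : ∀ (φ : Fin N → ℕ) (f : ℕ → ℕ) → (∀ i → φ i ≡ f (toℕ i)) → sumℕ σ (map φ (allFin N)) ≡ ℕΣ.∑ N f
  sumℕ-∑ φ f h = along id h
    where
    along : ∀ {n f} (g : Fin n → Fin N) → (∀ i → φ (g i) ≡ f (toℕ i)) → sumℕ σ (map φ (tabulate g)) ≡ ℕΣ.∑ n f
    along {zero}  g h = refl
    along {suc n} g h = cong₂ _+_ (h Fin.zero) (along (g ∘ Fin.suc) (h ∘ Fin.suc))

  count3-∑ : ∀ (P : Fin N → Fin N → Fin N → Bool) (p : ℕ → ℕ → ℕ → Bool) → (∀ x y z → P x y z ≡ p (toℕ x) (toℕ y) (toℕ z)) →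
    count3 σ P ≡ ℕΣ.∑ N (λ x → ℕΣ.∑ N (λ y → # N (p x y)))
  count3-∑ P p h = sumℕ-∑ _ (λ x → ℕΣ.∑ N (λ y → # N (p x y))) λ x → sumℕ-∑ _ (λ y → # N (p (toℕ x) y)) λ y → countF-# (P x y) (p (toℕ x) (toℕ y)) (h x y)

  count3-cong : ∀ τ {P Q : Fin N → Fin N → Fin N → Bool} → (∀ x y z → P x y z ≡ Q x y z) → count3 σ P ≡ count3 τ Q
  count3-cong τ {P} {Q} h = sum-map (allFin N) λ x → sum-map (allFin N) λ y → filter-map (allFin N) (h x y)
    where
    sum-map : ∀ {φ ψ : Fin N → ℕ} xs → (∀ x → φ x ≡ ψ x) → sumℕ σ (map φ xs) ≡ sumℕ τ (map ψ xs)
    sum-map []       h = refl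
    sum-map (x ∷ xs) h = cong₂ _+_ (h x) (sum-map xs h)
    filter-map : ∀ {p q : Fin N → Bool} xs → (∀ x → p x ≡ q x) → length (filterᵇ p xs) ≡ length (filterᵇ q xs)
    filter-map []           h = refl
    filter-map {p} {q} (x ∷ xs) h rewrite h x with q x
    ... | true  = cong suc (filter-map xs h)
    ... | false = filter-map xs h

module _ {N : ℕ} {σ τ : Fin N → Fin N} (inv : InverseFuns σ τ) where

  private
    flip-both : ∀ (b : Bool) {c d c′ d′} → c ≡ c′ → d ≡ d′ → (b ∧ (c ∧ d)) ≡ (b ∧ (c′ ∧ d′))
    flip-both b refl refl = refl

    flip-swap : ∀ (b : Bool) {c d c′ d′} → c ≡ d′ → d ≡ c′ → (b ∧ (c ∧ d)) ≡ (b ∧ (c′ ∧ d′))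
    flip-swap b {c} {d} refl refl = cong (b ∧_) (∧-comm c d)

  -- Inversion reverses every arc: k = σ i becomes i = τ k. The four points keep their order, so
  -- upper crossings and nestings become lower ones and conversely.
  ucross′≡ : ∀ k → ucross′ σ k ≡ lcross τ k
  ucross′≡ k = count3-cong σ τ λ i j l → flip-both (lt4 σ i j k l) (=F-inverse inv k i) (=F-inverse inv l j)

  unest′≡ : ∀ k → unest′ σ k ≡ lnest τ k
  unest′≡ k = count3-cong σ τ λ i j l → flip-swap (lt4 σ i j k l) (=F-inverse inv k j) (=F-inverse inv l i)

  lcross′≡ : ∀ j → lcross′ σ j ≡ ucross τ j
  lcross′≡ j = count3-cong σ τ λ i k l → flip-both (lt4 σ i j k l) (=F-inverse inv i k) (=F-inverse inv j l)

  lnest′≡ : ∀ j → lnest′ σ j ≡ unest τ j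
  lnest′≡ j = count3-cong σ τ λ i k l → flip-swap (lt4 σ i j k l) (=F-inverse inv i l) (=F-inverse inv j k)

module _ {N : ℕ} {σ τ : Fin N → Fin N} (inv : InverseFuns σ τ) where
  private
    s t : ℕ → ℕ
    s = ext σ
    t = ext τ
  open Inverses (ext-inverses inv)

  private
    arcs : ∀ (b : Bool) (x y u v : Fin N) →
      (b ∧ ((x =F σ y) ∧ (u =F σ v))) ≡ (b ∧ ((toℕ x ≡ᵇ s (toℕ y)) ∧ (toℕ u ≡ᵇ s (toℕ v))))
    arcs b x y u v = cong₂ (λ c d → b ∧ ((toℕ x ≡ᵇ c) ∧ (toℕ u ≡ᵇ d))) (sym (ext-toℕ σ y)) (sym (ext-toℕ σ v))

    _<<_<<_<<_ : (i j k l : ℕ) → Bool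
    i << j << k << l = (i <ᵇ j) ∧ ((j <ᵇ k) ∧ (k <ᵇ l))

    arc : ∀ b x y u v → (b ∧ ((x ≡ᵇ y) ∧ (u ≡ᵇ v))) ≡ true → x ≡ y × u ≡ v
    arc b x y u v e = let e′ = ∧-true₂ {b} e in true-≡ᵇ (∧-true₁ e′) , true-≡ᵇ (∧-true₂ {x ≡ᵇ y} e′)

    back : ∀ {x y} → y < N → x ≡ s y → y ≡ t x
    back y<N refl = sym (ts _ y<N)

    both : ∀ b x y u v → x ≡ y → u ≡ v → (b ∧ ((x ≡ᵇ y) ∧ (u ≡ᵇ v))) ≡ b
    both b x _ u _ refl refl rewrite ≡ᵇ-refl x | ≡ᵇ-refl u = ∧-identityʳ b

    not-above : ∀ {x q} → q < N → q ≢ s x → (not (x <ᵇ t q)) ≡ (t q <ᵇ x)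
    not-above {x} {q} q<N q≢sx with <-cmp (t q) x
    ... | tri< tq<x _ _ rewrite <ᵇ-true tq<x | <ᵇ-false (<⇒≤ tq<x) = refl
    ... | tri≈ _ tq≡x _ = ⊥-elim (q≢sx (trans (sym (st q q<N)) (cong s tq≡x)))
    ... | tri> _ _ x<tq rewrite <ᵇ-true x<tq | <ᵇ-false (<⇒≤ x<tq) = refl

  module _ (i : Fin N) (m : ℕ) (eq : suc (toℕ i) + m ≡ N) where
    private
      x = toℕ i
      g = segment s (suc x) m
      si<N = s< x (Fin.toℕ<n i)

    lcr≡ : lcr N x (s x) g ≡ lcross σ i
    lcr≡ = sym (trans
      (count3-∑ σ _ (λ u q v → (u << q << x << v) ∧ ((u ≡ᵇ s x) ∧ (q ≡ᵇ s v)))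
        (λ u q v → arcs (lt4 σ u q i v) u i q v))
      (trans (count-by-second _ (λ _ → s x) t (λ _ _ → si<N) t<
               (λ u q v u<N q<N v<N e → let (e₁ , e₂) = arc (u << q << x << v) u (s x) q (s v) e in e₁ , back v<N e₂))
             (#-cong N λ q q<N → trans (both (s x << q << x << t q) (s x) (s x) q (s (t q)) refl (sym (st q q<N)))
               (trans (sym (∧-assoc (s x <ᵇ q) (q <ᵇ x) (x <ᵇ t q)))
                      (cong (((s x <ᵇ q) ∧ (q <ᵇ x)) ∧_) (sym (hit-segment x m q eq q<N)))))))

    -- The list counts of nestings do not compare x with `s x`, so the direction of the arc is
    -- assumed here and in `une≡`. For crossings it is implied by q lying between the two.
    lne≡ : s x < x → lne N x (s x) g ≡ lnest σ i
    lne≡ sx<x = sym (trans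
      (count3-∑ σ _ (λ q u v → (q << u << x << v) ∧ ((q ≡ᵇ s v) ∧ (u ≡ᵇ s x)))
        (λ q u v → arcs (lt4 σ q u i v) q v u i))
      (trans (count-by-first _ (λ _ → s x) t (λ _ _ → si<N) t<
               (λ q u v q<N u<N v<N e → let (e₁ , e₂) = arc (q << u << x << v) q (s v) u (s x) e in e₂ , back v<N e₁))
             (#-cong N λ q q<N → trans (both (q << s x << x << t q) q (s (t q)) (s x) (s x) (sym (st q q<N)) refl)
               (trans (cong (λ b → (q <ᵇ s x) ∧ (b ∧ (x <ᵇ t q))) (<ᵇ-true sx<x))
                      (cong ((q <ᵇ s x) ∧_) (sym (hit-segment x m q eq q<N)))))))

    ucr≡ : ucr N x (s x) g ≡ ucross σ i
    ucr≡ = sym (trans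
      (count3-∑ σ _ (λ u q v → (u << x << q << v) ∧ ((q ≡ᵇ s u) ∧ (v ≡ᵇ s x)))
        (λ u q v → arcs (lt4 σ u i q v) q u v i))
      (trans (count-by-second _ t (λ _ → s x) t< (λ _ _ → si<N)
               (λ u q v u<N q<N v<N e → let (e₁ , e₂) = arc (u << x << q << v) q (s u) v (s x) e in back u<N e₁ , e₂))
             (#-cong N λ q q<N → trans (both (t q << x << q << s x) q (s (t q)) (s x) (s x) (sym (st q q<N)) refl)
               (trans (rotate q q<N) (cong (λ b → (x <ᵇ q) ∧ ((q <ᵇ s x) ∧ not b)) (sym (hit-segment x m q eq q<N)))))))
      where
      rotate : ∀ q → q < N → (t q << x << q << s x) ≡ (x <ᵇ q) ∧ ((q <ᵇ s x) ∧ not (x <ᵇ t q))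
      rotate q q<N with <-≤-connex q (s x)
      ... | inj₁ q<sx rewrite not-above {x} q<N (<⇒≢ q<sx) =
        trans (∧-comm (t q <ᵇ x) _) (∧-assoc (x <ᵇ q) (q <ᵇ s x) (t q <ᵇ x))
      ... | inj₂ sx≤q rewrite <ᵇ-false sx≤q | ∧-zeroʳ (x <ᵇ q) = ∧-zeroʳ _

    une≡ : x < s x → une N x (s x) g ≡ unest σ i
    une≡ x<sx = sym (trans
      (count3-∑ σ _ (λ u v q → (u << x << v << q) ∧ ((v ≡ᵇ s x) ∧ (q ≡ᵇ s u)))
        (λ u v q → arcs (lt4 σ u i v q) v i q u))
      (trans (count-by-third _ t (λ _ → s x) t< (λ _ _ → si<N)
               (λ u v q u<N v<N q<N e → let (e₁ , e₂) = arc (u << x << v << q) v (s x) q (s u) e in back u<N e₂ , e₁))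
             (#-cong N λ q q<N → trans (both (t q << x << s x << q) (s x) (s x) q (s (t q)) refl (sym (st q q<N)))
               (trans (rotate q q<N) (cong (λ b → (x <ᵇ q) ∧ ((s x <ᵇ q) ∧ not b)) (sym (hit-segment x m q eq q<N)))))))
      where
      rotate : ∀ q → q < N → (t q << x << s x << q) ≡ (x <ᵇ q) ∧ ((s x <ᵇ q) ∧ not (x <ᵇ t q))
      rotate q q<N with <-≤-connex (s x) q
      ... | inj₂ q≤sx rewrite <ᵇ-false q≤sx | ∧-zeroʳ (x <ᵇ s x) | ∧-zeroʳ (t q <ᵇ x) = sym (∧-zeroʳ _)
      ... | inj₁ sx<q rewrite not-above {x} q<N (<⇒≢ sx<q ∘ sym) | <ᵇ-true x<sx | <ᵇ-true sx<q | <ᵇ-true (<-trans x<sx sx<q) = ∧-identityʳ _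

    -- The list records points below x whose preimage is above x, which is the statistic of the
    -- inverse; at fixed points `psnest-inverse` restores the original one.
    psn≡ : psn N x g ≡ psnest τ i
    psn≡ = sym (countF-# _ (λ q → (q <ᵇ x) ∧ hit g q) λ j → cong ((toℕ j <ᵇ x) ∧_)
      (trans (cong (x <ᵇ_) (sym (ext-toℕ τ j))) (sym (hit-segment x m (toℕ j) eq (Fin.toℕ<n j)))))

  -- At a fixed point x, as many points cross x upwards under σ as under its inverse:
  -- both complement, in {q < x} and in σ⁻¹{q < x}, the points that σ keeps below x.
  psnest-inverse : ∀ i → σ i ≡ i → psnest τ i ≡ psnest σ i
  psnest-inverse i σi≡i = trans (countF-# _ (λ q → (q <ᵇ x) ∧ (x <ᵇ t q)) (λ j → cong (λ y → (toℕ j <ᵇ x) ∧ (x <ᵇ y)) (sym (ext-toℕ τ j))))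
    (trans (+-cancelˡ-≡ below _ _ balance)
      (sym (countF-# _ (λ q → (q <ᵇ x) ∧ (x <ᵇ s q)) (λ j → cong (λ y → (toℕ j <ᵇ x) ∧ (x <ᵇ y)) (sym (ext-toℕ σ j))))))
    where
    open ≡-Reasoning
    x = toℕ i
    x<N = Fin.toℕ<n i
    sx≡x : s x ≡ x
    sx≡x = trans (ext-toℕ σ i) (cong toℕ σi≡i)
    below = # N (λ q → (q <ᵇ x) ∧ (s q <ᵇ x))
    avoid : ∀ q → q < N → s q ≡ x → q ≡ x
    avoid q q<N e = injective q x q<N x<N (trans e (sym sx≡x))
    split-domain : ∀ q → q < N → ind (q <ᵇ x) ≡ ind ((q <ᵇ x) ∧ (s q <ᵇ x)) + ind ((q <ᵇ x) ∧ (x <ᵇ s q))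
    split-domain q q<N with <-≤-connex q x
    ... | inj₂ x≤q rewrite <ᵇ-false x≤q = refl
    ... | inj₁ q<x rewrite <ᵇ-true q<x with <-cmp (s q) x
    ...   | tri< sq<x _ _ rewrite <ᵇ-true sq<x | <ᵇ-false (<⇒≤ sq<x) = refl
    ...   | tri≈ _ sq≡x _ = ⊥-elim (<⇒≢ q<x (avoid q q<N sq≡x))
    ...   | tri> _ _ x<sq rewrite <ᵇ-true x<sq | <ᵇ-false (<⇒≤ x<sq) = refl
    split-image : ∀ q → q < N → ind (s q <ᵇ x) ≡ ind ((q <ᵇ x) ∧ (s q <ᵇ x)) + ind ((s q <ᵇ x) ∧ (x <ᵇ t (s q)))
    split-image q q<N rewrite ts q q<N with <-≤-connex (s q) x
    ... | inj₂ x≤sq rewrite <ᵇ-false x≤sq | ∧-zeroʳ (q <ᵇ x) = refl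
    ... | inj₁ sq<x rewrite <ᵇ-true sq<x with <-cmp q x
    ...   | tri< q<x _ _ rewrite <ᵇ-true q<x | <ᵇ-false (<⇒≤ q<x) = refl
    ...   | tri≈ _ q≡x _ = ⊥-elim (<⇒≢ sq<x (trans (cong s q≡x) sx≡x))
    ...   | tri> _ _ x<q rewrite <ᵇ-true x<q | <ᵇ-false (<⇒≤ x<q) = refl
    reindex : ∀ p → # N (p ∘ s) ≡ # N p
    reindex p = ℕΣ.∑-reindex N s t (ind ∘ p) t< s< ts st
    balance : below + # N (λ q → (q <ᵇ x) ∧ (x <ᵇ t q)) ≡ below + # N (λ q → (q <ᵇ x) ∧ (x <ᵇ s q))
    balance = begin
      below + # N (λ q → (q <ᵇ x) ∧ (x <ᵇ t q))
        ≡⟨ cong (below +_) (reindex (λ q → (q <ᵇ x) ∧ (x <ᵇ t q))) ⟨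
      below + # N (λ q → (s q <ᵇ x) ∧ (x <ᵇ t (s q)))
        ≡⟨ ℕΣ.∑-+ N (λ q → ind ((q <ᵇ x) ∧ (s q <ᵇ x))) (λ q → ind ((s q <ᵇ x) ∧ (x <ᵇ t (s q)))) ⟨
      ℕΣ.∑ N (λ q → ind ((q <ᵇ x) ∧ (s q <ᵇ x)) + ind ((s q <ᵇ x) ∧ (x <ᵇ t (s q))))
        ≡⟨ ℕΣ.∑-cong N (λ q q<N → sym (split-image q q<N)) ⟩
      # N (λ q → s q <ᵇ x)
        ≡⟨ reindex (_<ᵇ x) ⟩
      # N (_<ᵇ x)
        ≡⟨ ℕΣ.∑-cong N split-domain ⟩
      ℕΣ.∑ N (λ q → ind ((q <ᵇ x) ∧ (s q <ᵇ x)) + ind ((q <ᵇ x) ∧ (x <ᵇ s q)))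
        ≡⟨ ℕΣ.∑-+ N (λ q → ind ((q <ᵇ x) ∧ (s q <ᵇ x))) (λ q → ind ((q <ᵇ x) ∧ (x <ᵇ s q))) ⟩
      below + # N (λ q → (q <ᵇ x) ∧ (x <ᵇ s q)) ∎

-- Comparison with the statistics of D-permutations

isEvenᵇ-+ : ∀ a m → isEvenᵇ (a + m) ≡ (if isEvenᵇ a then isEvenᵇ m else not (isEvenᵇ m))
isEvenᵇ-+ zero    m = refl
isEvenᵇ-+ (suc a) m rewrite isEvenᵇ-+ a m with isEvenᵇ a | isEvenᵇ m
... | true  | _     = refl
... | false | true  = refl
... | false | false = refl

isEvenᵇ-complement : ∀ n a m → a + m ≡ 2 * n → isEvenᵇ m ≡ isEvenᵇ a
isEvenᵇ-complement n a m e = decide (isEvenᵇ a) (trans (sym (isEvenᵇ-+ a m)) (trans (cong isEvenᵇ e) (isEvenᵇ-2* n)))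
  where
  decide : ∀ b {c} → (if b then c else not c) ≡ true → c ≡ b
  decide true  h = h
  decide false h = not-true h

module Products {ℓ₁ ℓ₂ : Level} (R : CommutativeRing ℓ₁ ℓ₂) where
  open RingSums R
  open Defs.Ring R using (prodR; _^R_)

  Πₗ : ∀ {a} {X : Set a} → List X → (X → Carrier) → Carrier
  Πₗ xs φ = prodR (map φ xs)

  module _ {X : Set} where

    Πₗ-cong : ∀ (xs : List X) {φ ψ} → (∀ x → φ x ≈ ψ x) → Πₗ xs φ ≈ Πₗ xs ψ
    Πₗ-cong []       h = ≈-refl
    Πₗ-cong (x ∷ xs) h = ⊛-cong (h x) (Πₗ-cong xs h)

    ⊛-swap : ∀ a b c d → (a ⊛ b) ⊛ (c ⊛ d) ≈ (a ⊛ c) ⊛ (b ⊛ d)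
    ⊛-swap a b c d = begin
      (a ⊛ b) ⊛ (c ⊛ d)  ≈⟨ ⊛-assoc a b _ ⟩
      a ⊛ (b ⊛ (c ⊛ d))  ≈⟨ ⊛-congˡ (⊛-assoc b c d) ⟨
      a ⊛ ((b ⊛ c) ⊛ d)  ≈⟨ ⊛-congˡ (⊛-congʳ (⊛-comm b c)) ⟩
      a ⊛ ((c ⊛ b) ⊛ d)  ≈⟨ ⊛-congˡ (⊛-assoc c b d) ⟩
      a ⊛ (c ⊛ (b ⊛ d))  ≈⟨ ⊛-assoc a c _ ⟨
      (a ⊛ c) ⊛ (b ⊛ d)  ∎
      where open SetoidReasoning setoid

    Πₗ-⊛ : ∀ (xs : List X) φ ψ → Πₗ xs φ ⊛ Πₗ xs ψ ≈ Πₗ xs (λ x → φ x ⊛ ψ x)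
    Πₗ-⊛ []       φ ψ = ⊛-identityˡ _
    Πₗ-⊛ (x ∷ xs) φ ψ = ≈-trans (⊛-swap _ _ _ _) (⊛-congˡ (Πₗ-⊛ xs φ ψ))

    -- Distributes a condition imposed on all elements over the factors; the D-condition is absorbed
    -- into local weights this way.
    Πₗ-allᵇ : ∀ (p : X → Bool) xs φ → allᵇ p xs · Πₗ xs φ ≈ Πₗ xs (λ x → p x · φ x)
    Πₗ-allᵇ p []       φ = ≈-refl
    Πₗ-allᵇ p (x ∷ xs) φ with p x
    ... | true  = ≈-trans (·-⊛ (allᵇ p xs) (φ x) _) (⊛-congˡ (Πₗ-allᵇ p xs φ))
    ... | false = ≈-sym (⊛-zeroˡ _)

    ^R-length-filter : ∀ x (p : X → Bool) xs → x ^R length (filterᵇ p xs) ≈ Πₗ xs (λ i → if p i then x else 1#)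
    ^R-length-filter x p []       = ≈-refl
    ^R-length-filter x p (i ∷ xs) with p i
    ... | true  = ⊛-congˡ (^R-length-filter x p xs)
    ... | false = ≈-trans (^R-length-filter x p xs) (≈-sym (⊛-identityˡ _))

module LocalWeights {ℓ₁ ℓ₂ : Level} (R : CommutativeRing ℓ₁ ℓ₂)
  (lam : CommutativeRing.Carrier R)
  (A : ℕ → ℕ → CommutativeRing.Carrier R)
  (B C D : ℕ → ℕ → ℕ → CommutativeRing.Carrier R)
  (F : ℕ → ℕ → CommutativeRing.Carrier R) where
  open RingSums R
  open StateSums R lam A B C D F using (loc; W; closing)
  open Products R

  W-segment : ∀ {X : Set} (s : ℕ → ℕ) m k (h : Fin m → X) (φ : X → Carrier) →
    (∀ i r → suc (toℕ i) + r ≡ m → loc (k + toℕ i) (s (k + toℕ i)) (segment s (suc (k + toℕ i)) r) ≈ φ (h i)) →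
    W k (segment s k m) ≈ Πₗ (tabulate h) φ
  W-segment s zero    k h φ e = ≈-refl
  W-segment s (suc m) k h φ e = ⊛-cong
    (subst (λ k′ → loc k′ (s k′) (segment s (suc k′) m) ≈ φ (h Fin.zero)) (+-identityʳ k) (e Fin.zero m refl))
    (W-segment s m (suc k) (h ∘ Fin.suc) φ λ i r eq →
      subst (λ k′ → loc k′ (s k′) (segment s (suc k′) r) ≈ φ (h (Fin.suc i))) (+-suc k (toℕ i)) (e (Fin.suc i) r (cong suc eq)))

  private
    by-type : (m n k v : ℕ) → List ℕ → (low high return : Bool) → Carrier
    by-type m n k v g low high return =
      if low
      then (if return then C m (lcr n k v g) (lne n k v g) else B m (lcr n k v g) (lne n k v g))
      else if high
      then (if return then closing (exit (suc k) g v ≡ᵇ k) ⊛ A m (ucr n k v g + une n k v g)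
                      else D m (ucr n k v g) (une n k v g))
      else F m (psn n k g)

    loc-by-type : ∀ {m n} k v g {low high return} → length g ≡ m → suc k + m ≡ n →
      (v <ᵇ k) ≡ low → (k <ᵇ v) ≡ high → hit g k ≡ return → loc k v g ≡ by-type m n k v g low high return
    loc-by-type k v g refl refl refl refl refl = refl

  module _ {N : ℕ} {σ τ : Fin N → Fin N} (inv : InverseFuns σ τ) (i : Fin N) (m : ℕ) (eq : suc (toℕ i) + m ≡ N) where
    open Inverses (ext-inverses inv)
    private
      s t : ℕ → ℕ
      s = ext σ
      t = ext τ
      x = toℕ i
      g = segment s (suc x) m

      reduce : ∀ {low high return} → (s x <ᵇ x) ≡ low → (x <ᵇ s x) ≡ high → (x <ᵇ t x) ≡ return →
        loc x (s x) g ≡ by-type m N x (s x) g low high return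
      reduce lo hi re = loc-by-type x (s x) g (length-segment s (suc x) m) eq lo hi
        (trans (hit-segment x m x eq (Fin.toℕ<n i)) re)

    loc-fixed : s x ≡ x → loc x (s x) g ≡ F m (psnest τ i)
    loc-fixed sx≡x = trans
      (reduce (<ᵇ-false (≤-reflexive (sym sx≡x))) (<ᵇ-false (≤-reflexive sx≡x)) refl)
      (cong (F m) (psn≡ inv i m eq))

    loc-peak : s x < x → t x < x → loc x (s x) g ≡ B m (lcross σ i) (lnest σ i)
    loc-peak sx<x tx<x = trans (reduce (<ᵇ-true sx<x) refl (<ᵇ-false (<⇒≤ tx<x)))
      (cong₂ (B m) (lcr≡ inv i m eq) (lne≡ inv i m eq sx<x))

    loc-fall : s x < x → x < t x → loc x (s x) g ≡ C m (lcross σ i) (lnest σ i)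
    loc-fall sx<x x<tx = trans (reduce (<ᵇ-true sx<x) refl (<ᵇ-true x<tx))
      (cong₂ (C m) (lcr≡ inv i m eq) (lne≡ inv i m eq sx<x))

    loc-rise : x < s x → t x < x → loc x (s x) g ≡ D m (ucross σ i) (unest σ i)
    loc-rise x<sx tx<x = trans (reduce (<ᵇ-false (<⇒≤ x<sx)) (<ᵇ-true x<sx) (<ᵇ-false (<⇒≤ tx<x)))
      (cong₂ (D m) (ucr≡ inv i m eq) (une≡ inv i m eq x<sx))

    loc-val : x < s x → x < t x →
      loc x (s x) g ≡ closing (isCycleMin σ i) ⊛ A m (ucross σ i + unest σ i)
    loc-val x<sx x<tx = trans (reduce (<ᵇ-false (<⇒≤ x<sx)) (<ᵇ-true x<sx) (<ᵇ-true x<tx))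
      (cong₂ (λ b l → closing b ⊛ A m l)
        (bool-ext (λ e → stays⇒isCycleMin inv i (exit⇒stays x m eq (true-≡ᵇ e)))
                  (λ e → ≡ᵇ-true (stays⇒exit x m eq (isCycleMin⇒stays inv i e))))
        (cong₂ _+_ (ucr≡ inv i m eq) (une≡ inv i m eq x<sx)))

cycleMin-below : ∀ {N} {σ τ : Fin N → Fin N} (inv : InverseFuns σ τ) i → ext σ (toℕ i) < toℕ i → isCycleMin σ i ≡ false
cycleMin-below inv i sx<x = ≢true⇒false λ e → <⇒≱ sx<x (isCycleMin⇒stays inv i e 1)

cycleMin-fixed : ∀ {N} {σ τ : Fin N → Fin N} (inv : InverseFuns σ τ) i → ext σ (toℕ i) ≡ toℕ i → isCycleMin σ i ≡ true
cycleMin-fixed {σ = σ} inv i sx≡x = stays⇒isCycleMin inv i λ k → ≤-reflexive (sym (constant k))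
  where
  constant : ∀ k → iterate (ext σ) k (toℕ i) ≡ toℕ i
  constant zero    = refl
  constant (suc k) = trans (cong (iterate (ext σ) k) sx≡x) (constant k)

module Factors {ℓ₁ ℓ₂ : Level} (R : CommutativeRing ℓ₁ ℓ₂) (lam : CommutativeRing.Carrier R) where
  open RingSums R
  open Defs.Ring R using (prodOver; _^R_)
  open Products R
  open SetoidReasoning setoid

  infix 9 _or1
  _or1 : Bool → Carrier → Carrier
  (b or1) x = if b then x else 1#

  -- The contribution of an element X with image S and preimage T, given the
  -- weights it would have as a valley, peak, double fall, double rise, even and odd fixed point.
  factor : (minimal : Bool) (X S T : ℕ) (ev : Bool) (xv xp xf xr xe xo : Carrier) → Carrier
  factor mn X S T ev xv xp xf xr xe xo =
    (if ev then S <ᵇ suc X else (X <ᵇ suc S)) ·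
    (((((((mn or1) lam
      ⊛ (((X <ᵇ T) ∧ (X <ᵇ S)) or1) xv)
      ⊛ (((T <ᵇ X) ∧ (S <ᵇ X)) or1) xp)
      ⊛ (((X <ᵇ T) ∧ (S <ᵇ X)) or1) xf)
      ⊛ (((T <ᵇ X) ∧ (X <ᵇ S)) or1) xr)
      ⊛ (((S ≡ᵇ X) ∧ ev) or1) xe)
      ⊛ (((S ≡ᵇ X) ∧ not ev) or1) xo)

  private
    1ʳ : ∀ {x y} → x ≈ y → x ⊛ 1# ≈ y
    1ʳ h = ≈-trans (⊛-identityʳ _) h

    at-1 : ∀ {x y} → x ≈ 1# → x ⊛ y ≈ y
    at-1 h = ≈-trans (⊛-congʳ h) (⊛-identityˡ _)

  module _ {X S T : ℕ} (xv xp xf xr xe xo : Carrier) where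

    factor-val : ∀ ev mn → X < S → X < T →
      factor mn X S T ev xv xp xf xr xe xo ≈ (mn or1) lam ⊛ (if ev then 0# else xv)
    factor-val ev mn X<S X<T
      rewrite <ᵇ-true X<S | <ᵇ-true X<T | <ᵇ-false (<⇒≤ X<S) | <ᵇ-false (<⇒≤ X<T)
            | ≡ᵇ-false (<⇒≢ X<S ∘ sym) | <ᵇ-true (m<n⇒m<1+n X<S) | <ᵇ-false {S} {suc X} X<S with ev
    ... | true  = ≈-sym (⊛-zeroʳ _)
    ... | false = 1ʳ (1ʳ (1ʳ (1ʳ (1ʳ ≈-refl))))

    factor-peak : ∀ ev → S < X → T < X → factor false X S T ev xv xp xf xr xe xo ≈ (if ev then xp else 0#)
    factor-peak ev S<X T<X
      rewrite <ᵇ-true S<X | <ᵇ-true T<X | <ᵇ-false (<⇒≤ S<X) | <ᵇ-false (<⇒≤ T<X)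
            | ≡ᵇ-false (<⇒≢ S<X) | <ᵇ-true (m<n⇒m<1+n S<X) | <ᵇ-false {X} {suc S} S<X with ev
    ... | false = ≈-refl
    ... | true  = 1ʳ (1ʳ (1ʳ (1ʳ (at-1 (1ʳ ≈-refl)))))

    factor-fall : ∀ ev → S < X → X < T → factor false X S T ev xv xp xf xr xe xo ≈ (if ev then xf else 0#)
    factor-fall ev S<X X<T
      rewrite <ᵇ-true S<X | <ᵇ-true X<T | <ᵇ-false (<⇒≤ S<X) | <ᵇ-false (<⇒≤ X<T)
            | ≡ᵇ-false (<⇒≢ S<X) | <ᵇ-true (m<n⇒m<1+n S<X) | <ᵇ-false {X} {suc S} S<X with ev
    ... | false = ≈-refl
    ... | true  = 1ʳ (1ʳ (1ʳ (at-1 (1ʳ (1ʳ ≈-refl)))))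

    factor-rise : ∀ ev → X < S → T < X → factor false X S T ev xv xp xf xr xe xo ≈ (if ev then 0# else xr)
    factor-rise ev X<S T<X
      rewrite <ᵇ-true X<S | <ᵇ-true T<X | <ᵇ-false (<⇒≤ X<S) | <ᵇ-false (<⇒≤ T<X)
            | ≡ᵇ-false (<⇒≢ X<S ∘ sym) | <ᵇ-true (m<n⇒m<1+n X<S) | <ᵇ-false {S} {suc X} X<S with ev
    ... | true  = ≈-refl
    ... | false = 1ʳ (1ʳ (at-1 (1ʳ (1ʳ (1ʳ ≈-refl)))))

    factor-fixed : ∀ ev → S ≡ X → T ≡ X → factor true X S T ev xv xp xf xr xe xo ≈ lam ⊛ (if ev then xe else xo)
    factor-fixed ev refl refl
      rewrite <ᵇ-false (≤-refl {X}) | ≡ᵇ-refl X | <ᵇ-true (n<1+n X) with ev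
    ... | true  = 1ʳ (⊛-congʳ (1ʳ (1ʳ (1ʳ (1ʳ ≈-refl)))))
    ... | false = ⊛-congʳ (1ʳ (1ʳ (1ʳ (1ʳ (1ʳ ≈-refl)))))

  -- The power of `lam` is a product over cycle minima, so it, the six products and the D-condition
  -- all run over the same elements and merge into one product of local factors.
  weight-factors : ∀ {N} {σ τ : Fin N → Fin N} → InverseFuns σ τ → (xv xp xf xr xe xo : Fin N → Carrier) →
    isDᵇ σ · (((((((lam ^R cyc σ
      ⊛ prodOver N (isCval σ) xv)
      ⊛ prodOver N (isCpeak σ) xp)
      ⊛ prodOver N (isCdfall σ) xf)
      ⊛ prodOver N (isCdrise σ) xr)
      ⊛ prodOver N (isEvenfix σ) xe)
      ⊛ prodOver N (isOddfix σ) xo))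
    ≈ Πₗ (allFin N) (λ i → factor (isCycleMin σ i) (toℕ i) (ext σ (toℕ i)) (ext τ (toℕ i)) (isEvenᵇ (pos i))
                             (xv i) (xp i) (xf i) (xr i) (xe i) (xo i))
  weight-factors {N} {σ} {τ} inv xv xp xf xr xe xo = begin
    isDᵇ σ · (((((((lam ^R cyc σ
      ⊛ prodOver N (isCval σ) xv)
      ⊛ prodOver N (isCpeak σ) xp)
      ⊛ prodOver N (isCdfall σ) xf)
      ⊛ prodOver N (isCdrise σ) xr)
      ⊛ prodOver N (isEvenfix σ) xe)
      ⊛ prodOver N (isOddfix σ) xo))
      ≈⟨ ·-cong {isDᵇ σ} refl (λ _ → merge (merge (merge (merge (merge (merge (^R-length-filter lam (isCycleMin σ) (allFin N))))))))  ⟩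
    isDᵇ σ · Πₗ (allFin N) inner
      ≈⟨ Πₗ-allᵇ Dᵇ (allFin N) inner ⟩
    Πₗ (allFin N) (λ i → Dᵇ i · inner i)
      ≈⟨ Πₗ-cong (allFin N) (λ i → ≈-reflexive (same i)) ⟩
    Πₗ (allFin N) (λ i → factor (isCycleMin σ i) (toℕ i) (ext σ (toℕ i)) (ext τ (toℕ i)) (isEvenᵇ (pos i))
                             (xv i) (xp i) (xf i) (xr i) (xe i) (xo i)) ∎
    where
    merge : ∀ {x φ ψ} → x ≈ Πₗ (allFin N) φ → x ⊛ Πₗ (allFin N) ψ ≈ Πₗ (allFin N) (λ i → φ i ⊛ ψ i)
    merge {φ = φ} {ψ} h = ≈-trans (⊛-congʳ h) (Πₗ-⊛ (allFin N) φ ψ)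
    Dᵇ : Fin N → Bool
    Dᵇ i = if isEvenᵇ (pos i) then pos (σ i) ≤ᵇ pos i else (pos i ≤ᵇ pos (σ i))
    inner : Fin N → Carrier
    inner i = (((((((isCycleMin σ i or1) lam
      ⊛ (isCval σ i or1) (xv i))
      ⊛ (isCpeak σ i or1) (xp i))
      ⊛ (isCdfall σ i or1) (xf i))
      ⊛ (isCdrise σ i or1) (xr i))
      ⊛ (isEvenfix σ i or1) (xe i))
      ⊛ (isOddfix σ i or1) (xo i))
    same : ∀ i → Dᵇ i · inner i ≡ factor (isCycleMin σ i) (toℕ i) (ext σ (toℕ i)) (ext τ (toℕ i)) (isEvenᵇ (pos i))
                                         (xv i) (xp i) (xf i) (xr i) (xe i) (xo i)
    -- `pos` adds one to both sides, so each `≤ᵇ` of the D-condition computes to the `<ᵇ` against a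
    -- successor in `factor`.
    same i = cong₂ (λ S T → factor (isCycleMin σ i) (toℕ i) S T (isEvenᵇ (pos i)) (xv i) (xp i) (xf i) (xr i) (xe i) (xo i))
      (sym (ext-toℕ σ i)) (trans (cong toℕ (σ⁻¹≡ inv i)) (sym (ext-toℕ τ i)))

-- Summation over inverse permutations

inverseᵇ : ∀ {N} → (Fin N → Fin N) → (Fin N → Fin N) → Bool
inverseᵇ {N} σ τ = allᵇ (λ i → (τ (σ i) =F i) ∧ (σ (τ i) =F i)) (allFin N)

inverseᵇ-true : ∀ {N} (σ τ : Fin N → Fin N) → inverseᵇ σ τ ≡ true → InverseFuns σ τ
inverseᵇ-true {N} σ τ h = (λ i → toℕ-=F (∧-true₁ (at i))) , (λ i → toℕ-=F (∧-true₂ {τ (σ i) =F i} (at i)))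
  where
  at : ∀ i → (τ (σ i) =F i) ∧ (σ (τ i) =F i) ≡ true
  at i = allᵇ-true _ (allFin N) h (∈-allFin i)

true-inverseᵇ : ∀ {N} {σ τ : Fin N → Fin N} → InverseFuns σ τ → inverseᵇ σ τ ≡ true
true-inverseᵇ {N} (τσ , στ) = true-allᵇ _ (allFin N) λ i → ∧-true (=F-refl (τσ i)) (=F-refl (στ i))

inverse-unique : ∀ {N} {σ τ τ′ : Fin N → Fin N} → InverseFuns σ τ → InverseFuns σ τ′ → ∀ i → τ i ≡ τ′ i
inverse-unique {τ = τ} {τ′} (τσ , _) (_ , στ′) i = trans (cong τ (sym (στ′ i))) (τσ (τ′ i))

inverse-≗ : ∀ {N} {σ τ τ′ : Fin N → Fin N} → InverseFuns σ τ → (∀ i → τ′ i ≡ τ i) → InverseFuns σ τ′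
inverse-≗ {σ = σ} (τσ , στ) h = (λ i → trans (h (σ i)) (τσ i)) , (λ i → trans (cong σ (h i)) (στ i))

module InverseSums {ℓ₁ ℓ₂ : Level} (R : CommutativeRing ℓ₁ ℓ₂) (N : ℕ) where
  open RingSums R
  open FunctionSums R
  open SetoidReasoning setoid

  private
    inverses-sum : ∀ (σ : Fin N → Fin N) x → Σₗ (allFuns N N) (λ τ → inverseᵇ σ τ · x) ≈ isPermᵇ σ · x
    inverses-sum σ x with isPermᵇ σ in p
    ... | false = Σₗ-zero (allFuns N N) λ τ → ≈-reflexive (cong (_· x)
                    (≢true⇒false λ e → true≢false (inverse-isPermᵇ (inverseᵇ-true σ τ e)) p))
    ... | true  = Σₗ-allFuns-single N (inverseᵇ σ) (σ⁻¹ σ) x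
                    (λ τ e → inverse-unique (inverseᵇ-true σ τ e) (isPermᵇ⇒σ⁻¹ σ p))
                    (λ τ e → true-inverseᵇ (inverse-≗ (isPermᵇ⇒σ⁻¹ σ p) e))

    inverseᵇ-sym : ∀ σ τ → inverseᵇ {N} σ τ ≡ inverseᵇ τ σ
    inverseᵇ-sym σ τ = bool-ext (λ e → true-inverseᵇ (swap-inverse (inverseᵇ-true σ τ e)))
                                (λ e → true-inverseᵇ (swap-inverse (inverseᵇ-true τ σ e)))

  -- Both sides are the sum of `ψ (values τ)` over pairs of mutually inverse functions σ and τ,
  -- taken in the two orders; each permutation has a single partner in the list, any other map none.
  reindex-inverse : ∀ ψ → Σₗ (allFuns N N) (λ σ → isPermᵇ σ · ψ (values (σ⁻¹ σ)))
                        ≈ Σₗ (allFuns N N) (λ σ → isPermᵇ σ · ψ (values σ))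
  reindex-inverse ψ = begin
    Σₗ (allFuns N N) (λ σ → isPermᵇ σ · ψ (values (σ⁻¹ σ)))
      ≈⟨ Σₗ-cong (allFuns N N) (λ σ → inverses-sum σ (ψ (values (σ⁻¹ σ)))) ⟨
    Σₗ (allFuns N N) (λ σ → Σₗ (allFuns N N) (λ τ → inverseᵇ σ τ · ψ (values (σ⁻¹ σ))))
      ≈⟨ Σₗ-cong (allFuns N N) (λ σ → Σₗ-cong (allFuns N N) λ τ → ·-cong {inverseᵇ σ τ} refl λ e →
           let inv = inverseᵇ-true σ τ e in
           ≈-reflexive (cong ψ (tabulate-cong λ i → cong toℕ (σ⁻¹≡ inv i)))) ⟩
    Σₗ (allFuns N N) (λ σ → Σₗ (allFuns N N) (λ τ → inverseᵇ σ τ · ψ (values τ)))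
      ≈⟨ Σₗ-swap (allFuns N N) (allFuns N N) (λ σ τ → inverseᵇ σ τ · ψ (values τ)) ⟩
    Σₗ (allFuns N N) (λ τ → Σₗ (allFuns N N) (λ σ → inverseᵇ σ τ · ψ (values τ)))
      ≈⟨ Σₗ-cong (allFuns N N) (λ τ → ≈-trans
           (Σₗ-cong (allFuns N N) λ σ → ≈-reflexive (cong (_· ψ (values τ)) (inverseᵇ-sym σ τ)))
           (inverses-sum τ (ψ (values τ)))) ⟩
    Σₗ (allFuns N N) (λ τ → isPermᵇ τ · ψ (values τ)) ∎

-- The two polynomials as state sums

module DPermutationSums {ℓ₁ ℓ₂ : Level} (R : CommutativeRing ℓ₁ ℓ₂)
  (lam : CommutativeRing.Carrier R) (a : ℕ → CommutativeRing.Carrier R)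
  (b c d : ℕ → ℕ → CommutativeRing.Carrier R) (e f : ℕ → CommutativeRing.Carrier R) where
  open RingSums R
  open FunctionSums R
  open Factors R lam
  open Parity R lam a b c d e f
  open Defs.Ring R using (weight; weight′; Qhat; Qhat′; Tfrac; δ; α)
  open SetoidReasoning setoid

  module _ {n : ℕ} {σ τ : Fin (2 * n) → Fin (2 * n)} (inv : InverseFuns σ τ) where
    private
      N = 2 * n
      s t : ℕ → ℕ
      s = ext σ
      t = ext τ
      inv′ = swap-inverse inv
      open Inverses (ext-inverses inv)

      fixed⇒ : ∀ i → s (toℕ i) ≡ toℕ i → t (toℕ i) ≡ toℕ i
      fixed⇒ i e = trans (cong t (sym e)) (ts (toℕ i) (Fin.toℕ<n i))

      ⇒fixed : ∀ i → t (toℕ i) ≡ toℕ i → s (toℕ i) ≡ toℕ i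
      ⇒fixed i e = trans (cong s (sym e)) (st (toℕ i) (Fin.toℕ<n i))

      fixed-σ : ∀ i → s (toℕ i) ≡ toℕ i → σ i ≡ i
      fixed-σ i e = Fin.toℕ-injective (trans (sym (ext-toℕ σ i)) e)

      parity : ∀ (i : Fin N) r → suc (toℕ i) + r ≡ N → isEvenᵇ r ≡ isEvenᵇ (suc (toℕ i))
      parity i r eq = isEvenᵇ-complement n (suc (toℕ i)) r eq

      if-cong : ∀ {b b′ : Bool} {x x′ y y′ : Carrier} → b ≡ b′ → x ≡ x′ → y ≡ y′ →
                (if b then x else y) ≈ (if b′ then x′ else y′)
      if-cong refl refl refl = ≈-refl

      minimal-τ : ∀ i → t (toℕ i) < toℕ i → isCycleMin σ i ≡ false
      minimal-τ i tx<x = trans (isCycleMin-inverse inv i) (cycleMin-below inv′ i tx<x)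

      with-minimal : ∀ {m} i {S T ev xv xp xf xr xe xo y} → isCycleMin σ i ≡ m →
        factor m (toℕ i) S T ev xv xp xf xr xe xo ≈ y → factor (isCycleMin σ i) (toℕ i) S T ev xv xp xf xr xe xo ≈ y
      with-minimal i refl h = h

    module Unprimed where
      open LocalWeights R lam A (even b) (even c) (odd d) F
      open StateSums R lam A (even b) (even c) (odd d) F using (loc; W)

      loc≈factor : ∀ i r → suc (toℕ i) + r ≡ N →
        loc (toℕ i) (s (toℕ i)) (segment s (suc (toℕ i)) r)
        ≈ factor (isCycleMin σ i) (toℕ i) (s (toℕ i)) (t (toℕ i)) (isEvenᵇ (pos i))
            (a (ucross σ i + unest σ i)) (b (lcross σ i) (lnest σ i)) (c (lcross σ i) (lnest σ i))
            (d (ucross σ i) (unest σ i)) (e (psnest σ i)) (f (psnest σ i))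
      loc≈factor i r eq with <-cmp (s (toℕ i)) (toℕ i) | <-cmp (t (toℕ i)) (toℕ i)
      ... | tri< sx<x _ _ | tri< tx<x _ _ = ≈-trans (≈-reflexive (loc-peak inv i r eq sx<x tx<x))
            (≈-sym (with-minimal i (cycleMin-below inv i sx<x)
              (≈-trans (factor-peak _ _ _ _ _ _ _ sx<x tx<x) (if-cong (sym (parity i r eq)) refl refl))))
      ... | tri< sx<x _ _ | tri> _ _ x<tx = ≈-trans (≈-reflexive (loc-fall inv i r eq sx<x x<tx))
            (≈-sym (with-minimal i (cycleMin-below inv i sx<x)
              (≈-trans (factor-fall _ _ _ _ _ _ _ sx<x x<tx) (if-cong (sym (parity i r eq)) refl refl))))
      ... | tri> _ _ x<sx | tri< tx<x _ _ = ≈-trans (≈-reflexive (loc-rise inv i r eq x<sx tx<x))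
            (≈-sym (with-minimal i (minimal-τ i tx<x)
              (≈-trans (factor-rise _ _ _ _ _ _ _ x<sx tx<x) (if-cong (sym (parity i r eq)) refl refl))))
      ... | tri> _ _ x<sx | tri> _ _ x<tx = ≈-trans (≈-reflexive (loc-val inv i r eq x<sx x<tx))
            (≈-sym (≈-trans (factor-val _ _ _ _ _ _ _ (isCycleMin σ i) x<sx x<tx)
              (⊛-congˡ (if-cong (sym (parity i r eq)) refl refl))))
      ... | tri≈ _ sx≡x _ | _ = ≈-trans (≈-reflexive (loc-fixed inv i r eq sx≡x))
            (≈-sym (with-minimal i (cycleMin-fixed inv i sx≡x)
              (≈-trans (factor-fixed _ _ _ _ _ _ _ sx≡x (fixed⇒ i sx≡x)) (⊛-congˡ (if-cong (sym (parity i r eq))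
                (cong e (sym (psnest-inverse inv i (fixed-σ i sx≡x)))) (cong f (sym (psnest-inverse inv i (fixed-σ i sx≡x)))))))))
      ... | tri< _ sx≢x _ | tri≈ _ tx≡x _ = ⊥-elim (sx≢x (⇒fixed i tx≡x))
      ... | tri> _ sx≢x _ | tri≈ _ tx≡x _ = ⊥-elim (sx≢x (⇒fixed i tx≡x))

      weight≈W : isDᵇ σ · weight lam a b c d e f σ ≈ W 0 (values σ)
      weight≈W = ≈-trans (weight-factors inv _ _ _ _ _ _) (≈-sym (≈-trans
        (≈-reflexive (cong (W 0) (values-ext σ))) (W-segment s N 0 id _ loc≈factor)))

    module Primed where
      open LocalWeights R lam A (even b) (odd d) (even c) F
      open StateSums R lam A (even b) (odd d) (even c) F using (loc; W)

      -- The state weight is read off the inverse τ, whose double falls are the double rises of σ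
      -- and conversely; hence `odd d` stands in the place of `C` and `even c` in that of `D`.
      loc≈factor : ∀ i r → suc (toℕ i) + r ≡ N →
        loc (toℕ i) (t (toℕ i)) (segment t (suc (toℕ i)) r)
        ≈ factor (isCycleMin σ i) (toℕ i) (s (toℕ i)) (t (toℕ i)) (isEvenᵇ (pos i))
            (a (lcross′ σ i + lnest′ σ i)) (b (ucross′ σ i) (unest′ σ i)) (c (lcross′ σ i) (lnest′ σ i))
            (d (ucross′ σ i) (unest′ σ i)) (e (psnest σ i)) (f (psnest σ i))
      loc≈factor i r eq with <-cmp (s (toℕ i)) (toℕ i) | <-cmp (t (toℕ i)) (toℕ i)
      ... | tri< sx<x _ _ | tri< tx<x _ _ = ≈-trans (≈-reflexive (loc-peak inv′ i r eq tx<x sx<x))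
            (≈-sym (with-minimal i (cycleMin-below inv i sx<x)
              (≈-trans (factor-peak _ _ _ _ _ _ _ sx<x tx<x)
                (if-cong (sym (parity i r eq)) (cong₂ b (ucross′≡ inv i) (unest′≡ inv i)) refl))))
      ... | tri< sx<x _ _ | tri> _ _ x<tx = ≈-trans (≈-reflexive (loc-rise inv′ i r eq x<tx sx<x))
            (≈-sym (with-minimal i (cycleMin-below inv i sx<x)
              (≈-trans (factor-fall _ _ _ _ _ _ _ sx<x x<tx)
                (if-cong (sym (parity i r eq)) (cong₂ c (lcross′≡ inv i) (lnest′≡ inv i)) refl))))
      ... | tri> _ _ x<sx | tri< tx<x _ _ = ≈-trans (≈-reflexive (loc-fall inv′ i r eq tx<x x<sx))
            (≈-sym (with-minimal i (minimal-τ i tx<x)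
              (≈-trans (factor-rise _ _ _ _ _ _ _ x<sx tx<x)
                (if-cong (sym (parity i r eq)) refl (cong₂ d (ucross′≡ inv i) (unest′≡ inv i))))))
      ... | tri> _ _ x<sx | tri> _ _ x<tx = ≈-trans (≈-reflexive (loc-val inv′ i r eq x<tx x<sx))
            (≈-sym (≈-trans (factor-val _ _ _ _ _ _ _ (isCycleMin σ i) x<sx x<tx)
              (⊛-cong (≈-reflexive (cong (λ m → (m or1) lam) (isCycleMin-inverse inv i)))
                (if-cong (sym (parity i r eq)) refl (cong a (cong₂ _+_ (lcross′≡ inv i) (lnest′≡ inv i)))))))
      ... | tri≈ _ sx≡x _ | _ = ≈-trans (≈-reflexive (loc-fixed inv′ i r eq (fixed⇒ i sx≡x)))
            (≈-sym (with-minimal i (cycleMin-fixed inv i sx≡x)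
              (≈-trans (factor-fixed _ _ _ _ _ _ _ sx≡x (fixed⇒ i sx≡x)) (⊛-congˡ (if-cong (sym (parity i r eq)) refl refl)))))
      ... | tri< _ sx≢x _ | tri≈ _ tx≡x _ = ⊥-elim (sx≢x (⇒fixed i tx≡x))
      ... | tri> _ sx≢x _ | tri≈ _ tx≡x _ = ⊥-elim (sx≢x (⇒fixed i tx≡x))

      weight′≈W : isDᵇ σ · weight′ lam a b c d e f σ ≈ W 0 (values τ)
      weight′≈W = ≈-trans (weight-factors inv _ _ _ _ _ _) (≈-sym (≈-trans
        (≈-reflexive (cong (W 0) (values-ext τ))) (W-segment t N 0 id _ loc≈factor)))

  private
    inj≡isPermᵇ : ∀ {N} (σ : Fin N → Fin N) → isPermᵇ σ ≡ inj (values σ) ∧ true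
    inj≡isPermᵇ σ = sym (trans (∧-identityʳ _) (inj-values σ))

  Qhat-convergent : ∀ n m → n ≤ m →
    Qhat lam a b c d e f n ≈ Tfrac (δ lam a b c d e f) (α lam a b c d e f) 1 m n
  Qhat-convergent n m n≤m = begin
    Σₗ (filterᵇ (λ σ → isPermᵇ σ ∧ isDᵇ σ) (allFuns N N)) (weight lam a b c d e f)
      ≈⟨ Σₗ-filter (λ σ → isPermᵇ σ ∧ isDᵇ σ) (allFuns N N) (weight lam a b c d e f) ⟩
    Σₗ (allFuns N N) (λ σ → (isPermᵇ σ ∧ isDᵇ σ) · weight lam a b c d e f σ)
      ≈⟨ Σₗ-cong (allFuns N N) (λ σ → ≈-trans (≈-reflexive (sym (·-· (isPermᵇ σ) (isDᵇ σ) _)))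
           (≈-trans (·-cong {isPermᵇ σ} refl λ p → Unprimed.weight≈W {n} (isPermᵇ⇒σ⁻¹ σ p))
                    (≈-reflexive (cong (_· W 0 (values σ)) (inj≡isPermᵇ σ))))) ⟩
    Σₗ (allFuns N N) (λ σ → (inj (values σ) ∧ true) · W 0 (values σ))
      ≈⟨ Σₗ-allFuns N N (λ g → (inj g ∧ true) · W 0 g) ⟩
    Z N 0
      ≈⟨ state-sum-convergent (even c) (odd d) levels n m n≤m ⟩
    Tfrac (δ lam a b c d e f) (α lam a b c d e f) 1 m n ∎
    where
    N = 2 * n
    open StateSums R lam A (even b) (even c) (odd d) F using (W; Z)
    levels : ∀ m k → diag (even c m) k ⊕ diag (odd d m) k ≈ (if isEvenᵇ m then diag c k else diag d k)
    levels m k = ≈-trans (⊕-cong (diag-even c m k) (diag-odd d m k)) (collect (isEvenᵇ m))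
      where
      collect : ∀ v {x y} → (if v then x else 0#) ⊕ (if v then 0# else y) ≈ (if v then x else y)
      collect true  = ⊕-identityʳ _
      collect false = ⊕-identityˡ _

  Qhat′-convergent : ∀ n m → n ≤ m →
    Qhat′ lam a b c d e f n ≈ Tfrac (δ lam a b c d e f) (α lam a b c d e f) 1 m n
  Qhat′-convergent n m n≤m = begin
    Σₗ (filterᵇ (λ σ → isPermᵇ σ ∧ isDᵇ σ) (allFuns N N)) (weight′ lam a b c d e f)
      ≈⟨ Σₗ-filter (λ σ → isPermᵇ σ ∧ isDᵇ σ) (allFuns N N) (weight′ lam a b c d e f) ⟩
    Σₗ (allFuns N N) (λ σ → (isPermᵇ σ ∧ isDᵇ σ) · weight′ lam a b c d e f σ)
      ≈⟨ Σₗ-cong (allFuns N N) (λ σ → ≈-trans (≈-reflexive (sym (·-· (isPermᵇ σ) (isDᵇ σ) _)))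
           (·-cong {isPermᵇ σ} refl λ p → Primed.weight′≈W {n} (isPermᵇ⇒σ⁻¹ σ p))) ⟩
    Σₗ (allFuns N N) (λ σ → isPermᵇ σ · W 0 (values (σ⁻¹ σ)))
      ≈⟨ InverseSums.reindex-inverse R N (W 0) ⟩
    Σₗ (allFuns N N) (λ σ → isPermᵇ σ · W 0 (values σ))
      ≈⟨ Σₗ-cong (allFuns N N) (λ σ → ≈-reflexive (cong (_· W 0 (values σ)) (inj≡isPermᵇ σ))) ⟩
    Σₗ (allFuns N N) (λ σ → (inj (values σ) ∧ true) · W 0 (values σ))
      ≈⟨ Σₗ-allFuns N N (λ g → (inj g ∧ true) · W 0 g) ⟩
    Z N 0
      ≈⟨ state-sum-convergent (odd d) (even c) levels n m n≤m ⟩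
    Tfrac (δ lam a b c d e f) (α lam a b c d e f) 1 m n ∎
    where
    N = 2 * n
    open StateSums R lam A (even b) (odd d) (even c) F using (W; Z)
    levels : ∀ m k → diag (odd d m) k ⊕ diag (even c m) k ≈ (if isEvenᵇ m then diag c k else diag d k)
    levels m k = ≈-trans (⊕-cong (diag-odd d m k) (diag-even c m k)) (collect (isEvenᵇ m))
      where
      collect : ∀ v {x y} → (if v then 0# else y) ⊕ (if v then x else 0#) ≈ (if v then x else y)
      collect true  = ⊕-identityˡ _
      collect false = ⊕-identityʳ _

theorem4p7 : ∀ {c ℓ : Level} (R : CommutativeRing c ℓ) →
    let open CommutativeRing R
        open Defs.Ring R
    in (lam : Carrier) (a : ℕ → Carrier) (b c′ d : ℕ → ℕ → Carrier) (e f : ℕ → Carrier) →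
      -- Σ_n Q̂′_n t^n equals the T-fraction: the n-th coefficient of Q̂′
      -- agrees with that of every convergent of depth m ≥ n
      (∀ n m → n ≤ m →
        Qhat′ lam a b c′ d e f n ≈ Tfrac (δ lam a b c′ d e f) (α lam a b c′ d e f) 1 m n)
      -- the same T-fraction for Q̂_n
      × (∀ n m → n ≤ m →
        Qhat lam a b c′ d e f n ≈ Tfrac (δ lam a b c′ d e f) (α lam a b c′ d e f) 1 m n)
      -- hence Q̂′_n = Q̂_n
      × (∀ n → Qhat′ lam a b c′ d e f n ≈ Qhat lam a b c′ d e f n)
theorem4p7 R lam a b c d e f =
  Qhat′-convergent , Qhat-convergent , λ n → ≈-trans (Qhat′-convergent n n ≤-refl) (≈-sym (Qhat-convergent n n ≤-refl))
  where
  open RingSums R using (≈-trans; ≈-sym)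
  open DPermutationSums R lam a b c d e f
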